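{- Let $q_n\in(0,1]$, $n=1,2,\dots$, with $q_n\to0$ as $n\to\infty$, and for each $n$ consider $q_n$-proportion Bulgarian solitaire on $n$ cards. (i) If $q_n^2n\to0$, then the recurrent configurations have a triangular limit shape, namely $\phi(x)=\max(1-x/2,\,0)$. (ii) If $q_n^2n\to\infty$, then the recurrent configurations have an exponential limit shape, namely $\phi(x)=e^{ -x}$.
   Context: A configuration of $n$ cards is an integer partition $\lambda=(\lambda_1\ge\lambda_2\ge\cdots\ge\lambda_\ell>0)$ of $n$, extended by $\lambda_i=0$ for $i>\ell$; $\mathcal{P}(n)$ denotes the set of these. In a move of $q$-proportion Bulgarian solitaire ($q\in(0,1]$), $\lceil qh\rceil$ cards are picked from each nonempty pile of size $h$, all picked cards together form one new pile, and the resulting piles are sorted in weakly decreasing order (empty piles being discarded). Let $f_n:\mathcal{P}(n)\to\mathcal{P}(n)$ be the map given by one move of $q_n$-proportion Bulgarian solitaire. A configuration $\lambda\in\mathcal{P}(n)$ is recurrent if $f_n^k(\lambda)=\lambda$ for some positive integer $k$. For a partition $\lambda$ of $n$, the downscaled diagram-boundary function is $\partial\lambda(x)=\frac{1}{\lambda_1}\lambda_{\lfloor xn/\lambda_1\rfloor+1}$ for $x\ge0$. A function $\phi$ is a limit shape of recurrent configurations if, for every choice of recurrent configurations $\lambda^{(n)}$ of $f_n$ ($n=1,2,\dots$), $\partial\lambda^{(n)}(x)\to\phi(x)$ as $n\to\infty$ for all $x>0$. -}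

module Defs where

open import Data.Nat.Base as ℕ using (ℕ; zero; suc; NonZero)
import Data.Nat.Properties as ℕ
open import Data.Nat.GeneralisedArithmetic using (fold)
open import Data.Integer.Base as ℤ using (+_; -[1+_])
import Data.Integer.Properties as ℤ
open import Data.Rational.Base as ℚ using (ℚ; 0ℚ; 1ℚ; ½)
import Data.Rational.Properties as ℚ
import Data.Rational.Unnormalised.Base as ℚᵘ
import Data.Rational.Unnormalised.Properties as ℚᵘ
open import Data.Rational.Solver using (module +-*-Solver)
open import Data.Nat.ListAction using (sum)
open import Data.List.Base using (List; []; _∷_; zipWith; filter)
open import Data.List.Relation.Unary.All using (All; []; _∷_)
open import Data.List.Relation.Unary.Linked using (Linked)
open import Data.List.Relation.Binary.Pointwise.Base using (Pointwise)
open import Data.List.Relation.Binary.Permutation.Propositional using (_↭_)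
open import Data.Product.Base using (∃; ∃-syntax; _×_; _,_; proj₁; proj₂)
open import Data.Sum.Base using (inj₁; inj₂)
open import Relation.Nullary using (¬_; recompute)
open import Relation.Binary.PropositionalEquality

module Rat where
  open import Data.Rational.Base hiding (NonZero)
  open ℚ.≤-Reasoning
  open +-*-Solver

  dist : ℚ → ℚ → ℚ
  dist p q = ∣ p - q ∣

  dist-comm : ∀ p q → dist p q ≡ dist q p
  dist-comm p q = trans (sym (ℚ.∣-p∣≡∣p∣ (p - q)))
    (cong ∣_∣ (solve 2 (λ p q → :- (p :- q) := q :- p) refl p q))

  dist-triangle : ∀ p q r → dist p r ≤ dist p q + dist q r
  dist-triangle p q r = subst (λ t → ∣ t ∣ ≤ dist p q + dist q r)
    (solve 3 (λ p q r → (p :- q) :+ (q :- r) := p :- r) refl p q r)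
    (ℚ.∣p+q∣≤∣p∣+∣q∣ (p - q) (q - r))

  half+half : ∀ p → ½ * p + ½ * p ≡ p
  half+half = solve 1 (λ p → con ½ :* p :+ con ½ :* p := p) refl

  half-pos : ∀ {p} → 0ℚ < p → 0ℚ < ½ * p
  half-pos 0<p = ℚ.*-monoʳ-<-pos ½ 0<p

  <-halves : ∀ {p q ε} → p < ½ * ε → q < ½ * ε → p + q < ε
  <-halves {ε = ε} p<ε/2 q<ε/2 = subst (_ <_) (half+half ε) (ℚ.+-mono-< p<ε/2 q<ε/2)

  dist-+ : ∀ p q r s → dist (p + q) (r + s) ≤ dist p r + dist q s
  dist-+ p q r s = subst (λ t → ∣ t ∣ ≤ dist p r + dist q s)
    (solve 4 (λ p q r s → (p :- r) :+ (q :- s) := (p :+ q) :- (r :+ s)) refl p q r s)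
    (ℚ.∣p+q∣≤∣p∣+∣q∣ (p - r) (q - s))

  dist-neg : ∀ p q → dist (- p) (- q) ≡ dist p q
  dist-neg p q = trans (sym (ℚ.∣-p∣≡∣p∣ _))
    (cong ∣_∣ (solve 2 (λ p q → :- ((:- p) :- (:- q)) := p :- q) refl p q))

  p≤∣p∣ : ∀ p → p ≤ ∣ p ∣
  p≤∣p∣ p with ℚ.≤-total 0ℚ p
  ... | inj₁ 0≤p = ℚ.≤-reflexive (sym (ℚ.0≤p⇒∣p∣≡p 0≤p))
  ... | inj₂ p≤0 = ℚ.≤-trans p≤0 (ℚ.0≤∣p∣ p)

  p≤q+dist : ∀ p q → p ≤ q + dist p q
  p≤q+dist p q = begin
    p             ≡⟨ solve 2 (λ p q → p := q :+ (p :- q)) refl p q ⟩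
    q + (p - q)   ≤⟨ ℚ.+-monoʳ-≤ q (p≤∣p∣ (p - q)) ⟩
    q + dist p q  ∎

  dist-< : ∀ {p q ε} → p < q + ε → q < p + ε → dist p q < ε
  dist-< {p} {q} {ε} p<q+ε q<p+ε with ℚ.∣p∣≡p∨∣p∣≡-p (p - q)
  ... | inj₁ eq = begin-strict
    dist p q     ≡⟨ eq ⟩
    p - q        <⟨ ℚ.+-monoˡ-< (- q) p<q+ε ⟩
    q + ε - q    ≡⟨ solve 2 (λ q ε → (q :+ ε) :- q := ε) refl q ε ⟩
    ε            ∎
  ... | inj₂ eq = begin-strict
    dist p q     ≡⟨ eq ⟩
    - (p - q)    ≡⟨ solve 2 (λ p q → :- (p :- q) := q :- p) refl p q ⟩
    q - p        <⟨ ℚ.+-monoˡ-< (- p) q<p+ε ⟩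
    p + ε - p    ≡⟨ solve 2 (λ q ε → (q :+ ε) :- q := ε) refl p ε ⟩
    ε            ∎

  dist⇒< : ∀ {p q ε} → dist p q < ε → p < q + ε
  dist⇒< {p} {q} d<ε = ℚ.≤-<-trans (p≤q+dist p q) (ℚ.+-monoʳ-< q d<ε)

  ⊔-< : ∀ {p q r s ε} → dist p r < ε → dist q s < ε → p ⊔ q < (r ⊔ s) + ε
  ⊔-< {p} {q} {r} {s} {ε} d₁ d₂ with ℚ.⊔-sel p q
  ... | inj₁ eq = subst (_< (r ⊔ s) + ε) (sym eq)
        (ℚ.<-≤-trans (dist⇒< d₁) (ℚ.+-monoˡ-≤ ε (ℚ.p≤p⊔q r s)))
  ... | inj₂ eq = subst (_< (r ⊔ s) + ε) (sym eq)
        (ℚ.<-≤-trans (dist⇒< d₂) (ℚ.+-monoˡ-≤ ε (ℚ.p≤q⊔p r s)))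

  dist-⊔ : ∀ {p q r s ε} → dist p r < ε → dist q s < ε → dist (p ⊔ q) (r ⊔ s) < ε
  dist-⊔ {p} {q} {r} {s} d₁ d₂ = dist-< (⊔-< {p} {q} {r} {s} d₁ d₂)
    (⊔-< {r} {s} {p} {q} (subst (_< _) (dist-comm p r) d₁) (subst (_< _) (dist-comm q s) d₂))

  ∣∣≤dist+∣∣ : ∀ p q → ∣ p ∣ ≤ dist p q + ∣ q ∣
  ∣∣≤dist+∣∣ p q = subst (λ t → ∣ t ∣ ≤ dist p q + ∣ q ∣)
    (solve 2 (λ p q → (p :- q) :+ q := p) refl p q) (ℚ.∣p+q∣≤∣p∣+∣q∣ (p - q) q)

  *-mono-nonNeg : ∀ {p q r s} → 0ℚ ≤ p → 0ℚ ≤ s → p ≤ q → r ≤ s → p * r ≤ q * s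
  *-mono-nonNeg {p} {q} {r} {s} 0≤p 0≤s p≤q r≤s = ℚ.≤-trans
    (ℚ.*-monoˡ-≤-nonNeg p {{nonNegative 0≤p}} r≤s)
    (ℚ.*-monoʳ-≤-nonNeg s {{nonNegative 0≤s}} p≤q)

  dist-* : ∀ {p q r s B C δ η} → 0ℚ ≤ C → 0ℚ ≤ η → dist p r ≤ δ → dist q s ≤ η →
           ∣ q ∣ ≤ C → ∣ r ∣ ≤ B → dist (p * q) (r * s) ≤ δ * C + B * η
  dist-* {p} {q} {r} {s} {B} {C} {δ} {η} 0≤C 0≤η d₁ d₂ q≤C r≤B = begin
    ∣ p * q - r * s ∣
      ≡⟨ cong ∣_∣ (solve 4 (λ p q r s → p :* q :- r :* s := (p :- r) :* q :+ r :* (q :- s)) refl p q r s) ⟩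
    ∣ (p - r) * q + r * (q - s) ∣
      ≤⟨ ℚ.∣p+q∣≤∣p∣+∣q∣ ((p - r) * q) (r * (q - s)) ⟩
    ∣ (p - r) * q ∣ + ∣ r * (q - s) ∣
      ≡⟨ cong₂ _+_ (ℚ.∣p*q∣≡∣p∣*∣q∣ (p - r) q) (ℚ.∣p*q∣≡∣p∣*∣q∣ r (q - s)) ⟩
    dist p r * ∣ q ∣ + ∣ r ∣ * dist q s
      ≤⟨ ℚ.+-mono-≤ (*-mono-nonNeg (ℚ.0≤∣p∣ _) 0≤C d₁ q≤C) (*-mono-nonNeg (ℚ.0≤∣p∣ r) 0≤η r≤B d₂) ⟩
    δ * C + B * η ∎

  ∃-scale : ∀ {B ε} → 0ℚ < B → 0ℚ < ε → ∃[ δ ] 0ℚ < δ × δ * B + B * δ < ε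
  ∃-scale {B} {ε} 0<B 0<ε = δ , 0<δ , (begin-strict
    δ * B + B * δ          ≡⟨ solve 4 (λ h e i b → h :* (h :* e) :* i :* b :+ b :* (h :* (h :* e) :* i)
                                          := (h :* (h :* e) :+ h :* (h :* e)) :* (i :* b)) refl ½ ε (1/ B) B ⟩
    (½ * (½ * ε) + ½ * (½ * ε)) * (1/ B * B)
                           ≡⟨ cong₂ _*_ (half+half (½ * ε)) (ℚ.*-inverseˡ B) ⟩
    ½ * ε * 1ℚ             ≡⟨ ℚ.*-identityʳ (½ * ε) ⟩
    ½ * ε                  ≡⟨ ℚ.+-identityʳ (½ * ε) ⟨
    ½ * ε + 0ℚ             <⟨ ℚ.+-monoʳ-< (½ * ε) (half-pos 0<ε) ⟩
    ½ * ε + ½ * ε          ≡⟨ half+half ε ⟩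
    ε                      ∎)
    where
    instance _ = positive 0<B
             _ = ℚ.pos⇒nonZero B
             _ = ℚ.1/pos⇒pos B
    δ = ½ * (½ * ε) * 1/ B
    0<δ : 0ℚ < δ
    0<δ = subst (_< δ) (ℚ.*-zeroˡ (1/ B)) (ℚ.*-monoˡ-<-pos (1/ B) (half-pos (half-pos 0<ε)))

  below-ℕ : ∀ p → ∃[ n ] p < + n / 1
  below-ℕ p@record{} = n , ℚ.toℚᵘ-cancel-<
    (ℚᵘ.<-respʳ-≃ (ℚᵘ.≃-sym (ℚ.toℚᵘ-fromℚᵘ (ℚᵘ.mkℚᵘ (+ n) 0))) (ℚᵘ.*<* lt))
    where
    n = suc ℤ.∣ ↥ p ∣
    i≤∣i∣ : ∀ i → i ℤ.≤ + ℤ.∣ i ∣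
    i≤∣i∣ (+ _)    = ℤ.≤-refl
    i≤∣i∣ -[1+ _ ] = ℤ.-≤+
    lt : ↥ p ℤ.* + 1 ℤ.< + n ℤ.* ↧ p
    lt = ℤ.<-≤-trans
      (subst (ℤ._< + n) (sym (ℤ.*-identityʳ (↥ p)))
        (ℤ.≤-<-trans (i≤∣i∣ (↥ p)) (ℤ.+<+ ℕ.≤-refl)))
      (subst (+ n ℤ.≤_) (ℤ.pos-* n (↧ₙ p)) (ℤ.+≤+ (ℕ.m≤m*n n (↧ₙ p))))

  /1-mono-≤ : ∀ {m n} → m ℕ.≤ n → + m / 1 ≤ + n / 1
  /1-mono-≤ {m} {n} m≤n = ℚ.toℚᵘ-cancel-≤
    (ℚᵘ.≤-respʳ-≃ (ℚᵘ.≃-sym (ℚ.toℚᵘ-fromℚᵘ (ℚᵘ.mkℚᵘ (+ n) 0)))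
    (ℚᵘ.≤-respˡ-≃ (ℚᵘ.≃-sym (ℚ.toℚᵘ-fromℚᵘ (ℚᵘ.mkℚᵘ (+ m) 0)))
      (ℚᵘ.*≤* (ℤ.*-monoʳ-≤-nonNeg (+ 1) (ℤ.+≤+ m≤n)))))

  n*1/n≡1 : ∀ k → (+ suc k / 1) * (+ 1 / suc k) ≡ 1ℚ
  n*1/n≡1 k = ℚ.toℚᵘ-injective (ℚᵘ.≃-trans (ℚ.toℚᵘ-homo-* (+ suc k / 1) (+ 1 / suc k))
    (ℚᵘ.≃-trans
      (ℚᵘ.*-cong (ℚ.toℚᵘ-fromℚᵘ (ℚᵘ.mkℚᵘ (+ suc k) 0)) (ℚ.toℚᵘ-fromℚᵘ (ℚᵘ.mkℚᵘ (+ 1) k)))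
      (ℚᵘ.*≡* (cong (λ m → + suc m) (trans (ℕ.*-identityʳ (k ℕ.* 1)) (trans (ℕ.*-identityʳ k)
        (sym (trans (ℕ.+-identityʳ (k ℕ.+ 0)) (ℕ.+-identityʳ k)))))))))

  suc/1 : ∀ n → + suc n / 1 ≡ 1ℚ + + n / 1
  suc/1 n = sym (ℚ.toℚᵘ-injective (ℚᵘ.≃-trans (ℚ.toℚᵘ-homo-+ 1ℚ (+ n / 1))
    (ℚᵘ.≃-trans (ℚᵘ.+-cong (ℚᵘ.≃-refl {ℚᵘ.1ℚᵘ}) (ℚ.toℚᵘ-fromℚᵘ (ℚᵘ.mkℚᵘ (+ n) 0)))
    (ℚᵘ.≃-trans (ℚᵘ.*≡* (cong (λ i → (+ 1 ℤ.+ i) ℤ.* + 1) (ℤ.*-identityʳ (+ n))))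
    (ℚᵘ.≃-sym (ℚ.toℚᵘ-fromℚᵘ (ℚᵘ.mkℚᵘ (+ suc n) 0)))))))

  halve : ℚ → ℕ → ℚ
  halve C zero    = C
  halve C (suc j) = ½ * halve C j

  halve-½ : ∀ C j → halve (½ * C) j ≡ halve C (suc j)
  halve-½ C zero    = refl
  halve-½ C (suc j) = cong (½ *_) (halve-½ C j)

  halve-nonNeg : ∀ {C} → 0ℚ ≤ C → ∀ j → 0ℚ ≤ halve C j
  halve-nonNeg 0≤C zero    = 0≤C
  halve-nonNeg 0≤C (suc j) = ℚ.*-monoˡ-≤-nonNeg ½ (halve-nonNeg 0≤C j)

  halve-step : ∀ b {C ε} → 0ℚ < ε → C < (+ suc (suc b) / 1) * ε → ½ * C < (+ suc b / 1) * ε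
  halve-step b {C} {ε} 0<ε C<bε = begin-strict
    ½ * C                          <⟨ ℚ.*-monoʳ-<-pos ½ C<bε ⟩
    ½ * ((+ suc (suc b) / 1) * ε)  ≡⟨ cong (λ t → ½ * (t * ε)) (suc/1 (suc b)) ⟩
    ½ * ((1ℚ + c) * ε)             ≡⟨ cong (½ *_) (ℚ.*-distribʳ-+ ε 1ℚ c) ⟩
    ½ * (1ℚ * ε + c * ε)           ≡⟨ ℚ.*-distribˡ-+ ½ (1ℚ * ε) (c * ε) ⟩
    ½ * (1ℚ * ε) + ½ * (c * ε)     ≤⟨ ℚ.+-monoˡ-≤ (½ * (c * ε)) (ℚ.*-monoˡ-≤-nonNeg ½ ε≤cε) ⟩
    ½ * (c * ε) + ½ * (c * ε)      ≡⟨ half+half (c * ε) ⟩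
    c * ε                          ∎
    where
    c = + suc b / 1
    ε≤cε : 1ℚ * ε ≤ c * ε
    ε≤cε = ℚ.*-monoʳ-≤-nonNeg ε {{nonNegative (ℚ.<⇒≤ 0<ε)}} (/1-mono-≤ {1} {suc b} (ℕ.s≤s ℕ.z≤n))

  halve-below : ∀ b {C ε} → 0ℚ < ε → C < (+ b / 1) * ε → ∃[ j ] halve C j < ε
  halve-below zero          {C} {ε} 0<ε C<bε = 0 , ℚ.<-trans (subst (C <_) (ℚ.*-zeroˡ ε) C<bε) 0<ε
  halve-below (suc zero)    {C} {ε} 0<ε C<bε = 0 , subst (C <_) (ℚ.*-identityˡ ε) C<bε
  halve-below (suc (suc b)) {C} {ε} 0<ε C<bε =
    let j , lt = halve-below (suc b) 0<ε (halve-step b 0<ε C<bε)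
    in suc j , subst (_< ε) (halve-½ C j) lt

  halve→0 : ∀ C {ε} → 0ℚ < ε → ∃[ j ] halve C j < ε
  halve→0 C {ε} 0<ε = halve-below b 0<ε
    (subst (_< (+ b / 1) * ε)
      (trans (ℚ.*-assoc C (1/ ε) ε) (trans (cong (C *_) (ℚ.*-inverseˡ ε)) (ℚ.*-identityʳ C)))
      (ℚ.*-monoˡ-<-pos ε C/ε<b))
    where
    instance _ = positive 0<ε
             _ = ℚ.pos⇒nonZero ε
    b = proj₁ (below-ℕ (C * 1/ ε))
    C/ε<b : C * 1/ ε < + b / 1
    C/ε<b = proj₂ (below-ℕ (C * 1/ ε))

  tail-bound : (g h : ℕ → ℚ) → (∀ i → 0ℚ ≤ h i) → (∀ i → h (suc i) + h (suc i) ≡ h i) →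
               (∀ i → dist (g i) (g (suc i)) ≤ h (suc i)) →
               ∀ j i → dist (g i) (g (j ℕ.+ i)) ≤ h i
  tail-bound g h 0≤h h-half step zero    i =
    ℚ.≤-trans (ℚ.≤-reflexive (cong ∣_∣ (ℚ.+-inverseʳ (g i)))) (0≤h i)
  tail-bound g h 0≤h h-half step (suc j) i = begin
    dist (g i) (g (suc (j ℕ.+ i)))
      ≤⟨ dist-triangle (g i) (g (suc i)) (g (suc (j ℕ.+ i))) ⟩
    dist (g i) (g (suc i)) + dist (g (suc i)) (g (suc (j ℕ.+ i)))
      ≡⟨ cong (λ m → dist (g i) (g (suc i)) + dist (g (suc i)) (g m)) (ℕ.+-suc j i) ⟨
    dist (g i) (g (suc i)) + dist (g (suc i)) (g (j ℕ.+ suc i))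
      ≤⟨ ℚ.+-mono-≤ (step i) (tail-bound g h 0≤h h-half step j (suc i)) ⟩
    h (suc i) + h (suc i)
      ≡⟨ h-half i ⟩
    h i ∎

open Rat using (dist)

-- Cauchy reals: every modulus of convergence is admitted, and equality is _≃_, not _≡_.
record ℝ : Set where
  constructor mkℝ
  field
    seq    : ℕ → ℚ
    cauchy : ∀ {ε} → 0ℚ ℚ.< ε → ∃[ N ] ∀ {m n} → N ℕ.≤ m → N ℕ.≤ n →
             ℚ.∣ seq m ℚ.- seq n ∣ ℚ.< ε
open ℝ public

fromℚ : ℚ → ℝ
fromℚ p .seq    _   = p
fromℚ p .cauchy 0<ε = 0 , λ _ _ → subst (ℚ._< _) (sym (cong ℚ.∣_∣ (ℚ.+-inverseʳ p))) 0<ε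

fromℕ : ℕ → ℝ
fromℕ n = fromℚ (+ n ℚ./ 1)

0ℝ 1ℝ : ℝ
0ℝ = fromℚ 0ℚ
1ℝ = fromℚ 1ℚ

infix  8 -_
infixl 7 _*_
infixl 6 _+_ _-_ _⊔_
infix  4 _<_ _≤_ _≃_ _⟶_ _⟶∞

-- The strict inequality must hold with a uniform gap: termwise `seq x n < seq y n`
-- would not exclude x = y.
_<_ : ℝ → ℝ → Set
x < y = ∃[ δ ] 0ℚ ℚ.< δ × ∃[ N ] ∀ {n} → N ℕ.≤ n → seq x n ℚ.+ δ ℚ.≤ seq y n

_≤_ : ℝ → ℝ → Set
x ≤ y = ¬ (y < x)

_≃_ : ℝ → ℝ → Set
x ≃ y = x ≤ y × y ≤ x

-_ : ℝ → ℝ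
(- x) .seq n = ℚ.- seq x n
(- x) .cauchy 0<ε with cauchy x 0<ε
... | N , close = N , λ {m} {n} N≤m N≤n →
  subst (ℚ._< _) (sym (Rat.dist-neg (seq x m) (seq x n))) (close N≤m N≤n)

_+_ : ℝ → ℝ → ℝ
(x + y) .seq n = seq x n ℚ.+ seq y n
(x + y) .cauchy {ε} 0<ε with cauchy x (Rat.half-pos 0<ε) | cauchy y (Rat.half-pos 0<ε)
... | N₁ , c₁ | N₂ , c₂ = N₁ ℕ.⊔ N₂ , λ {m} {n} N≤m N≤n →
  ℚ.≤-<-trans (Rat.dist-+ (seq x m) (seq y m) (seq x n) (seq y n))
    (Rat.<-halves (c₁ (ℕ.m⊔n≤o⇒m≤o N₁ N₂ N≤m) (ℕ.m⊔n≤o⇒m≤o N₁ N₂ N≤n))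
                  (c₂ (ℕ.m⊔n≤o⇒n≤o N₁ N₂ N≤m) (ℕ.m⊔n≤o⇒n≤o N₁ N₂ N≤n)))

_-_ : ℝ → ℝ → ℝ
x - y = x + - y

_⊔_ : ℝ → ℝ → ℝ
(x ⊔ y) .seq n = seq x n ℚ.⊔ seq y n
(x ⊔ y) .cauchy {ε} 0<ε with cauchy x 0<ε | cauchy y 0<ε
... | N₁ , c₁ | N₂ , c₂ = N₁ ℕ.⊔ N₂ , λ {m} {n} N≤m N≤n →
  Rat.dist-⊔ {seq x m} {seq y m} {seq x n} {seq y n}
    (c₁ (ℕ.m⊔n≤o⇒m≤o N₁ N₂ N≤m) (ℕ.m⊔n≤o⇒m≤o N₁ N₂ N≤n))
    (c₂ (ℕ.m⊔n≤o⇒n≤o N₁ N₂ N≤m) (ℕ.m⊔n≤o⇒n≤o N₁ N₂ N≤n))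

∣_∣ : ℝ → ℝ
∣ x ∣ = x ⊔ - x

bounded : ∀ x → ∃[ B ] 0ℚ ℚ.< B × ∃[ N ] ∀ {n} → N ℕ.≤ n → ℚ.∣ seq x n ∣ ℚ.≤ B
bounded x with cauchy x {1ℚ} (ℚ.positive⁻¹ 1ℚ)
... | N , close = 1ℚ ℚ.+ ℚ.∣ seq x N ∣ ,
  ℚ.+-mono-<-≤ (ℚ.positive⁻¹ 1ℚ) (ℚ.0≤∣p∣ (seq x N)) , N , λ {n} N≤n →
  ℚ.≤-trans (Rat.∣∣≤dist+∣∣ (seq x n) (seq x N))
    (ℚ.+-monoˡ-≤ ℚ.∣ seq x N ∣ (ℚ.<⇒≤ (close N≤n ℕ.≤-refl)))

*-cauchy : ∀ x y {B C δ ε} N₁ N₂ N₃ N₄ → 0ℚ ℚ.< δ → 0ℚ ℚ.< C → δ ℚ.* C ℚ.+ B ℚ.* δ ℚ.< ε →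
  (∀ {n} → N₁ ℕ.≤ n → ℚ.∣ seq x n ∣ ℚ.≤ B) → (∀ {n} → N₂ ℕ.≤ n → ℚ.∣ seq y n ∣ ℚ.≤ C) →
  (∀ {m n} → N₃ ℕ.≤ m → N₃ ℕ.≤ n → dist (seq x m) (seq x n) ℚ.< δ) →
  (∀ {m n} → N₄ ℕ.≤ m → N₄ ℕ.≤ n → dist (seq y m) (seq y n) ℚ.< δ) →
  ∃[ N ] ∀ {m n} → N ℕ.≤ m → N ℕ.≤ n →
    dist (seq x m ℚ.* seq y m) (seq x n ℚ.* seq y n) ℚ.< ε
*-cauchy x y {B} {C} {δ} N₁ N₂ N₃ N₄ 0<δ 0<C lt x≤B y≤C cx cy = N , λ {m} {n} N≤m N≤n →
  ℚ.≤-<-trans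
    (Rat.dist-* {seq x m} {seq y m} {seq x n} {seq y n} {B} {C} {δ} {δ}
      (ℚ.<⇒≤ 0<C) (ℚ.<⇒≤ 0<δ)
      (ℚ.<⇒≤ (cx (le₃ N≤m) (le₃ N≤n))) (ℚ.<⇒≤ (cy (le₄ N≤m) (le₄ N≤n)))
      (y≤C (le₂ N≤m)) (x≤B (le₁ N≤n)))
    lt
  where
  N = (N₁ ℕ.⊔ N₂) ℕ.⊔ (N₃ ℕ.⊔ N₄)
  le₁₂ : ∀ {m} → N ℕ.≤ m → N₁ ℕ.⊔ N₂ ℕ.≤ m
  le₁₂ = ℕ.m⊔n≤o⇒m≤o (N₁ ℕ.⊔ N₂) (N₃ ℕ.⊔ N₄)
  le₃₄ : ∀ {m} → N ℕ.≤ m → N₃ ℕ.⊔ N₄ ℕ.≤ m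
  le₃₄ = ℕ.m⊔n≤o⇒n≤o (N₁ ℕ.⊔ N₂) (N₃ ℕ.⊔ N₄)
  le₁ : ∀ {m} → N ℕ.≤ m → N₁ ℕ.≤ m
  le₁ p = ℕ.m⊔n≤o⇒m≤o N₁ N₂ (le₁₂ p)
  le₂ : ∀ {m} → N ℕ.≤ m → N₂ ℕ.≤ m
  le₂ p = ℕ.m⊔n≤o⇒n≤o N₁ N₂ (le₁₂ p)
  le₃ : ∀ {m} → N ℕ.≤ m → N₃ ℕ.≤ m
  le₃ p = ℕ.m⊔n≤o⇒m≤o N₃ N₄ (le₃₄ p)
  le₄ : ∀ {m} → N ℕ.≤ m → N₄ ℕ.≤ m
  le₄ p = ℕ.m⊔n≤o⇒n≤o N₃ N₄ (le₃₄ p)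

_*_ : ℝ → ℝ → ℝ
(x * y) .seq n = seq x n ℚ.* seq y n
(x * y) .cauchy 0<ε =
  let B , 0<B , N₁ , x≤B = bounded x
      C , 0<C , N₂ , y≤C = bounded y
      D = B ℚ.⊔ C
      0<D = ℚ.<-≤-trans 0<B (ℚ.p≤p⊔q B C)
      δ , 0<δ , lt = Rat.∃-scale {D} 0<D 0<ε
      N₃ , cx = cauchy x 0<δ
      N₄ , cy = cauchy y 0<δ
  in *-cauchy x y {D} {D} N₁ N₂ N₃ N₄ 0<δ 0<D lt
       (λ p → ℚ.≤-trans (x≤B p) (ℚ.p≤p⊔q B C)) (λ p → ℚ.≤-trans (y≤C p) (ℚ.p≤q⊔p B C)) cx cy

_⟶_ : (ℕ → ℝ) → ℝ → Set
u ⟶ ℓ = ∀ ε → 0ℝ < ε → ∃[ N ] ∀ n → N ℕ.≤ n → ∣ u n - ℓ ∣ < ε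

_⟶∞ : (ℕ → ℝ) → Set
u ⟶∞ = ∀ M → ∃[ N ] ∀ n → N ℕ.≤ n → M < u n

-- xᵏ / k!
expTerm : ℝ → ℕ → ℝ
expTerm x zero    = 1ℝ
expTerm x (suc k) = expTerm x k * (x * fromℚ (+ 1 ℚ./ suc k))

expSum : ℝ → ℕ → ℝ
expSum x zero    = expTerm x zero
expSum x (suc k) = expSum x k + expTerm x (suc k)

module Exp (x : ℝ) {ε B C : ℚ} (K i N₁ N₂ N₃ : ℕ)
  (0<C : 0ℚ ℚ.< C) (2B<K : B ℚ.+ B ℚ.< + K ℚ./ 1)
  (x≤B : ∀ {n} → N₁ ℕ.≤ n → ℚ.∣ seq x n ∣ ℚ.≤ B)
  (t≤C : ∀ {n} → N₂ ℕ.≤ n → ℚ.∣ seq (expTerm x K) n ∣ ℚ.≤ C)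
  (c : ∀ {m n} → N₃ ℕ.≤ m → N₃ ℕ.≤ n →
       dist (seq (expSum x (K ℕ.+ i)) m) (seq (expSum x (K ℕ.+ i)) n) ℚ.< ½ ℚ.* ε)
  (hi<ε/4 : Rat.halve C i ℚ.< ½ ℚ.* (½ ℚ.* ε))
  where

  M = K ℕ.+ i
  N = (N₁ ℕ.⊔ N₂) ℕ.⊔ (N₃ ℕ.⊔ M)
  P : ℕ → ℕ → ℚ
  P k n = seq (expSum x k) n
  t : ℕ → ℕ → ℚ
  t k n = seq (expTerm x k) n
  h = Rat.halve C
  le₁₂ : ∀ {m} → N ℕ.≤ m → N₁ ℕ.⊔ N₂ ℕ.≤ m
  le₁₂ = ℕ.m⊔n≤o⇒m≤o (N₁ ℕ.⊔ N₂) (N₃ ℕ.⊔ M)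
  le₃₄ : ∀ {m} → N ℕ.≤ m → N₃ ℕ.⊔ M ℕ.≤ m
  le₃₄ = ℕ.m⊔n≤o⇒n≤o (N₁ ℕ.⊔ N₂) (N₃ ℕ.⊔ M)
  le₁ : ∀ {m} → N ℕ.≤ m → N₁ ℕ.≤ m
  le₁ p = ℕ.m⊔n≤o⇒m≤o N₁ N₂ (le₁₂ p)
  le₂ : ∀ {m} → N ℕ.≤ m → N₂ ℕ.≤ m
  le₂ p = ℕ.m⊔n≤o⇒n≤o N₁ N₂ (le₁₂ p)
  le₃ : ∀ {m} → N ℕ.≤ m → N₃ ℕ.≤ m
  le₃ p = ℕ.m⊔n≤o⇒m≤o N₃ M (le₃₄ p)
  le₄ : ∀ {m} → N ℕ.≤ m → M ℕ.≤ m
  le₄ p = ℕ.m⊔n≤o⇒n≤o N₃ M (le₃₄ p)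

  open ℚ.≤-Reasoning
  open +-*-Solver

  ratio : ∀ {n} → N ℕ.≤ n → ∀ j →
          ℚ.∣ seq x n ℚ.* (+ 1 ℚ./ suc (K ℕ.+ j)) ∣ ℚ.≤ ½
  ratio {n} N≤n j = begin
    ℚ.∣ seq x n ℚ.* r ∣            ≡⟨ ℚ.∣p*q∣≡∣p∣*∣q∣ (seq x n) r ⟩
    ℚ.∣ seq x n ∣ ℚ.* ℚ.∣ r ∣      ≡⟨ cong (ℚ.∣ seq x n ∣ ℚ.*_) (ℚ.0≤p⇒∣p∣≡p 0≤r) ⟩
    ℚ.∣ seq x n ∣ ℚ.* r            ≤⟨ ℚ.*-monoʳ-≤-nonNeg r (x≤B (le₁ N≤n)) ⟩
    B ℚ.* r                        ≡⟨ solve 2 (λ b r → b :* r := con ½ :* ((b :+ b) :* r)) refl B r ⟩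
    ½ ℚ.* ((B ℚ.+ B) ℚ.* r)        ≤⟨ ℚ.*-monoˡ-≤-nonNeg ½ (ℚ.*-monoʳ-≤-nonNeg r
                                        (ℚ.≤-trans (ℚ.<⇒≤ 2B<K) (Rat./1-mono-≤ (ℕ.m≤n⇒m≤1+n (ℕ.m≤m+n K j))))) ⟩
    ½ ℚ.* ((+ suc (K ℕ.+ j) ℚ./ 1) ℚ.* r)
                                   ≡⟨ cong (½ ℚ.*_) (Rat.n*1/n≡1 (K ℕ.+ j)) ⟩
    ½                              ∎
    where
    r = + 1 ℚ./ suc (K ℕ.+ j)
    instance _ = ℚ.normalize-nonNeg 1 (suc (K ℕ.+ j))
    0≤r : 0ℚ ℚ.≤ r
    0≤r = ℚ.nonNegative⁻¹ r

  term-bound : ∀ {n} → N ℕ.≤ n → ∀ j → ℚ.∣ t (K ℕ.+ j) n ∣ ℚ.≤ h j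
  term-bound {n} N≤n zero    = subst (λ k → ℚ.∣ t k n ∣ ℚ.≤ C) (sym (ℕ.+-identityʳ K)) (t≤C (le₂ N≤n))
  term-bound {n} N≤n (suc j) = begin
    ℚ.∣ t (K ℕ.+ suc j) n ∣              ≡⟨ cong (λ k → ℚ.∣ t k n ∣) (ℕ.+-suc K j) ⟩
    ℚ.∣ t (K ℕ.+ j) n ℚ.* s ∣            ≡⟨ ℚ.∣p*q∣≡∣p∣*∣q∣ (t (K ℕ.+ j) n) s ⟩
    ℚ.∣ t (K ℕ.+ j) n ∣ ℚ.* ℚ.∣ s ∣      ≤⟨ Rat.*-mono-nonNeg (ℚ.0≤∣p∣ (t (K ℕ.+ j) n))
                                              (ℚ.nonNegative⁻¹ ½) (term-bound N≤n j) (ratio N≤n j) ⟩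
    h j ℚ.* ½                            ≡⟨ ℚ.*-comm (h j) ½ ⟩
    ½ ℚ.* h j                            ∎
    where s = seq x n ℚ.* (+ 1 ℚ./ suc (K ℕ.+ j))

  step : ∀ {n} → N ℕ.≤ n → ∀ j → dist (P (K ℕ.+ j) n) (P (K ℕ.+ suc j) n) ℚ.≤ h (suc j)
  step {n} N≤n j = begin
    dist (P (K ℕ.+ j) n) (P (K ℕ.+ suc j) n)
      ≡⟨ cong (λ k → dist (P (K ℕ.+ j) n) (P k n)) (ℕ.+-suc K j) ⟩
    dist (P (K ℕ.+ j) n) (P (K ℕ.+ j) n ℚ.+ t (suc (K ℕ.+ j)) n)
      ≡⟨ Rat.dist-comm (P (K ℕ.+ j) n) _ ⟩
    dist (P (K ℕ.+ j) n ℚ.+ t (suc (K ℕ.+ j)) n) (P (K ℕ.+ j) n)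
      ≡⟨ cong ℚ.∣_∣ (solve 2 (λ p t → (p :+ t) :- p := t) refl (P (K ℕ.+ j) n) (t (suc (K ℕ.+ j)) n)) ⟩
    ℚ.∣ t (suc (K ℕ.+ j)) n ∣
      ≡⟨ cong (λ k → ℚ.∣ t k n ∣) (ℕ.+-suc K j) ⟨
    ℚ.∣ t (K ℕ.+ suc j) n ∣
      ≤⟨ term-bound N≤n (suc j) ⟩
    h (suc j) ∎

  near : ∀ {m} → N ℕ.≤ m → dist (P M m) (P m m) ℚ.< ½ ℚ.* (½ ℚ.* ε)
  near {m} N≤m = ℚ.≤-<-trans
    (subst (λ k → dist (P M m) (P k m) ℚ.≤ h i) index
      (Rat.tail-bound (λ j → P (K ℕ.+ j) m) h (Rat.halve-nonNeg (ℚ.<⇒≤ 0<C))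
        (λ j → Rat.half+half (h j)) (step N≤m) (m ℕ.∸ M) i))
    hi<ε/4
    where
    index : K ℕ.+ (m ℕ.∸ M ℕ.+ i) ≡ m
    index = trans (cong (K ℕ.+_) (ℕ.+-comm (m ℕ.∸ M) i))
      (trans (sym (ℕ.+-assoc K i (m ℕ.∸ M))) (ℕ.m+[n∸m]≡n (le₄ N≤m)))

  quarters : ∀ {p q r} → p ℚ.< ½ ℚ.* (½ ℚ.* ε) → q ℚ.< ½ ℚ.* ε → r ℚ.< ½ ℚ.* (½ ℚ.* ε) →
         p ℚ.+ (q ℚ.+ r) ℚ.< ε
  quarters {p} {q} {r} a b c = begin-strict
    p ℚ.+ (q ℚ.+ r)  ≡⟨ solve 3 (λ p q r → p :+ (q :+ r) := (p :+ r) :+ q) refl p q r ⟩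
    p ℚ.+ r ℚ.+ q    <⟨ Rat.<-halves (Rat.<-halves a c) b ⟩
    ε                ∎

  close : ∀ {m n} → N ℕ.≤ m → N ℕ.≤ n → dist (P m m) (P n n) ℚ.< ε
  close {m} {n} N≤m N≤n = ℚ.≤-<-trans
    (Rat.dist-triangle (P m m) (P M m) (P n n))
    (ℚ.≤-<-trans
      (ℚ.+-monoʳ-≤ (dist (P m m) (P M m)) (Rat.dist-triangle (P M m) (P M n) (P n n)))
      (quarters (subst (ℚ._< ½ ℚ.* (½ ℚ.* ε)) (Rat.dist-comm (P M m) (P m m)) (near N≤m))
            (c (le₃ N≤m) (le₃ N≤n)) (near N≤n)))

-- The diagonal through the approximations of the partial sums Σ_{k≤n} xᵏ/k!.
exp : ℝ → ℝ
exp x .seq n = seq (expSum x n) n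
exp x .cauchy {ε} 0<ε =
  let B , _ , N₁ , x≤B = bounded x
      K , 2B<K = Rat.below-ℕ (B ℚ.+ B)
      C , 0<C , N₂ , t≤C = bounded (expTerm x K)
      i , hi<ε/4 = Rat.halve→0 C (Rat.half-pos (Rat.half-pos 0<ε))
      N₃ , c = cauchy (expSum x (K ℕ.+ i)) (Rat.half-pos 0<ε)
  in Exp.N x {ε} K i N₁ N₂ N₃ 0<C 2B<K x≤B t≤C c hi<ε/4 ,
     Exp.close x {ε} K i N₁ N₂ N₃ 0<C 2B<K x≤B t≤C c hi<ε/4

-- The proofs are irrelevant, so that propositional equality of partitions is
-- equality of their lists of parts.
record Partition (n : ℕ) : Set where
  constructor mkPartition
  field
    parts     : List ℕ
    .sorted   : Linked ℕ._≥_ parts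
    .positive : All NonZero parts
    .total    : sum parts ≡ n
open Partition public

nth₀ : List ℕ → ℕ → ℕ
nth₀ []       _       = 0
nth₀ (h ∷ _)  zero    = h
nth₀ (_ ∷ hs) (suc i) = nth₀ hs i

-- Extended by zero and counted from 0: `part μ i` is the (i+1)-st largest part.
part : ∀ {n} → Partition n → ℕ → ℕ
part μ = nth₀ (parts μ)

nth₀-nonZero : ∀ {n} .{{_ : NonZero n}} hs → All NonZero hs → sum hs ≡ n → NonZero (nth₀ hs 0)
nth₀-nonZero {suc _} []      _         ()
nth₀-nonZero         (_ ∷ _) (h≢0 ∷ _) _ = h≢0

largest-nonZero : ∀ {n} .{{_ : NonZero n}} (μ : Partition n) → NonZero (part μ 0)
largest-nonZero (mkPartition hs _ hs≢0 Σhs≡n) =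
  recompute (ℕ.nonZero? (nth₀ hs 0)) (nth₀-nonZero hs hs≢0 Σhs≡n)

-- Floors and ceilings of reals are not computable, so they, and the notions built
-- on them, are given by their graphs; classically each is the graph of a function.
-- Only arguments ≥ 0 occur, hence values in ℕ.

⌈_⌉≡_ : ℝ → ℕ → Set
⌈ x ⌉≡ k = x ≤ fromℕ k × fromℕ k < x + 1ℝ

⌊_⌋≡_ : ℝ → ℕ → Set
⌊ x ⌋≡ k = fromℕ k ≤ x × x < fromℕ k + 1ℝ

-- The permutation determines ν, as its parts are sorted. For 0 < q ≤ 1 each pick
-- is at most its pile, so the truncated subtraction is exact.
Move : ∀ {n} → ℝ → Partition n → Partition n → Set
Move q μ ν = ∃[ picks ]
  Pointwise (λ h k → ⌈ q * fromℕ h ⌉≡ k) (parts μ) picks ×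
  parts ν ↭ filter ℕ.nonZero? (sum picks ∷ zipWith ℕ._∸_ (parts μ) picks)

IsMoveMap : ∀ {n} → ℝ → (Partition n → Partition n) → Set
IsMoveMap q f = ∀ μ → Move q μ (f μ)

Recurrent : ∀ {n} → (Partition n → Partition n) → Partition n → Set
Recurrent f μ = ∃[ k ] NonZero k × fold μ f k ≡ μ

-- The graph y = ∂μ(x) = λ_{⌊xn/λ₁⌋+1} / λ₁ of the downscaled diagram-boundary function,
-- where λᵢ₊₁ = part μ i.
∂[_]_≡_ : ∀ {n} .{{_ : NonZero n}} → Partition n → ℝ → ℝ → Set
∂[_]_≡_ {n} μ x y = ∃[ k ]
  ⌊ x * fromℚ (+ n ℚ./ part μ 0) ⌋≡ k × y ≃ fromℚ (+ part μ k ℚ./ part μ 0)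
  where instance _ = largest-nonZero μ

-- Only n ≥ 1 matters; the value of a sequence at 0 is unconstrained.
IsLimitShape : (∀ n → Partition n → Partition n) → (ℝ → ℝ) → Set
IsLimitShape f φ =
  (μ : ∀ n → Partition n) → (∀ n .{{_ : NonZero n}} → Recurrent (f n) (μ n)) →
  ∀ x → 0ℝ < x →
  (y : ℕ → ℝ) → (∀ n .{{_ : NonZero n}} → ∂[ μ n ] x ≡ y n) →
  y ⟶ φ x

triangular : ℝ → ℝ
triangular x = (1ℝ - x * fromℚ ½) ⊔ 0ℝ

exponential : ℝ → ℝ
exponential x = exp (- x)

{-# OPTIONS --safe #-}
-- Let N_t be the pile formed in move t of a periodic orbit, σ h = ⌈q h⌉ and g h = h − σ h. At each
-- time the configuration consists of the piles gˢ(N_{t−1−s}), s ≥ 0, whatever their order, so bounds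
-- lo ≤ N_t ≤ hi for all t imply gⁱ(lo) ≤ λ_{i+1} ≤ gⁱ(hi).
-- A pile of age ≥ H had size > H when it was H moves younger, so there are at most H + n/(H+1) piles,
-- which for H = ⌊√n⌋ gives q n ≤ N_t ≤ q n + 1 + 2H.
-- If q²n → ∞, then √n = o(qn), so all N_t are asymptotic to qn and λ_{i+1}/λ₁ ≈ (1−q)ⁱ.
-- If q²n → 0, then q N_t ≤ 1 eventually and the game is classical Bulgarian solitaire. There N_t is
-- the number of s with N_{t−1−s} > s; summing these s over a period shows that they are exactly
-- 0, …, N_t − 1. Hence N_{t+d} ≥ d implies N_t ≥ d, and since d and d + 1 are coprime, max N ≤ min N + 1:
-- the configuration is a staircase up to a bounded error.
module Submission where

open import Data.Nat.Base as ℕ using (ℕ; zero; suc; NonZero)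
import Data.Nat.Properties as ℕ
import Data.Nat.DivMod as ℕ
import Data.Nat.Solver as ℕ
open import Data.Nat.GeneralisedArithmetic using (fold)
open import Data.Nat.ListAction using (sum)
open import Data.Nat.ListAction.Properties using (sum-↭)
open import Data.Rational.Base as ℚ using (ℚ; mkℚ; 0ℚ; 1ℚ; ½)
import Data.Rational.Properties as ℚ
import Data.Rational.Solver as ℚ
import Data.Rational.Unnormalised.Base as ℚᵘ
import Data.Rational.Unnormalised.Properties as ℚᵘ
open import Data.List.Base using (List; []; _∷_; map; zipWith; filter)
open import Data.List.Relation.Unary.Linked using (Linked; [-]; _∷_; tail; linked?)
open import Data.List.Relation.Binary.Pointwise.Base using (Pointwise; []; _∷_)
open import Data.List.Relation.Binary.Permutation.Propositional using (_↭_)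
open import Data.List.Relation.Binary.Permutation.Propositional.Properties using (map⁺)
open import Data.Product.Base using (Σ; ∃-syntax; _×_; _,_; proj₁; proj₂)
open import Data.Sum.Base using (_⊎_; inj₁; inj₂)
open import Function.Base using (_∘_; id)
open import Relation.Nullary using (yes; no; contradiction; recompute)
open import Relation.Binary.PropositionalEquality
import Defs as D
open D using (module Rat; nth₀)

-- The slope `q n` is real and its ceilings are given only by their graphs, so arithmetic with piles
-- cannot start from `q n` itself. A periodic orbit meets finitely many piles, and the strict half
-- of each ceiling, k < q h + 1, leaves room; hence one rational r just below q explains all the
-- picks, and the orbit is also an orbit of r-proportion solitaire. This r varies with n and with
-- the orbit, but r < q < 2r, so both hypotheses on q²n pass to r²n, and every threshold can be
-- fixed before r is known. The counting is then done in ℕ, the estimates in ℚ, and reals reappear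
-- only through their approximants of large index. The scaling by λ₁ produces the two shapes. In the
-- exponential case λ₁ ≈ rn, so the index is i ≈ xn/λ₁ ≈ x/r and (1-r)ⁱ tends to exp(-x). For a
-- staircase 2n ≈ λ₁², so i ≈ xλ₁/2 and (λ₁ - i)/λ₁ ≈ 1 - x/2.

module Combinatorics where
  open import Data.Nat.Base
  open import Data.Nat.Properties
  open ℕ.+-*-Solver using (solve; _:=_; con; _:+_; _:*_)

  -- Finite sums and counting in ℕ

  Σ< : ℕ → (ℕ → ℕ) → ℕ
  Σ< zero    f = 0
  Σ< (suc L) f = f 0 + Σ< L (f ∘ suc)

  infix 5 _[≤]_

  -- Iverson bracket of v ≤ x.
  _[≤]_ : ℕ → ℕ → ℕ
  zero  [≤] _     = 1
  suc _ [≤] zero  = 0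
  suc v [≤] suc x = v [≤] x

  module _ where
    open ≤-Reasoning

    ≤⇒[≤]≡1 : ∀ {v x} → v ≤ x → (v [≤] x) ≡ 1
    ≤⇒[≤]≡1 z≤n       = refl
    ≤⇒[≤]≡1 (s≤s v≤x) = ≤⇒[≤]≡1 v≤x

    >⇒[≤]≡0 : ∀ {v x} → x < v → (v [≤] x) ≡ 0
    >⇒[≤]≡0 {suc _} {zero}  _         = refl
    >⇒[≤]≡0 {suc _} {suc _} (s≤s x<v) = >⇒[≤]≡0 x<v

    [≤]≥1⇒≤ : ∀ v x → 1 ≤ (v [≤] x) → v ≤ x
    [≤]≥1⇒≤ zero    _       _  = z≤n
    [≤]≥1⇒≤ (suc v) (suc x) le = s≤s ([≤]≥1⇒≤ v x le)

    [≤]≤1 : ∀ v x → (v [≤] x) ≤ 1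
    [≤]≤1 zero    _       = ≤-refl
    [≤]≤1 (suc _) zero    = z≤n
    [≤]≤1 (suc v) (suc x) = [≤]≤1 v x

    [≤]-monoʳ : ∀ v {x y} → x ≤ y → (v [≤] x) ≤ (v [≤] y)
    [≤]-monoʳ zero    _         = ≤-refl
    [≤]-monoʳ (suc _) z≤n       = z≤n
    [≤]-monoʳ (suc v) (s≤s x≤y) = [≤]-monoʳ v x≤y

    v*[≤]≤x : ∀ v x → v * (v [≤] x) ≤ x
    v*[≤]≤x v x with v ≤? x
    ... | yes v≤x = ≤-trans (≤-reflexive (trans (cong (v *_) (≤⇒[≤]≡1 v≤x)) (*-identityʳ v))) v≤x
    ... | no  v≰x = ≤-trans (≤-reflexive (trans (cong (v *_) (>⇒[≤]≡0 (≰⇒> v≰x))) (*-zeroʳ v))) z≤n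

    Σ<-cong : ∀ L {f h : ℕ → ℕ} → (∀ {s} → s < L → f s ≡ h s) → Σ< L f ≡ Σ< L h
    Σ<-cong zero    _  = refl
    Σ<-cong (suc L) eq = cong₂ _+_ (eq (s≤s z≤n)) (Σ<-cong L (λ s<L → eq (s≤s s<L)))

    Σ<-mono : ∀ L {f h : ℕ → ℕ} → (∀ {s} → s < L → f s ≤ h s) → Σ< L f ≤ Σ< L h
    Σ<-mono zero    _  = z≤n
    Σ<-mono (suc L) le = +-mono-≤ (le (s≤s z≤n)) (Σ<-mono L (λ s<L → le (s≤s s<L)))

    Σ<-zero : ∀ L → Σ< L (λ _ → 0) ≡ 0
    Σ<-zero zero    = refl
    Σ<-zero (suc L) = Σ<-zero L

    Σ<-+ : ∀ L (f h : ℕ → ℕ) → Σ< L (λ s → f s + h s) ≡ Σ< L f + Σ< L h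
    Σ<-+ zero    f h = refl
    Σ<-+ (suc L) f h = trans (cong (f 0 + h 0 +_) (Σ<-+ L (f ∘ suc) (h ∘ suc)))
      (solve 4 (λ a b c d → (a :+ b) :+ (c :+ d) := (a :+ c) :+ (b :+ d)) refl
        (f 0) (h 0) (Σ< L (f ∘ suc)) (Σ< L (h ∘ suc)))

    Σ<-*ˡ : ∀ L c (f : ℕ → ℕ) → Σ< L (λ s → c * f s) ≡ c * Σ< L f
    Σ<-*ˡ zero    c f = sym (*-zeroʳ c)
    Σ<-*ˡ (suc L) c f = trans (cong (c * f 0 +_) (Σ<-*ˡ L c (f ∘ suc)))
      (sym (*-distribˡ-+ c (f 0) (Σ< L (f ∘ suc))))

    Σ<-swap : ∀ L K (f : ℕ → ℕ → ℕ) → Σ< L (λ s → Σ< K (f s)) ≡ Σ< K (λ i → Σ< L (λ s → f s i))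
    Σ<-swap zero    K f = sym (Σ<-zero K)
    Σ<-swap (suc L) K f = trans (cong (Σ< K (f 0) +_) (Σ<-swap L K (f ∘ suc)))
      (sym (Σ<-+ K (f 0) (λ i → Σ< L (λ s → f (suc s) i))))

    Σ<-last : ∀ L (f : ℕ → ℕ) → Σ< (suc L) f ≡ Σ< L f + f L
    Σ<-last zero    f = +-identityʳ (f 0)
    Σ<-last (suc L) f = trans (cong (f 0 +_) (Σ<-last L (f ∘ suc))) (sym (+-assoc (f 0) _ _))

    Σ<-term : ∀ L (f : ℕ → ℕ) {s} → s < L → f s ≤ Σ< L f
    Σ<-term (suc L) f {zero}  _         = m≤m+n (f 0) _
    Σ<-term (suc L) f {suc s} (s≤s s<L) = ≤-trans (Σ<-term L (f ∘ suc) s<L) (m≤n+m _ (f 0))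

    Σ<-ones : ∀ L i (f : ℕ → ℕ) → i ≤ L → (∀ {s} → s < i → 1 ≤ f s) → i ≤ Σ< L f
    Σ<-ones L       zero    f _         _  = z≤n
    Σ<-ones (suc L) (suc i) f (s≤s i≤L) le =
      +-mono-≤ (le (s≤s z≤n)) (Σ<-ones L i (f ∘ suc) i≤L (λ s<i → le (s≤s s<i)))

    Σ<-support : ∀ L i (f : ℕ → ℕ) → (∀ s → f s ≤ 1) → (∀ {s} → i ≤ s → f s ≡ 0) → Σ< L f ≤ i
    Σ<-support zero    i       f _  _   = z≤n
    Σ<-support (suc L) zero    f ≤1 out =
      ≤-reflexive (trans (cong₂ _+_ (out {0} z≤n) (Σ<-cong L (λ _ → out z≤n))) (Σ<-zero L))
    Σ<-support (suc L) (suc i) f ≤1 out =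
      +-mono-≤ (≤1 0) (Σ<-support L i (f ∘ suc) (≤1 ∘ suc) (λ i≤s → out (s≤s i≤s)))

    Σ<-≤ : ∀ L {f : ℕ → ℕ} → (∀ s → f s ≤ 1) → Σ< L f ≤ L
    Σ<-≤ zero    ≤1 = z≤n
    Σ<-≤ (suc L) ≤1 = +-mono-≤ (≤1 0) (Σ<-≤ L (≤1 ∘ suc))

    Σ<-initial : ∀ L l → l ≤ L → Σ< L (λ s → suc s [≤] l) ≡ l
    Σ<-initial L l l≤L = ≤-antisym
      (Σ<-support L l _ (λ s → [≤]≤1 (suc s) l) (λ l≤s → >⇒[≤]≡0 (s≤s l≤s)))
      (Σ<-ones L l _ l≤L (λ s<l → ≤-reflexive (sym (≤⇒[≤]≡1 s<l))))

    -- Summed over s, with B the indicator function of a set of size l: the sum of the set exceeds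
    -- 0 + 1 + … + (l−1) by at least the number of s < l missing from the set.
    defect-term : ∀ s l B → B ≤ 1 →
      s * (suc s [≤] l) + l * B + ((suc s [≤] l) ∸ B) ≤ s * B + l * (suc s [≤] l)
    defect-term s l B B≤1 with suc s ≤? l
    ... | yes s<l rewrite ≤⇒[≤]≡1 s<l = case B B≤1
      where
      case : ∀ B → B ≤ 1 → s * 1 + l * B + (1 ∸ B) ≤ s * B + l * 1
      case zero    _ rewrite *-zeroʳ l | *-zeroʳ s | *-identityʳ s | *-identityʳ l | +-identityʳ s
        = ≤-trans (≤-reflexive (+-comm s 1)) s<l
      case (suc zero) _ = ≤-reflexive (+-identityʳ _)
      case (suc (suc _)) (s≤s ())
    ... | no s≮l rewrite >⇒[≤]≡0 (≰⇒> s≮l) | *-zeroʳ s | *-zeroʳ l | 0∸n≡0 B | +-identityʳ (l * B) | +-identityʳ (s * B)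
      = *-monoˡ-≤ B (≮⇒≥ s≮l)

    -- Both index sets have size `l`, so `l * l` can be added to either side as `l` times the size
    -- of one of them. This replaces the weight s by s - l and leaves an inequality that holds term
    -- by term.
    defect : ∀ L l (B : ℕ → ℕ) → l ≤ L → (∀ s → B s ≤ 1) → Σ< L B ≡ l →
      Σ< L (λ s → s * (suc s [≤] l)) + Σ< L (λ s → (suc s [≤] l) ∸ B s) ≤ Σ< L (λ s → s * B s)
    defect L l B l≤L B≤1 ΣB≡l = +-cancelʳ-≤ (l * l) _ _ (begin
      X + D + l * l                  ≡⟨ cong (λ t → X + D + l * t) (sym ΣB≡l) ⟩
      X + D + l * Σ< L B             ≡⟨ cong (X + D +_) (sym (Σ<-*ˡ L l B)) ⟩
      X + D + Σ< L (λ s → l * B s)   ≡⟨ solve 3 (λ x d y → x :+ d :+ y := x :+ y :+ d) refl X D _ ⟩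
      X + Σ< L (λ s → l * B s) + D   ≡⟨ cong (_+ D) (sym (Σ<-+ L _ _)) ⟩
      Σ< L (λ s → s * (suc s [≤] l) + l * B s) + D   ≡⟨ sym (Σ<-+ L _ _) ⟩
      Σ< L (λ s → s * (suc s [≤] l) + l * B s + ((suc s [≤] l) ∸ B s))
        ≤⟨ Σ<-mono L (λ {s} _ → defect-term s l (B s) (B≤1 s)) ⟩
      Σ< L (λ s → s * B s + l * (suc s [≤] l))   ≡⟨ Σ<-+ L _ _ ⟩
      Y + Σ< L (λ s → l * (suc s [≤] l))   ≡⟨ cong (Y +_) (Σ<-*ˡ L l _) ⟩
      Y + l * Σ< L (λ s → suc s [≤] l)   ≡⟨ cong (λ t → Y + l * t) (Σ<-initial L l l≤L) ⟩
      Y + l * l ∎)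
      where
      X = Σ< L (λ s → s * (suc s [≤] l))
      D = Σ< L (λ s → (suc s [≤] l) ∸ B s)
      Y = Σ< L (λ s → s * B s)

    -- Periodic sequences and the balance of classical Bulgarian solitaire

    Σ<-shift : ∀ k (h : ℕ → ℕ) → (∀ t → h (k + t) ≡ h t) → ∀ τ → Σ< k (λ i → h (τ + i)) ≡ Σ< k h
    Σ<-shift k h per zero    = refl
    Σ<-shift k h per (suc τ) = trans (+-cancelˡ-≡ (h τ) _ _ (begin-equality
      h τ + Σ< k (λ i → h (suc τ + i))  ≡⟨ cong₂ _+_ (cong h (sym (+-identityʳ τ)))
                                             (Σ<-cong k (λ {i} _ → cong h (sym (+-suc τ i)))) ⟩
      Σ< (suc k) (λ i → h (τ + i))      ≡⟨ Σ<-last k (λ i → h (τ + i)) ⟩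
      Σ< k (λ i → h (τ + i)) + h (τ + k) ≡⟨ cong (Σ< k (λ i → h (τ + i)) +_) (trans (cong h (+-comm τ k)) (per τ)) ⟩
      Σ< k (λ i → h (τ + i)) + h τ      ≡⟨ +-comm _ (h τ) ⟩
      h τ + Σ< k (λ i → h (τ + i))      ∎))
      (Σ<-shift k h per τ)

    -- The terms vanish from s = h on, so the full sum is h (h + 1) / 2. A window shorter than h
    -- loses terms, hence the condition `h ≤ L` in the reverse bound.
    gaussian-≤ : ∀ L h → 2 * Σ< L (λ s → h ∸ s) ≤ h * suc h
    gaussian-≤ zero    h       = z≤n
    gaussian-≤ (suc L) zero    = ≤-reflexive (cong (2 *_) (trans (Σ<-cong L (λ _ → refl)) (Σ<-zero L)))
    gaussian-≤ (suc L) (suc h) = begin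
      2 * (suc h + Σ< L (λ s → h ∸ s))      ≡⟨ *-distribˡ-+ 2 (suc h) _ ⟩
      2 * suc h + 2 * Σ< L (λ s → h ∸ s)    ≤⟨ +-monoʳ-≤ (2 * suc h) (gaussian-≤ L h) ⟩
      2 * suc h + h * suc h                 ≡⟨ solve 1 (λ h → con 2 :* (con 1 :+ h) :+ h :* (con 1 :+ h)
                                                  := (con 1 :+ h) :* (con 1 :+ (con 1 :+ h))) refl h ⟩
      suc h * suc (suc h)                   ∎

    gaussian-≥ : ∀ L h → h ≤ L → h * suc h ≤ 2 * Σ< L (λ s → h ∸ s)
    gaussian-≥ L       zero    _         = z≤n
    gaussian-≥ (suc L) (suc h) (s≤s h≤L) = begin
      suc h * suc (suc h)                   ≡⟨ solve 1 (λ h → con 2 :* (con 1 :+ h) :+ h :* (con 1 :+ h)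
                                                  := (con 1 :+ h) :* (con 1 :+ (con 1 :+ h))) refl h ⟨
      2 * suc h + h * suc h                 ≤⟨ +-monoʳ-≤ (2 * suc h) (gaussian-≥ L h h≤L) ⟩
      2 * suc h + 2 * Σ< L (λ s → h ∸ s)    ≡⟨ *-distribˡ-+ 2 (suc h) _ ⟨
      2 * (suc h + Σ< L (λ s → h ∸ s))      ∎

    periodic-* : ∀ {A : Set} k (N : ℕ → A) → (∀ t → N (k + t) ≡ N t) → ∀ c t → N (c * k + t) ≡ N t
    periodic-* k N per zero    t = refl
    periodic-* k N per (suc c) t = trans (cong N (+-assoc k (c * k) t))
      (trans (per (c * k + t)) (periodic-* k N per c t))

    -- Summed over a period, both sides of `defect` agree up to the missing elements, so none is missing.
    present : ∀ k L (N : ℕ → ℕ) → 1 ≤ k → (∀ t → N (k + t) ≡ N t) → (∀ t → N t ≤ L) →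
      (∀ u → N (L + u) ≡ Σ< L (λ s → suc s [≤] N ((L ∸ suc s) + u))) →
      ∀ {s} → s < L → suc s ≤ N (L + 0) → suc s ≤ N ((L ∸ suc s) + 0)
    present k L N 1≤k per N≤L rec {s} s<L s<N = [≤]≥1⇒≤ (suc s) _ (≤-trans (≤-reflexive (sym (≤⇒[≤]≡1 s<N)))
        (m∸n≡0⇒m≤n D₀≡0))
      where
      B : ℕ → ℕ → ℕ
      B i s = suc s [≤] N ((L ∸ suc s) + i)
      D : ℕ → ℕ
      D i = Σ< L (λ s → (suc s [≤] N (L + i)) ∸ B i s)
      -- Over a full period the time offset disappears: a pile larger than s contributes s once,
      -- whether it is read when formed or s + 1 moves later.
      sweep : ∀ s τ → Σ< k (λ i → s * (suc s [≤] N (τ + i))) ≡ s * Σ< k (λ i → suc s [≤] N i)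
      sweep s τ = trans (Σ<-*ˡ k s _)
        (cong (s *_) (Σ<-shift k (λ i → suc s [≤] N i) (λ t → cong (suc s [≤]_) (per t)) τ))
      X Y : ℕ
      X = Σ< k (λ i → Σ< L (λ s → s * (suc s [≤] N (L + i))))
      Y = Σ< k (λ i → Σ< L (λ s → s * B i s))
      X≡Y : X ≡ Y
      X≡Y = begin-equality
        X ≡⟨ Σ<-swap k L _ ⟩
        Σ< L (λ s → Σ< k (λ i → s * (suc s [≤] N (L + i)))) ≡⟨ Σ<-cong L (λ {s} _ →
            trans (sweep s L) (sym (sweep s (L ∸ suc s)))) ⟩
        Σ< L (λ s → Σ< k (λ i → s * B i s)) ≡⟨ Σ<-swap L k _ ⟩
        Y ∎
      ΣD≡0 : Σ< k D ≡ 0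
      ΣD≡0 = n≤0⇒n≡0 (+-cancelˡ-≤ X _ _ (begin
        X + Σ< k D ≡⟨ Σ<-+ k _ _ ⟨
        Σ< k (λ i → Σ< L (λ s → s * (suc s [≤] N (L + i))) + D i)
          ≤⟨ Σ<-mono k (λ {i} _ → defect L (N (L + i)) (B i) (N≤L (L + i)) (λ s →
              [≤]≤1 (suc s) (N ((L ∸ suc s) + i))) (sym (rec i))) ⟩
        Y ≡⟨ sym X≡Y ⟩
        X ≡⟨ +-identityʳ X ⟨
        X + 0 ∎))
      D₀≡0 : (suc s [≤] N (L + 0)) ∸ B 0 s ≡ 0
      D₀≡0 = n≤0⇒n≡0 (begin
        (suc s [≤] N (L + 0)) ∸ B 0 s ≤⟨ Σ<-term L (λ s → (suc s [≤] N (L + 0)) ∸ B 0 s) s<L ⟩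
        D 0 ≤⟨ Σ<-term k D 1≤k ⟩
        Σ< k D ≡⟨ ΣD≡0 ⟩
        0 ∎)

    iterate-down : ∀ (P : ℕ → Set) d → (∀ u → P (d + u) → P u) → ∀ j u → P (j * d + u) → P u
    iterate-down P d down zero    u p = p
    iterate-down P d down (suc j) u p =
      iterate-down P d down j u (down (j * d + u) (subst P (+-assoc d (j * d) u) p))

    -- `N t` is the pile formed at time t; at time L + u the pile formed at time (L ∸ suc s) + u has
    -- been reduced s times, and is still nonempty iff it started with more than s cards.
    bulgarian : ∀ k L (N : ℕ → ℕ) → 1 ≤ k → (∀ t → N (k + t) ≡ N t) → (∀ t → N t ≤ L) →
      (∀ u → N (L + u) ≡ Σ< L (λ s → suc s [≤] N ((L ∸ suc s) + u))) →
      ∀ u v → N u ≤ suc (N v)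
    bulgarian (suc k) L N _ per N≤L rec u v with N u in Nu≡
    ... | zero  = z≤n
    ... | suc zero = s≤s z≤n
    ... | suc (suc d) = s≤s (down-d v v-late)
      where
      K = suc k
      -- [N ≥ d] at time d + u forces [N ≥ d] at time u; the coprime steps d and d + 1 then reach every time.
      down : ∀ d → suc d ≤ L → ∀ u → suc d ≤ N (suc d + u) → suc d ≤ N u
      down d d<L u d<N = subst (suc d ≤_) (trans (cong N eq₂) (periodic-* K N per L u))
        (present K L (λ t → N (t + u′)) (s≤s z≤n) (λ t → trans (cong N (+-assoc K t u′)) (per (t + u′)))
          (λ t → N≤L (t + u′))
          (λ w → trans (cong N (+-assoc L w u′)) (trans (rec (w + u′))
             (Σ<-cong L (λ {s} _ → cong (λ t → suc s [≤] N t) (sym (+-assoc (L ∸ suc s) w u′))))))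
          d<L (subst (suc d ≤_) (trans (sym (periodic-* K N per L (suc d + u))) (cong N eq₁)) d<N))
        where
        -- `present` looks back from time L + 0. Shifting the origin by u′ turns that time into d +
        -- 1 + u plus L whole periods.
        u′ = L * k + (suc d + u)
        eq₁ : L * K + (suc d + u) ≡ L + 0 + u′
        eq₁ = solve 3 (λ L k w → L :* (con 1 :+ k) :+ w := L :+ con 0 :+ (L :* k :+ w)) refl L k (suc d + u)
        eq₂ : (L ∸ suc d) + 0 + u′ ≡ L * K + u
        eq₂ = begin-equality
          (L ∸ suc d) + 0 + u′   ≡⟨ solve 5 (λ m L k d u → m :+ con 0 :+ (L :* k :+ (d :+ u)) := (m :+ d) :+
              (L :* k :+ u))
                                       refl (L ∸ suc d) L k (suc d) u ⟩
          (L ∸ suc d + suc d) + (L * k + u) ≡⟨ cong (_+ (L * k + u)) (m∸n+n≡m d<L) ⟩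
          L + (L * k + u)        ≡⟨ solve 3 (λ L k u → L :+ (L :* k :+ u) := L :* (con 1 :+ k) :+ u) refl L k u ⟩
          L * K + u              ∎
      d+1<L : suc (suc d) ≤ L
      d+1<L = subst (_≤ L) Nu≡ (N≤L u)
      -- Going back E times by d + 2 and E * k times by d + 1 covers E + E (d + 1) (k + 1) moves,
      -- which is E modulo the period k + 1. Since k is -1 modulo the period, E is congruent to u -
      -- v, so the walk from u ends at v.
      E = u + v * k
      w = (E * k) * suc d + v
      late : suc (suc d) ≤ N (E * suc (suc d) + w)
      late = subst (suc (suc d) ≤_) (trans (sym (periodic-* K N per (v + suc d * E) u)) (cong N
        (solve 4 (λ u v k d → let E = u :+ v :* k in
            (v :+ (con 1 :+ d) :* E) :* (con 1 :+ k) :+ u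
            := E :* (con 1 :+ (con 1 :+ d)) :+ ((E :* k) :* (con 1 :+ d) :+ v)) refl u v k d)))
        (≤-reflexive (sym Nu≡))
      v-late : suc d ≤ N w
      v-late = ≤-trans (n≤1+n (suc d)) (iterate-down (λ t → suc (suc d) ≤ N t) (suc (suc d)) (down
          (suc d) d+1<L) E w late)
      down-d : ∀ v → suc d ≤ N ((E * k) * suc d + v) → suc d ≤ N v
      down-d = iterate-down (λ t → suc d ≤ N t) (suc d) (down d (≤-trans (n≤1+n _) d+1<L)) (E * k)

  module _ where
    open ≤-Reasoning

    -- Sums over the piles of a configuration

    Σ∈ : (ℕ → ℕ) → List ℕ → ℕ
    Σ∈ F xs = sum (map F xs)

    Σ∈-id : ∀ xs → Σ∈ id xs ≡ sum xs
    Σ∈-id []       = refl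
    Σ∈-id (x ∷ xs) = cong (x +_) (Σ∈-id xs)

    Σ∈-mono : ∀ {F G : ℕ → ℕ} → (∀ x → F x ≤ G x) → ∀ xs → Σ∈ F xs ≤ Σ∈ G xs
    Σ∈-mono le []       = z≤n
    Σ∈-mono le (x ∷ xs) = +-mono-≤ (le x) (Σ∈-mono le xs)

    Σ∈-+ : ∀ (F G : ℕ → ℕ) xs → Σ∈ (λ x → F x + G x) xs ≡ Σ∈ F xs + Σ∈ G xs
    Σ∈-+ F G []       = refl
    Σ∈-+ F G (x ∷ xs) = trans (cong (F x + G x +_) (Σ∈-+ F G xs))
      (solve 4 (λ a b c d → (a :+ b) :+ (c :+ d) := (a :+ c) :+ (b :+ d)) refl (F x) (G x) _ _)

    Σ∈-*ˡ : ∀ c (F : ℕ → ℕ) xs → Σ∈ (λ x → c * F x) xs ≡ c * Σ∈ F xs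
    Σ∈-*ˡ c F []       = sym (*-zeroʳ c)
    Σ∈-*ˡ c F (x ∷ xs) = trans (cong (c * F x +_) (Σ∈-*ˡ c F xs)) (sym (*-distribˡ-+ c (F x) _))

    Σ∈-zero : ∀ B {F : ℕ → ℕ} → (∀ {x} → x ≤ B → F x ≡ 0) → ∀ xs → sum xs ≤ B → Σ∈ F xs ≡ 0
    Σ∈-zero B F≡0 []       _  = refl
    Σ∈-zero B F≡0 (x ∷ xs) le = cong₂ _+_ (F≡0 (≤-trans (m≤m+n x _) le)) (Σ∈-zero B F≡0 xs (≤-trans (m≤n+m _ x) le))

    Σ∈-filter : ∀ {F : ℕ → ℕ} → F 0 ≡ 0 → ∀ xs → Σ∈ F (filter nonZero? xs) ≡ Σ∈ F xs
    Σ∈-filter     F0 []           = refl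
    Σ∈-filter {F} F0 (zero ∷ xs)  = trans (Σ∈-filter F0 xs) (cong (_+ Σ∈ F xs) (sym F0))
    Σ∈-filter {F} F0 (suc x ∷ xs) = cong (F (suc x) +_) (Σ∈-filter F0 xs)

    Σ∈-remaining : ∀ (F σ : ℕ → ℕ) xs → Σ∈ F (zipWith _∸_ xs (map σ xs)) ≡ Σ∈ (λ x → F (x ∸ σ x)) xs
    Σ∈-remaining F σ []       = refl
    Σ∈-remaining F σ (x ∷ xs) = cong (F (x ∸ σ x) +_) (Σ∈-remaining F σ xs)

    nth₀≤head : ∀ {x xs} → Linked _≥_ (x ∷ xs) → ∀ i → nth₀ xs i ≤ x
    nth₀≤head [-]        i       = z≤n
    nth₀≤head (x≥y ∷ _)  zero    = x≥y
    nth₀≤head (x≥y ∷ ys) (suc i) = ≤-trans (nth₀≤head ys i) x≥y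

    -- In a decreasing list the entries that are at least v form an initial segment. The condition
    -- `1 ≤ v` excludes the zeros by which `nth₀` extends the list.
    count-≥ : ∀ {xs} → Linked _≥_ xs → ∀ {v} → 1 ≤ v → ∀ i → v ≤ nth₀ xs i → suc i ≤ Σ∈ (v [≤]_) xs
    count-≥ {[]}     _      1≤v i       v≤ = contradiction (≤-trans 1≤v v≤) λ ()
    count-≥ {x ∷ xs} sorted 1≤v zero    v≤ = ≤-trans (≤-reflexive (sym (≤⇒[≤]≡1 v≤))) (m≤m+n _ _)
    count-≥ {x ∷ xs} sorted 1≤v (suc i) v≤ =
      +-mono-≤ (≤-reflexive (sym (≤⇒[≤]≡1 (≤-trans v≤ (nth₀≤head sorted i))))) (count-≥ (tail sorted) 1≤v i v≤)

    count-≤ : ∀ {xs} → Linked _≥_ xs → ∀ {v} i → nth₀ xs i < v → Σ∈ (v [≤]_) xs ≤ i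
    count-≤ {[]}         _           i       _  = z≤n
    count-≤ {_ ∷ []}     sorted      zero    lt = ≤-reflexive (cong (_+ 0) (>⇒[≤]≡0 lt))
    count-≤ {_ ∷ _ ∷ _}  (x≥y ∷ ys)  zero    lt =
      +-mono-≤ (≤-reflexive (>⇒[≤]≡0 lt)) (count-≤ ys zero (≤-<-trans x≥y lt))
    count-≤ {x ∷ xs}     sorted {v}  (suc i) lt = +-mono-≤ ([≤]≤1 v x) (count-≤ (tail sorted) i lt)

  -- A staircase up to bounded error, expressed through its largest part `l`, by which the diagram
  -- is rescaled. The second alternative of `part-hi` is for indices beyond the staircase, where
  -- `part i + i` grows without bound.
  record TriangularBounds (n : ℕ) (part : ℕ → ℕ) : Set where
    l : ℕ
    l = part 0
    field
      l²≤     : l * l ≤ 2 * n + 3 * l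
      2n≤     : 2 * n ≤ l * l + 11 * l
      part-lo : ∀ i → l ≤ part i + (i + 2)
      part-hi : ∀ i → part i + i ≤ l + 2 ⊎ part i ≡ 0

  module _ where
    open ≤-Reasoning

    -- The largest part lies between `lo` and `lo + 2`, so it can replace `lo` everywhere at the
    -- cost of terms linear in `l`.
    near-staircase : ∀ {n} lo (part : ℕ → ℕ) → 1 ≤ part 0 →
      lo * suc lo ≤ 2 * n → 2 * n ≤ (2 + lo) * (3 + lo) →
      (∀ i → lo ∸ i ≤ part i) → (∀ i → part i ≤ 2 + lo ∸ i) → TriangularBounds n part
    near-staircase {n} lo part 1≤l 2n≥ 2n≤ ≤part part≤ = record
      { l²≤ = begin
          l * l                        ≤⟨ *-monoˡ-≤ l (part≤ 0) ⟩
          (2 + lo) * l                 ≡⟨ solve 2 (λ o l → (con 2 :+ o) :* l := o :* l :+ con 2 :* l) refl lo l ⟩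
          lo * l + 2 * l               ≤⟨ +-monoˡ-≤ (2 * l) (*-monoʳ-≤ lo (part≤ 0)) ⟩
          lo * (2 + lo) + 2 * l        ≡⟨ solve 2 (λ o l → o :* (con 2 :+ o) :+ con 2 :* l
                                            := o :* (con 1 :+ o) :+ (o :+ con 2 :* l)) refl lo l ⟩
          lo * suc lo + (lo + 2 * l)   ≤⟨ +-mono-≤ 2n≥ (+-monoˡ-≤ (2 * l) (≤part 0)) ⟩
          2 * n + 3 * l                ∎
      ; 2n≤ = begin
          2 * n                        ≤⟨ 2n≤ ⟩
          (2 + lo) * (3 + lo)          ≤⟨ *-mono-≤ (+-monoʳ-≤ 2 (≤part 0)) (+-monoʳ-≤ 3 (≤part 0)) ⟩
          (2 + l) * (3 + l)            ≡⟨ solve 1 (λ l → (con 2 :+ l) :* (con 3 :+ l)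
                                            := l :* l :+ con 5 :* l :+ con 6 :* con 1) refl l ⟩
          -- The constant 6 is absorbed by `1 ≤ l`; this is the origin of 11 = 5 + 6.
          l * l + 5 * l + 6 * 1        ≤⟨ +-monoʳ-≤ (l * l + 5 * l) (*-monoʳ-≤ 6 1≤l) ⟩
          l * l + 5 * l + 6 * l        ≡⟨ solve 1
              (λ l → l :* l :+ con 5 :* l :+ con 6 :* l := l :* l :+ con 11 :* l) refl l ⟩
          l * l + 11 * l               ∎
      ; part-lo = λ i → begin
          l                            ≤⟨ part≤ 0 ⟩
          2 + lo                       ≤⟨ +-monoʳ-≤ 2 (m≤n+m∸n lo i) ⟩
          2 + (i + (lo ∸ i))           ≤⟨ +-monoʳ-≤ 2 (+-monoʳ-≤ i (≤part i)) ⟩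
          2 + (i + part i)             ≡⟨ solve 2 (λ i p → con 2 :+ (i :+ p) := p :+ (i :+ con 2)) refl i (part i) ⟩
          part i + (i + 2)             ∎
      ; part-hi = hi
      }
      where
      l : ℕ
      l = part 0
      hi : ∀ i → part i + i ≤ l + 2 ⊎ part i ≡ 0
      hi i with i ≤? 2 + lo
      ... | no  i≰ = inj₂ (n≤0⇒n≡0 (≤-trans (part≤ i) (≤-reflexive (m≤n⇒m∸n≡0 (<⇒≤ (≰⇒> i≰))))))
      ... | yes i≤ = inj₁ (begin
        part i + i          ≤⟨ +-monoˡ-≤ i (part≤ i) ⟩
        2 + lo ∸ i + i      ≡⟨ m∸n+n≡m i≤ ⟩
        2 + lo              ≤⟨ +-monoʳ-≤ 2 (≤part 0) ⟩
        2 + l               ≡⟨ +-comm 2 l ⟩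
        l + 2               ∎)

  -- The hypotheses say that σ h = ⌈(a/b) h⌉.
  module Solitaire (a b : ℕ) (σ : ℕ → ℕ)
    (lower : ∀ h → a * h ≤ b * σ h) (upper : ∀ h → b * σ h < a * h + b)
    (0<a : 0 < a) (a≤b : a ≤ b) where
    open ≤-Reasoning

    -- A single pile under repeated moves

    rest : ℕ → ℕ
    rest h = h ∸ σ h

    restⁱ : ℕ → ℕ → ℕ
    restⁱ i h = fold h rest i

    b*-cancel : ∀ {x y} → b * x < b * y + b → x ≤ y
    b*-cancel {x} {y} lt = s≤s⁻¹ (*-cancelˡ-< b x (suc y)
      (≤-trans lt (≤-reflexive (trans (+-comm (b * y) b) (sym (*-suc b y))))))

    σ0≡0 : σ 0 ≡ 0
    σ0≡0 = n≤0⇒n≡0 (b*-cancel (<-≤-trans (upper 0) (+-monoˡ-≤ b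
      (≤-reflexive (trans (*-zeroʳ a) (sym (*-zeroʳ b)))))))

    σ≤ : ∀ h → σ h ≤ h
    σ≤ h = b*-cancel (<-≤-trans (upper h) (+-monoˡ-≤ b (*-monoˡ-≤ h a≤b)))

    σ-pos : ∀ {h} → 1 ≤ h → 1 ≤ σ h
    σ-pos {h} 1≤h = n≢0⇒n>0 λ σh≡0 → n≮0 (begin-strict
      0       <⟨ *-mono-≤ 0<a 1≤h ⟩
      a * h   ≤⟨ lower h ⟩
      b * σ h ≡⟨ trans (cong (b *_) σh≡0) (*-zeroʳ b) ⟩
      0       ∎)

    -- As a ≤ b, enlarging a pile by d cards raises (a/b) h by at most d, and d is an integer, so
    -- the ceiling also rises by at most d.
    rest-mono : ∀ {x y} → x ≤ y → rest x ≤ rest y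
    rest-mono {x} {y} x≤y = begin
      x ∸ σ x                        ≡⟨ [m+n]∸[m+o]≡n∸o (y ∸ x) x (σ x) ⟨
      (y ∸ x + x) ∸ (y ∸ x + σ x)    ≡⟨ cong (_∸ (y ∸ x + σ x)) (m∸n+n≡m x≤y) ⟩
      y ∸ (y ∸ x + σ x)              ≤⟨ ∸-monoʳ-≤ y (b*-cancel σy≤) ⟩
      y ∸ σ y                        ∎
      where
      σy≤ : b * σ y < b * (y ∸ x + σ x) + b
      σy≤ = begin-strict
        b * σ y                        <⟨ upper y ⟩
        a * y + b                      ≡⟨ cong (λ t → a * t + b) (m∸n+n≡m x≤y) ⟨
        a * (y ∸ x + x) + b            ≡⟨ cong (_+ b) (*-distribˡ-+ a (y ∸ x) x) ⟩
        a * (y ∸ x) + a * x + b        ≤⟨ +-monoˡ-≤ b (+-mono-≤ (*-monoˡ-≤ (y ∸ x) a≤b) (lower x)) ⟩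
        b * (y ∸ x) + b * σ x + b      ≡⟨ cong (_+ b) (*-distribˡ-+ b (y ∸ x) (σ x)) ⟨
        b * (y ∸ x + σ x) + b          ∎

    rest0≡0 : rest 0 ≡ 0
    rest0≡0 = 0∸n≡0 (σ 0)

    restⁱ-mono : ∀ i {x y} → x ≤ y → restⁱ i x ≤ restⁱ i y
    restⁱ-mono zero    x≤y = x≤y
    restⁱ-mono (suc i) x≤y = rest-mono (restⁱ-mono i x≤y)

    rest≤pred : ∀ h → rest h ≤ h ∸ 1
    rest≤pred zero    = ≤-reflexive rest0≡0
    rest≤pred (suc h) = ∸-monoʳ-≤ (suc h) (σ-pos {suc h} (s≤s z≤n))

    restⁱ≤ : ∀ i h → restⁱ i h ≤ h ∸ i
    restⁱ≤ zero    h = ≤-refl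
    restⁱ≤ (suc i) h = begin
      rest (restⁱ i h)  ≤⟨ rest≤pred (restⁱ i h) ⟩
      restⁱ i h ∸ 1     ≤⟨ ∸-monoˡ-≤ 1 (restⁱ≤ i h) ⟩
      h ∸ i ∸ 1         ≡⟨ trans (∸-+-assoc h i 1) (cong (h ∸_) (+-comm i 1)) ⟩
      h ∸ suc i         ∎

    restⁱ-anti : ∀ {i j} h → i ≤ j → restⁱ j h ≤ restⁱ i h
    restⁱ-anti h i≤j = go (≤⇒≤′ i≤j)
      where
      go : ∀ {i j} → i ≤′ j → restⁱ j h ≤ restⁱ i h
      go ≤′-refl       = ≤-refl
      go (≤′-step i≤j) = ≤-trans (≤-trans (rest≤pred _) (m∸n≤m _ 1)) (go i≤j)

    restⁱ≡0 : ∀ {i h} → h ≤ i → restⁱ i h ≡ 0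
    restⁱ≡0 {i} {h} h≤i = n≤0⇒n≡0 (≤-trans (restⁱ≤ i h) (≤-reflexive (m≤n⇒m∸n≡0 h≤i)))

    -- Periodic orbits, with the piles sorted by age

    module Orbit (n k : ℕ) (xs : ℕ → List ℕ)
      (total : ∀ t → sum (xs t) ≡ n)
      (sorted : ∀ t → Linked _≥_ (xs t))
      (period : ∀ t → xs (suc k + t) ≡ xs t)
      (step : ∀ t → xs (suc t) ↭
        filter nonZero? (sum (map σ (xs t)) ∷ zipWith _∸_ (xs t) (map σ (xs t)))) where

      -- The number of cards, the next new pile and the number of piles of size at least v are all
      -- of this form. Such sums ignore the order of the piles, which is all that a step up to
      -- permutation allows.
      W : (ℕ → ℕ) → ℕ → ℕ
      W F t = Σ∈ F (xs t)

      new : ℕ → ℕ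
      new = W σ

      W-id : ∀ t → W id t ≡ n
      W-id t = trans (Σ∈-id (xs t)) (total t)

      W-suc : ∀ F → F 0 ≡ 0 → ∀ t → W F (suc t) ≡ F (new t) + W (F ∘ rest) t
      W-suc F F0 t = trans (sum-↭ (map⁺ F (step t)))
        (trans (Σ∈-filter {F} F0 (new t ∷ zipWith _∸_ (xs t) (map σ (xs t)))) (cong (F (new t) +_) (Σ∈-remaining F σ
            (xs t))))

      -- A pile present at time L + u was either formed in the last L moves and has been reduced
      -- once per move since, or descends from a pile present at time u. The condition F 0 = 0 makes
      -- the discarded empty piles invisible.
      W-unfold : ∀ L F → F 0 ≡ 0 → ∀ u →
        W F (L + u) ≡ Σ< L (λ s → F (restⁱ s (new ((L ∸ suc s) + u)))) + W (F ∘ restⁱ L) u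
      W-unfold zero    F F0 u = refl
      W-unfold (suc L) F F0 u = trans (W-suc F F0 (L + u)) (trans
        (cong (F (new (L + u)) +_) (W-unfold L (F ∘ rest) (trans (cong F rest0≡0) F0) u))
        (sym (+-assoc (F (new (L + u))) _ _)))

      -- No pile exceeds n cards and every move takes a card from each nonempty pile, so n moves use
      -- up the whole old configuration.
      W-ages : ∀ F → F 0 ≡ 0 → ∀ u →
        W F (n + u) ≡ Σ< n (λ s → F (restⁱ s (new ((n ∸ suc s) + u))))
      W-ages F F0 u = trans (W-unfold n F F0 u) (trans
        (cong (Σ< n (λ s → F (restⁱ s (new ((n ∸ suc s) + u)))) +_) (Σ∈-zero n (λ x≤n →
            trans (cong F (restⁱ≡0 x≤n)) F0) (xs u) (≤-reflexive (total u))))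
        (+-identityʳ _))

      -- Periodicity provides a past of any length: t is moved forward by L periods, and the last L
      -- of these moves serve as history.
      recent : ∀ L t → xs t ≡ xs (L + (L * k + t))
      recent L t = trans (sym (periodic-* (suc k) xs period L t))
        (cong xs (solve 3 (λ L k t → L :* (con 1 :+ k) :+ t := L :+ (L :* k :+ t)) refl L k t))

      new≤n : ∀ t → new t ≤ n
      new≤n t = ≤-trans (Σ∈-mono σ≤ (xs t)) (≤-reflexive (W-id t))

      -- Rounding up pile by pile gives at least the rounded total.
      σn≤new : ∀ t → σ n ≤ new t
      σn≤new t = b*-cancel (begin-strict
        b * σ n                      <⟨ upper n ⟩
        a * n + b                    ≡⟨ cong (λ m → a * m + b) (W-id t) ⟨
        a * W id t + b               ≡⟨ cong (_+ b) (Σ∈-*ˡ a id (xs t)) ⟨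
        W (λ x → a * x) t + b        ≤⟨ +-monoˡ-≤ b (Σ∈-mono lower (xs t)) ⟩
        W (λ x → b * σ x) t + b      ≡⟨ cong (_+ b) (Σ∈-*ˡ b σ (xs t)) ⟩
        b * new t + b                ∎)

      #piles : ℕ → ℕ
      #piles = W (1 [≤]_)

      -- Piles of size > H have total at most n, and only H piles can be formed in H moves.
      #piles≤ : ∀ H → n < suc H * suc H → ∀ t → #piles t ≤ H + H
      #piles≤ H n<H² t = begin
        #piles t                         ≡⟨ cong (Σ∈ (1 [≤]_)) (recent H t) ⟩
        #piles (H + u)                   ≡⟨ W-unfold H (1 [≤]_) refl u ⟩
        Σ< H _ + W ((1 [≤]_) ∘ restⁱ H) u
          ≤⟨ +-mono-≤ (Σ<-≤ H (λ s → [≤]≤1 1 (restⁱ s (new ((H ∸ suc s) + u))))) (Σ∈-mono survivor (xs u)) ⟩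
        H + W (suc H [≤]_) u             ≤⟨ +-monoʳ-≤ H c≤H ⟩
        H + H                            ∎
        where
        u = H * k + t
        survivor : ∀ x → (1 [≤] restⁱ H x) ≤ (suc H [≤] x)
        survivor x with suc H ≤? x
        ... | yes H<x = ≤-trans ([≤]≤1 1 (restⁱ H x)) (≤-reflexive (sym (≤⇒[≤]≡1 H<x)))
        ... | no  H≮x = ≤-trans (≤-reflexive (cong (1 [≤]_) (restⁱ≡0 {H} {x} (≮⇒≥ H≮x)))) z≤n
        c≤H : W (suc H [≤]_) u ≤ H
        c≤H = s≤s⁻¹ (*-cancelˡ-< (suc H) _ (suc H) (≤-<-trans (begin
          suc H * W (suc H [≤]_) u             ≡⟨ Σ∈-*ˡ (suc H) (suc H [≤]_) (xs u) ⟨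
          W (λ x → suc H * (suc H [≤] x)) u    ≤⟨ Σ∈-mono (v*[≤]≤x (suc H)) (xs u) ⟩
          W id u                               ≡⟨ W-id u ⟩
          n                                    ∎) n<H²))

      -- Rounding costs at most one card per nonempty pile, so the new pile exceeds (a/b) n by at
      -- most the number of piles.
      new≤ : ∀ H → n < suc H * suc H → ∀ t → new t ≤ σ n + (H + H)
      new≤ H n<H² t = *-cancelˡ-≤ b {{>-nonZero (<-≤-trans 0<a a≤b)}} (begin
        b * new t                                 ≡⟨ Σ∈-*ˡ b σ (xs t) ⟨
        W (λ x → b * σ x) t                       ≤⟨ Σ∈-mono pick≤ (xs t) ⟩
        W (λ x → a * x + b * (1 [≤] x)) t         ≡⟨ Σ∈-+ (a *_) (λ x → b * (1 [≤] x)) (xs t) ⟩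
        W (a *_) t + W (λ x → b * (1 [≤] x)) t    ≡⟨ cong₂ _+_ (Σ∈-*ˡ a id (xs t)) (Σ∈-*ˡ b (1 [≤]_) (xs t)) ⟩
        a * W id t + b * #piles t                 ≤⟨ +-mono-≤ (≤-trans (≤-reflexive (cong (a *_) (W-id t))) (lower n))
                                                       (*-monoʳ-≤ b (#piles≤ H n<H² t)) ⟩
        b * σ n + b * (H + H)                     ≡⟨ *-distribˡ-+ b (σ n) (H + H) ⟨
        b * (σ n + (H + H))                       ∎)
        where
        pick≤ : ∀ x → b * σ x ≤ a * x + b * (1 [≤] x)
        pick≤ zero    = ≤-trans (≤-reflexive (trans (cong (b *_) σ0≡0) (*-zeroʳ b))) z≤n
        pick≤ (suc x) = ≤-trans (<⇒≤ (upper (suc x))) (≤-reflexive (cong (a * suc x +_) (sym (*-identityʳ b))))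

      -- Otherwise i + 1 piles would exceed `restⁱ i hi`. But piles of age at least i do not, and
      -- there are only i younger ones.
      part≤ : ∀ {hi} → (∀ t → new t ≤ hi) → ∀ t i → nth₀ (xs t) i ≤ restⁱ i hi
      part≤ {hi} new≤hi t i = ≮⇒≥ λ v≤ → contradiction (count-≥ (sorted t) (s≤s z≤n) i v≤) (≤⇒≯ (begin
        W (v [≤]_) t                         ≡⟨ cong (Σ∈ (v [≤]_)) (recent n t) ⟩
        W (v [≤]_) (n + u)                   ≡⟨ W-ages (v [≤]_) refl u ⟩
        Σ< n (λ s → v [≤] restⁱ s (new ((n ∸ suc s) + u)))
          ≤⟨ Σ<-mono n (λ {s} _ → [≤]-monoʳ v (restⁱ-mono s (new≤hi ((n ∸ suc s) + u)))) ⟩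
        Σ< n (λ s → v [≤] restⁱ s hi)        ≤⟨ Σ<-support n i (λ s → v [≤] restⁱ s hi) (λ s → [≤]≤1 v (restⁱ s hi))
                                                  (λ i≤s → >⇒[≤]≡0 (s≤s (restⁱ-anti hi i≤s))) ⟩
        i                                    ∎))
        where
        v = suc (restⁱ i hi)
        u = n * k + t

      -- The piles of ages 0, ..., i all keep at least `restⁱ i lo` cards, so the first i + 1 parts
      -- do.
      ≤part : ∀ {lo} → (∀ t → lo ≤ new t) → ∀ t i → restⁱ i lo ≤ nth₀ (xs t) i
      ≤part {lo} lo≤new t i = ≮⇒≥ λ lt → contradiction (count-≤ (sorted t) i lt) (<⇒≱ (begin-strict
        i                                    <⟨ Σ<-ones n (suc i) (λ s → v [≤] restⁱ s lo) (i<n (m<n⇒0<n lt))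
                                                  (λ s<1+i → ≤-reflexive (sym (≤⇒[≤]≡1 (restⁱ-anti lo
                                                      (s≤s⁻¹ s<1+i))))) ⟩
        Σ< n (λ s → v [≤] restⁱ s lo)
          ≤⟨ Σ<-mono n (λ {s} _ → [≤]-monoʳ v (restⁱ-mono s (lo≤new ((n ∸ suc s) + u)))) ⟩
        Σ< n (λ s → v [≤] restⁱ s (new ((n ∸ suc s) + u)))   ≡⟨ W-ages (v [≤]_) (>⇒[≤]≡0 (m<n⇒0<n lt)) u ⟨
        W (v [≤]_) (n + u)                   ≡⟨ cong (Σ∈ (v [≤]_)) (recent n t) ⟨
        W (v [≤]_) t                         ∎))
        where
        v = restⁱ i lo
        u = n * k + t
        -- The i + 1 ages must fit into the n moves unfolded by `W-ages`. They do, since a pile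
        -- still nonempty after i moves started with more than i cards.
        i<n : 0 < v → suc i ≤ n
        i<n 0<v = ≤-trans (m∸n≢0⇒n<m (λ eq → n≮0 (≤-trans (≤-trans 0<v (restⁱ≤ i lo)) (≤-reflexive eq))))
          (≤-trans (lo≤new 0) (new≤n 0))

      -- The classical regime: one card from each pile

      module Bulgarian (hi : ℕ) (new≤hi : ∀ t → new t ≤ hi) (a*hi≤b : a * hi ≤ b) where

        σ≡1 : ∀ {h} → 1 ≤ h → h ≤ hi → σ h ≡ 1
        σ≡1 {h} 1≤h h≤hi = ≤-antisym (b*-cancel (<-≤-trans (upper h) (+-monoˡ-≤ b (≤-trans (*-monoʳ-≤ a h≤hi)
          (≤-trans a*hi≤b (≤-reflexive (sym (*-identityʳ b)))))))) (σ-pos 1≤h)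

        restⁱ≡∸ : ∀ {h} → h ≤ hi → ∀ i → restⁱ i h ≡ h ∸ i
        restⁱ≡∸     h≤hi zero    = refl
        restⁱ≡∸ {h} h≤hi (suc i) rewrite restⁱ≡∸ h≤hi i = trans (rest≡pred (h ∸ i) (≤-trans (m∸n≤m h i) h≤hi))
          (trans (∸-+-assoc h i 1) (cong (h ∸_) (+-comm i 1)))
          where
          rest≡pred : ∀ x → x ≤ hi → rest x ≡ x ∸ 1
          rest≡pred zero    _ = rest0≡0
          rest≡pred (suc x) x≤hi = cong (suc x ∸_) (σ≡1 {suc x} (s≤s z≤n) x≤hi)

        -- A pile formed with h cards has h ∸ s left at age s and gives one card as long as this is
        -- positive. This turns `W-ages` for `σ` into the recursion required by `bulgarian`.
        pick≡ : ∀ {h} s → h ≤ hi → σ (restⁱ s h) ≡ (suc s [≤] h)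
        pick≡ {h} s h≤hi rewrite restⁱ≡∸ h≤hi s with suc s ≤? h
        ... | yes s<h = trans (σ≡1 (m<n⇒0<n∸m s<h) (≤-trans (m∸n≤m h s) h≤hi)) (sym (≤⇒[≤]≡1 s<h))
        ... | no  s≮h = trans (cong σ (m≤n⇒m∸n≡0 (≮⇒≥ s≮h))) (trans σ0≡0 (sym (>⇒[≤]≡0 (≰⇒> s≮h))))

        new-balanced : ∀ u v → new u ≤ suc (new v)
        new-balanced = bulgarian (suc k) n new (s≤s z≤n) (λ t → cong (Σ∈ σ) (period t)) new≤n
          (λ u → trans (W-ages σ σ0≡0 u) (Σ<-cong n (λ {s} _ → pick≡ s (new≤hi _))))

        -- By `new-balanced` every formed pile is within one card of `new 0`, hence lies between
        -- `lo` and `lo + 2`.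
        lo : ℕ
        lo = new 0 ∸ 1

        lo≤new : ∀ t → lo ≤ new t
        lo≤new t = ∸-monoˡ-≤ 1 (new-balanced 0 t)

        2n≥ : lo * suc lo ≤ 2 * n
        2n≥ = begin
          lo * suc lo                   ≤⟨ gaussian-≥ n lo (≤-trans (lo≤new 0) (new≤n 0)) ⟩
          2 * Σ< n (λ s → lo ∸ s)       ≤⟨ *-monoʳ-≤ 2 (Σ<-mono n (λ {s} _ →
              ≤-trans (∸-monoˡ-≤ s (lo≤new ((n ∸ suc s) + 0)))
                                             (≤-reflexive (sym (restⁱ≡∸ (new≤hi _) s))))) ⟩
          2 * Σ< n (λ s → restⁱ s (new ((n ∸ suc s) + 0)))   ≡⟨ cong (2 *_) (W-ages id refl 0) ⟨
          2 * W id (n + 0)              ≡⟨ cong (2 *_) (W-id (n + 0)) ⟩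
          2 * n                         ∎

        new≤2+lo : ∀ t → new t ≤ 2 + lo
        new≤2+lo t = ≤-trans (new-balanced t 0) (s≤s (m≤n+m∸n (new 0) 1))

        2n≤ : 2 * n ≤ (2 + lo) * (3 + lo)
        2n≤ = begin
          2 * n                         ≡⟨ cong (2 *_) (W-id (n + 0)) ⟨
          2 * W id (n + 0)              ≡⟨ cong (2 *_) (W-ages id refl 0) ⟩
          2 * Σ< n (λ s → restⁱ s (new ((n ∸ suc s) + 0)))
            ≤⟨ *-monoʳ-≤ 2 (Σ<-mono n (λ {s} _ → ≤-trans (restⁱ≤ s _) (∸-monoˡ-≤ s (new≤2+lo ((n ∸ suc s) + 0))))) ⟩
          2 * Σ< n (λ s → 2 + lo ∸ s)   ≤⟨ gaussian-≤ n (2 + lo) ⟩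
          (2 + lo) * (3 + lo)           ∎

        triangularBounds : ∀ t → 1 ≤ nth₀ (xs t) 0 → TriangularBounds n (nth₀ (xs t))
        triangularBounds t 1≤l = near-staircase lo (nth₀ (xs t)) 1≤l 2n≥ 2n≤
          (λ i → ≤-trans (≤-reflexive (sym (restⁱ≡∸ (≤-trans (lo≤new 0) (new≤hi 0)) i))) (≤part lo≤new t i))
          (λ i → ≤-trans (part≤ new≤2+lo t i) (restⁱ≤ i (2 + lo)))

open Combinatorics
open import Data.Integer.Base as ℤ using (+_; -[1+_])
import Data.Integer.Properties as ℤ

-- Exponential series over ℚ and its comparison with powers of 1 - q

module RatExtra where
  open import Data.Rational.Base hiding (NonZero)
  open ℚ.+-*-Solver using (solve; _:=_; con; _:+_; _:*_; :-_; _:-_)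
  open ℚ.≤-Reasoning

  ι : ℕ → ℚ
  ι n = + n / 1

  ι-+ : ∀ m n → ι (m ℕ.+ n) ≡ ι m + ι n
  ι-+ zero    n = sym (ℚ.+-identityˡ (ι n))
  ι-+ (suc m) n = trans (Rat.suc/1 (m ℕ.+ n)) (trans (cong (λ t → 1ℚ + t) (ι-+ m n))
    (trans (sym (ℚ.+-assoc 1ℚ (ι m) (ι n))) (cong (_+ ι n) (sym (Rat.suc/1 m)))))

  ι-* : ∀ m n → ι (m ℕ.* n) ≡ ι m * ι n
  ι-* zero    n = sym (ℚ.*-zeroˡ (ι n))
  ι-* (suc m) n = trans (ι-+ n (m ℕ.* n)) (trans (cong (λ t → ι n + t) (ι-* m n))
    (trans (solve 2 (λ m n → n :+ m :* n := (con 1ℚ :+ m) :* n) refl (ι m) (ι n)) (cong (_* ι n) (sym (Rat.suc/1 m)))))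

  ι-mono-≤ : ∀ {m n} → m ℕ.≤ n → ι m ≤ ι n
  ι-mono-≤ = Rat./1-mono-≤

  0≤ι : ∀ n → 0ℚ ≤ ι n
  0≤ι n = ι-mono-≤ {0} {n} ℕ.z≤n

  ι-mono-< : ∀ {m n} → m ℕ.< n → ι m < ι n
  ι-mono-< {m} {n} m<n = ℚ.<-≤-trans
    (subst₂ _<_ (ℚ.+-identityˡ (ι m)) (sym (Rat.suc/1 m)) (ℚ.+-monoˡ-< (ι m) (ℚ.positive⁻¹ 1ℚ)))
    (ι-mono-≤ m<n)

  ι-cancel-≤ : ∀ {m n} → ι m ≤ ι n → m ℕ.≤ n
  ι-cancel-≤ {m} {n} le = ℕ.≮⇒≥ λ n<m → ℚ.<-irrefl refl (ℚ.<-≤-trans (ι-mono-< n<m) le)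

  ι-cancel-< : ∀ {m n} → ι m < ι n → m ℕ.< n
  ι-cancel-< {m} {n} lt = ℕ.≰⇒> λ n≤m → ℚ.<-irrefl refl (ℚ.<-≤-trans lt (ι-mono-≤ n≤m))

  /≡ι* : ∀ m n .{{_ : ℕ.NonZero n}} → (+ m / n) * ι n ≡ ι m
  /≡ι* m (suc n) = ℚ.toℚᵘ-injective (ℚᵘ.≃-trans (ℚ.toℚᵘ-homo-* (+ m / suc n) (ι (suc n)))
    (ℚᵘ.≃-trans
      (ℚᵘ.*-cong (ℚ.toℚᵘ-fromℚᵘ (ℚᵘ.mkℚᵘ (+ m) n)) (ℚ.toℚᵘ-fromℚᵘ (ℚᵘ.mkℚᵘ (+ suc n) 0)))
      (ℚᵘ.≃-trans
        (ℚᵘ.*≡* (trans (ℤ.*-identityʳ _) (cong (λ d → + m ℤ.* + suc d) (sym (ℕ.*-identityʳ n)))))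
        (ℚᵘ.≃-sym (ℚ.toℚᵘ-fromℚᵘ (ℚᵘ.mkℚᵘ (+ m) 0))))))

  gap : ∀ {p q} → p ≤ q → 0ℚ ≤ q - p
  gap {p} {q} p≤q = subst (_≤ q - p) (ℚ.+-inverseʳ p) (ℚ.+-monoˡ-≤ (- p) p≤q)

  -- The shape of most estimates below: an inequality is certified by an explicit slack, a sum of
  -- non-negative multiples of the available inequalities, and the ring solver checks the identity.
  ≤-by : ∀ {p q} s → p + s ≡ q → 0ℚ ≤ s → p ≤ q
  ≤-by {p} s eq 0≤s = subst₂ _≤_ (ℚ.+-identityʳ p) eq (ℚ.+-monoʳ-≤ p 0≤s)

  0≤+ : ∀ {p q} → 0ℚ ≤ p → 0ℚ ≤ q → 0ℚ ≤ p + q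
  0≤+ 0≤p 0≤q = ℚ.≤-trans (ℚ.≤-reflexive (sym (ℚ.+-identityʳ 0ℚ))) (ℚ.+-mono-≤ 0≤p 0≤q)

  0≤* : ∀ {p q} → 0ℚ ≤ p → 0ℚ ≤ q → 0ℚ ≤ p * q
  0≤* {p} {q} 0≤p 0≤q = subst (_≤ p * q) (ℚ.*-zeroʳ p) (ℚ.*-monoˡ-≤-nonNeg p {{nonNegative 0≤p}} 0≤q)

  0<* : ∀ {p q} → 0ℚ < p → 0ℚ < q → 0ℚ < p * q
  0<* {p} {q} 0<p 0<q = subst (_< p * q) (ℚ.*-zeroʳ p) (ℚ.*-monoʳ-<-pos p {{positive 0<p}} 0<q)

  0<+ : ∀ {p q} → 0ℚ < p → 0ℚ ≤ q → 0ℚ < p + q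
  0<+ 0<p 0≤q = ℚ.+-mono-<-≤ 0<p 0≤q

  0≤1 : 0ℚ ≤ 1ℚ
  0≤1 = ℚ.nonNegative⁻¹ 1ℚ

  0<1 : 0ℚ < 1ℚ
  0<1 = ℚ.positive⁻¹ 1ℚ

  divide : ∀ {c d} → 0ℚ < c → 0ℚ < d → ∃[ e ] 0ℚ < e × e * d ≡ c
  divide {c} {d} 0<c 0<d = c * 1/ d , 0<* 0<c (ℚ.positive⁻¹ (1/ d)) ,
    trans (ℚ.*-assoc c (1/ d) d) (trans (cong (c *_) (ℚ.*-inverseˡ d)) (ℚ.*-identityʳ c))
    where
    instance _ = positive 0<d
             _ = ℚ.pos⇒nonZero d
             _ = ℚ.1/pos⇒pos d

  -p≤∣p∣ : ∀ p → - p ≤ ∣ p ∣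
  -p≤∣p∣ p = subst (- p ≤_) (ℚ.∣-p∣≡∣p∣ p) (Rat.p≤∣p∣ (- p))

  abs≤ : ∀ {p c} → p ≤ c → - p ≤ c → ∣ p ∣ ≤ c
  abs≤ {p} p≤c -p≤c with ℚ.∣p∣≡p∨∣p∣≡-p p
  ... | inj₁ eq = subst (_≤ _) (sym eq) p≤c
  ... | inj₂ eq = subst (_≤ _) (sym eq) -p≤c

  abs-+ : ∀ {p q a b} → ∣ p ∣ ≤ a → ∣ q ∣ ≤ b → ∣ p + q ∣ ≤ a + b
  abs-+ {p} {q} p≤a q≤b = ℚ.≤-trans (ℚ.∣p+q∣≤∣p∣+∣q∣ p q) (ℚ.+-mono-≤ p≤a q≤b)

  abs-* : ∀ {p q a b} → ∣ p ∣ ≤ a → ∣ q ∣ ≤ b → ∣ p * q ∣ ≤ a * b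
  abs-* {p} {q} p≤a q≤b = ℚ.≤-trans (ℚ.≤-reflexive (ℚ.∣p*q∣≡∣p∣*∣q∣ p q))
    (Rat.*-mono-nonNeg (ℚ.0≤∣p∣ p) (ℚ.≤-trans (ℚ.0≤∣p∣ q) q≤b) p≤a q≤b)

  abs-nonNeg : ∀ {p c} → 0ℚ ≤ p → p ≤ c → ∣ p ∣ ≤ c
  abs-nonNeg 0≤p p≤c = ℚ.≤-trans (ℚ.≤-reflexive (ℚ.0≤p⇒∣p∣≡p 0≤p)) p≤c

  abs-neg : ∀ {p c} → ∣ p ∣ ≤ c → ∣ - p ∣ ≤ c
  abs-neg {p} = subst (_≤ _) (sym (ℚ.∣-p∣≡∣p∣ p))

  pow : ℚ → ℕ → ℚ
  pow x zero    = 1ℚ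
  pow x (suc k) = x * pow x k

  recip : ℕ → ℚ
  recip j = + 1 / suc j

  term : ℕ → ℚ → ℚ
  term zero    y = 1ℚ
  term (suc j) y = term j y * (y * recip j)

  expPoly : ℕ → ℚ → ℚ
  expPoly zero    y = term zero y
  expPoly (suc j) y = expPoly j y + term (suc j) y

  0≤recip : ∀ j → 0ℚ ≤ recip j
  0≤recip j = ℚ.nonNegative⁻¹ (recip j) {{ℚ.normalize-nonNeg 1 (suc j)}}

  suc*recip : ∀ j → (1ℚ + ι j) * recip j ≡ 1ℚ
  suc*recip j = trans (cong (_* recip j) (sym (Rat.suc/1 j))) (Rat.n*1/n≡1 j)

  recip≤1 : ∀ j → recip j ≤ 1ℚ
  recip≤1 j = ≤-by (ι j * recip j)
    (trans (solve 2 (λ r i → r :+ i :* r := (con 1ℚ :+ i) :* r) refl (recip j) (ι j)) (suc*recip j))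
    (0≤* (0≤ι j) (0≤recip j))

  ∣recip∣≤1 : ∀ j → ∣ recip j ∣ ≤ 1ℚ
  ∣recip∣≤1 j = abs-nonNeg (0≤recip j) (recip≤1 j)

  0≤term : ∀ j {Y} → 0ℚ ≤ Y → 0ℚ ≤ term j Y
  0≤term zero    0≤Y = 0≤1
  0≤term (suc j) 0≤Y = 0≤* (0≤term j 0≤Y) (0≤* 0≤Y (0≤recip j))

  ∣term∣≤ : ∀ j {z Y} → ∣ z ∣ ≤ Y → ∣ term j z ∣ ≤ term j Y
  ∣term∣≤ zero    _   = ℚ.≤-refl
  ∣term∣≤ (suc j) z≤Y = abs-* (∣term∣≤ j z≤Y) (abs-* z≤Y (abs-nonNeg (0≤recip j) ℚ.≤-refl))

  ∣expPoly∣≤ : ∀ j {z Y} → ∣ z ∣ ≤ Y → ∣ expPoly j z ∣ ≤ expPoly j Y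
  ∣expPoly∣≤ zero    _   = ℚ.≤-refl
  ∣expPoly∣≤ (suc j) z≤Y = abs-+ (∣expPoly∣≤ j z≤Y) (∣term∣≤ (suc j) z≤Y)

  0≤expPoly : ∀ j {Y} → 0ℚ ≤ Y → 0ℚ ≤ expPoly j Y
  0≤expPoly zero    0≤Y = 0≤1
  0≤expPoly (suc j) 0≤Y = 0≤+ (0≤expPoly j 0≤Y) (0≤term (suc j) 0≤Y)

  expPoly-0 : ∀ j → expPoly j 0ℚ ≡ 1ℚ
  expPoly-0 zero    = refl
  expPoly-0 (suc j) = trans (cong (_+ term (suc j) 0ℚ) (expPoly-0 j))
    (solve 2 (λ t r → con 1ℚ :+ t :* (con 0ℚ :* r) := con 1ℚ) refl (term j 0ℚ) (recip j))

  -- The first-order Taylor error of z^(j+1)/(j+1)!, whose derivative is z^j/j!.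
  remainder : ℕ → ℚ → ℚ → ℚ
  remainder j z h = term (suc j) (z + h) - term (suc j) z - h * term j z

  -- Multiplying by (z + h)/(j + 2) carries the previous remainder along. The part linear in h
  -- cancels because 1/((j+1)(j+2)) = 1/(j+1) - 1/(j+2), and a multiple of h² is left.
  remainder-suc : ∀ j z h → remainder (suc j) z h ≡
    remainder j z h * ((z + h) * recip (suc j)) + (h * h) * (term j z * recip (suc j))
  remainder-suc j z h = begin-equality
    tʸ * ((z + h) * i) - t * (z * r) * (z * i) - h * (t * (z * r))
      ≡⟨ solve 6 (λ tʸ t z h r i →
           tʸ :* ((z :+ h) :* i) :- t :* (z :* r) :* (z :* i) :- h :* (t :* (z :* r))
           := (tʸ :- t :* (z :* r) :- h :* t) :* ((z :+ h) :* i) :+ h :* h :* (t :* i)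
              :+ h :* (t :* z :* (r :* i :+ i :- r))) refl tʸ t z h r i ⟩
    ρ + h * (t * z * (r * i + i - r))    ≡⟨ cong (λ w → ρ + h * (t * z * w)) partial-fractions ⟩
    ρ + h * (t * z * 0ℚ)                 ≡⟨ solve 4 (λ ρ t z h → ρ :+ h :* (t :* z :* con 0ℚ) := ρ) refl ρ t z h ⟩
    ρ                                    ∎
    where
    t = term j z
    tʸ = term (suc j) (z + h)
    r = recip j
    i = recip (suc j)
    ρ = remainder j z h * ((z + h) * i) + (h * h) * (t * i)
    partial-fractions : r * i + i - r ≡ 0ℚ
    partial-fractions = begin-equality
      r * i + i - r
        ≡⟨ solve 3 (λ r i n → r :* i :+ i :- r := i :* (con 1ℚ :- (con 1ℚ :+ n) :* r)
              :- r :* (con 1ℚ :- (con 1ℚ :+ (con 1ℚ :+ n)) :* i)) refl r i (ι j) ⟩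
      i * (1ℚ - (1ℚ + ι j) * r) - r * (1ℚ - (1ℚ + (1ℚ + ι j)) * i)
        ≡⟨ cong₂ (λ u v → i * (1ℚ - u) - r * (1ℚ - v)) (suc*recip j)
             (trans (cong (λ m → (1ℚ + m) * i) (sym (Rat.suc/1 j))) (suc*recip (suc j))) ⟩
      i * (1ℚ - 1ℚ) - r * (1ℚ - 1ℚ)   ≡⟨ solve 2 (λ r i → i :* (con 1ℚ :- con 1ℚ) :- r :*
          (con 1ℚ :- con 1ℚ) := con 0ℚ) refl r i ⟩
      0ℚ ∎

  -- The recursion of `remainder-suc` with reciprocals bounded by 1. A crude constant suffices, as
  -- the degree is fixed before the step h is made small.
  remainder-bound : ℕ → ℚ → ℚ
  remainder-bound zero    Y = 0ℚ
  remainder-bound (suc j) Y = remainder-bound j Y * (Y * 1ℚ) + 1ℚ * (term j Y * 1ℚ)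

  0≤remainder-bound : ∀ j {Y} → 0ℚ ≤ Y → 0ℚ ≤ remainder-bound j Y
  0≤remainder-bound zero    0≤Y = ℚ.≤-refl
  0≤remainder-bound (suc j) 0≤Y = 0≤+ (0≤* (0≤remainder-bound j 0≤Y) (0≤* 0≤Y 0≤1)) (0≤* 0≤1 (0≤* (0≤term j 0≤Y) 0≤1))

  0≤square : ∀ h → 0ℚ ≤ h * h
  0≤square h with ℚ.≤-total 0ℚ h
  ... | inj₁ 0≤h = 0≤* 0≤h 0≤h
  ... | inj₂ h≤0 = subst (0ℚ ≤_) (solve 1 (λ h → (con 0ℚ :- h) :* (con 0ℚ :- h) := h :* h) refl h)
                     (0≤* (gap h≤0) (gap h≤0))

  ∣remainder∣≤ : ∀ j {z h Y} → ∣ z ∣ ≤ Y → ∣ z + h ∣ ≤ Y → ∣ remainder j z h ∣ ≤ remainder-bound j Y * (h * h)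
  ∣remainder∣≤ zero    {z} {h} {Y} _ _ = ℚ.≤-reflexive (trans (cong ∣_∣
    (solve 2 (λ z h → con 1ℚ :* ((z :+ h) :* con 1ℚ) :- con 1ℚ :* (z :* con 1ℚ) :- h :* con 1ℚ := con 0ℚ) refl z h))
    (sym (ℚ.*-zeroˡ (h * h))))
  ∣remainder∣≤ (suc j) {z} {h} {Y} z≤Y y≤Y = begin
    ∣ remainder (suc j) z h ∣
      ≡⟨ cong ∣_∣ (remainder-suc j z h) ⟩
    ∣ remainder j z h * ((z + h) * recip (suc j)) + (h * h) * (term j z * recip (suc j)) ∣
      ≤⟨ abs-+ (abs-* (∣remainder∣≤ j z≤Y y≤Y) (abs-* y≤Y (∣recip∣≤1 (suc j))))
               (abs-* (abs-nonNeg (0≤square h) ℚ.≤-refl) (abs-* (∣term∣≤ j z≤Y) (∣recip∣≤1 (suc j)))) ⟩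
    remainder-bound j Y * (h * h) * (Y * 1ℚ) + h * h * (term j Y * 1ℚ)
      ≡⟨ solve 4 (λ D s Y t → D :* s :* (Y :* con 1ℚ) :+ s :* (t :* con 1ℚ)
            := (D :* (Y :* con 1ℚ) :+ con 1ℚ :* (t :* con 1ℚ)) :* s) refl (remainder-bound j Y) (h * h) Y (term j Y) ⟩
    remainder-bound (suc j) Y * (h * h) ∎

  taylor-bound : ℕ → ℚ → ℚ
  taylor-bound zero    Y = remainder-bound 0 Y
  taylor-bound (suc j) Y = taylor-bound j Y + remainder-bound (suc j) Y

  0≤taylor-bound : ∀ j {Y} → 0ℚ ≤ Y → 0ℚ ≤ taylor-bound j Y
  0≤taylor-bound zero    0≤Y = 0≤remainder-bound 0 0≤Y
  0≤taylor-bound (suc j) 0≤Y = 0≤+ (0≤taylor-bound j 0≤Y) (0≤remainder-bound (suc j) 0≤Y)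

  taylor : ∀ j {z h Y} → ∣ z ∣ ≤ Y → ∣ z + h ∣ ≤ Y →
    ∣ expPoly (suc j) (z + h) - expPoly (suc j) z - h * expPoly j z ∣ ≤ taylor-bound j Y * (h * h)
  taylor zero    {z} {h} z≤Y y≤Y = subst (λ w → ∣ w ∣ ≤ _)
    (solve 3 (λ a b h → a :- b :- h :* con 1ℚ := (con 1ℚ :+ a) :- (con 1ℚ :+ b) :- h :* con 1ℚ) refl
      (term 1 (z + h)) (term 1 z) h) (∣remainder∣≤ 0 z≤Y y≤Y)
  taylor (suc j) {z} {h} {Y} z≤Y y≤Y = begin
    ∣ p + t - (p′ + t′) - h * (p″ + t″) ∣
      ≡⟨ cong ∣_∣ (solve 7 (λ p t p′ t′ p″ t″ h → p :+ t :- (p′ :+ t′) :- h :* (p″ :+ t″)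
           := (p :- p′ :- h :* p″) :+ (t :- t′ :- h :* t″)) refl p t p′ t′ p″ t″ h) ⟩
    ∣ (p - p′ - h * p″) + remainder (suc j) z h ∣
      ≤⟨ abs-+ (taylor j z≤Y y≤Y) (∣remainder∣≤ (suc j) z≤Y y≤Y) ⟩
    taylor-bound j Y * (h * h) + remainder-bound (suc j) Y * (h * h)
      ≡⟨ ℚ.*-distribʳ-+ (h * h) (taylor-bound j Y) (remainder-bound (suc j) Y) ⟨
    taylor-bound (suc j) Y * (h * h) ∎
    where
    p  = expPoly (suc j) (z + h)
    t  = term (suc (suc j)) (z + h)
    p′ = expPoly (suc j) z
    t′ = term (suc (suc j)) z
    p″ = expPoly j z
    t″ = term (suc j) z

  -- Both sides satisfy e_{k+1} = (1 − q) e_k, expPoly only up to the Taylor error and its last term.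
  expPoly-pow : ∀ N {Y τ q} → (∀ {z} → ∣ z ∣ ≤ Y → ∣ term (suc N) z ∣ ≤ τ) → 0ℚ ≤ q → q ≤ 1ℚ → ∀ k → ι k * q ≤ Y →
    ∣ expPoly (suc N) (- (ι k * q)) - pow (1ℚ - q) k ∣ ≤ ι k * q * (taylor-bound N Y * q + τ)
  expPoly-pow N {Y} {τ} {q} last≤ 0≤q q≤1 zero _ = ℚ.≤-reflexive (begin-equality
    ∣ expPoly (suc N) (- (0ℚ * q)) - 1ℚ ∣  ≡⟨ cong (λ z → ∣ expPoly (suc N) z - 1ℚ ∣) (solve 1 (λ q →
        :- (con 0ℚ :* q) := con 0ℚ) refl q) ⟩
    ∣ expPoly (suc N) 0ℚ - 1ℚ ∣            ≡⟨ cong (λ p → ∣ p - 1ℚ ∣) (expPoly-0 (suc N)) ⟩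
    ∣ 1ℚ - 1ℚ ∣                         ≡⟨ solve 2 (λ q c → con 0ℚ := con 0ℚ :* q :* c) refl q
        (taylor-bound N Y * q + τ) ⟩
    0ℚ * q * (taylor-bound N Y * q + τ) ∎)
  expPoly-pow N {Y} {τ} {q} last≤ 0≤q q≤1 (suc k) kq≤Y = begin
    ∣ P (- (ι (suc k) * q)) - (1ℚ - q) * w ∣
      ≡⟨ cong (λ y → ∣ P y - (1ℚ - q) * w ∣) shift ⟩
    ∣ P (z + - q) - (1ℚ - q) * w ∣
      ≡⟨ cong ∣_∣ (solve 5 (λ P′ p t q w → P′ :- (con 1ℚ :- q) :* w
            := (P′ :- (p :+ t) :- (:- q) :* p) :+ ((con 1ℚ :- q) :* ((p :+ t) :- w) :+ q :* t))
           refl (P (z + - q)) (expPoly N z) (term (suc N) z) q w) ⟩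
    ∣ (P (z + - q) - P z - (- q) * expPoly N z) + ((1ℚ - q) * (P z - w) + q * term (suc N) z) ∣
      ≤⟨ abs-+ (taylor N z≤Y y≤Y) (abs-+
           (abs-* (abs-nonNeg (gap q≤1) 1-q≤1) (expPoly-pow N last≤ 0≤q q≤1 k kq≤Y′))
           (abs-* (abs-nonNeg 0≤q ℚ.≤-refl) (last≤ z≤Y))) ⟩
    C * ((- q) * (- q)) + (1ℚ * (ι k * q * (C * q + τ)) + q * τ)
      ≡⟨ solve 4 (λ C q τ k → C :* ((:- q) :* (:- q)) :+ (con 1ℚ :* (k :* q :* (C :* q :+ τ)) :+ q :* τ)
            := (con 1ℚ :+ k) :* q :* (C :* q :+ τ)) refl C q τ (ι k) ⟩
    (1ℚ + ι k) * q * (C * q + τ)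
      ≡⟨ cong (λ m → m * q * (C * q + τ)) (sym (Rat.suc/1 k)) ⟩
    ι (suc k) * q * (C * q + τ) ∎
    where
    P = expPoly (suc N)
    C = taylor-bound N Y
    z = - (ι k * q)
    w = pow (1ℚ - q) k
    shift : - (ι (suc k) * q) ≡ z + - q
    shift = trans (cong (λ m → - (m * q)) (Rat.suc/1 k))
      (solve 2 (λ k q → :- ((con 1ℚ :+ k) :* q) := :- (k :* q) :+ :- q) refl (ι k) q)
    1-q≤1 : 1ℚ - q ≤ 1ℚ
    1-q≤1 = ≤-by q (solve 1 (λ q → (con 1ℚ :- q) :+ q := con 1ℚ) refl q) 0≤q
    kq≤Y′ : ι k * q ≤ Y
    kq≤Y′ = ℚ.≤-trans (ℚ.*-monoʳ-≤-nonNeg q {{nonNegative 0≤q}} (ι-mono-≤ (ℕ.n≤1+n k))) kq≤Y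
    z≤Y : ∣ z ∣ ≤ Y
    z≤Y = abs-neg {ι k * q} (abs-nonNeg (0≤* (0≤ι k) 0≤q) kq≤Y′)
    y≤Y : ∣ z + - q ∣ ≤ Y
    y≤Y = subst (λ y → ∣ y ∣ ≤ Y) shift (abs-neg {ι (suc k) * q} (abs-nonNeg (0≤* (0≤ι (suc k)) 0≤q) kq≤Y))

  -- The ratio of consecutive terms is z/(K + j + 1), of absolute value at most ½ once K exceeds 2Y.
  term-halves : ∀ K {Y z} → 0ℚ ≤ Y → Y + Y < ι K → ∣ z ∣ ≤ Y → ∀ j → ∣ term (K ℕ.+ j) z ∣ ≤ Rat.halve (term K Y) j
  term-halves K {Y} {z} 0≤Y 2Y<K z≤Y zero    = subst (λ k → ∣ term k z ∣ ≤ term K Y) (sym (ℕ.+-identityʳ K))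
      (∣term∣≤ K z≤Y)
  term-halves K {Y} {z} 0≤Y 2Y<K z≤Y (suc j) = subst (λ k → ∣ term k z ∣ ≤ ½ * Rat.halve (term K Y) j) (sym
      (ℕ.+-suc K j))
    (ℚ.≤-trans (abs-* (term-halves K 0≤Y 2Y<K z≤Y j) ratio≤½) (ℚ.≤-reflexive (ℚ.*-comm (Rat.halve (term K Y) j) ½)))
    where
    r = recip (K ℕ.+ j)
    ratio≤½ : ∣ z * r ∣ ≤ ½
    ratio≤½ = begin
      ∣ z * r ∣                          ≤⟨ abs-* z≤Y (abs-nonNeg (0≤recip (K ℕ.+ j)) ℚ.≤-refl) ⟩
      Y * r                              ≡⟨ solve 2 (λ Y r → Y :* r := con ½ :* ((Y :+ Y) :* r)) refl Y r ⟩
      ½ * ((Y + Y) * r)                  ≤⟨ ℚ.*-monoˡ-≤-nonNeg ½ (ℚ.*-monoʳ-≤-nonNeg r {{nonNegative (0≤recip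
          (K ℕ.+ j))}}
                                              (ℚ.≤-trans (ℚ.<⇒≤ 2Y<K) (ι-mono-≤ (ℕ.m≤n⇒m≤1+n (ℕ.m≤m+n K j))))) ⟩
      ½ * (ι (suc (K ℕ.+ j)) * r)        ≡⟨ cong (½ *_) (Rat.n*1/n≡1 (K ℕ.+ j)) ⟩
      ½                                  ∎

  expPoly-tail : ∀ K {Y z} → 0ℚ ≤ Y → Y + Y < ι K → ∣ z ∣ ≤ Y → ∀ j i →
    Rat.dist (expPoly (K ℕ.+ i) z) (expPoly (K ℕ.+ (j ℕ.+ i)) z) ≤ Rat.halve (term K Y) i
  expPoly-tail K {Y} {z} 0≤Y 2Y<K z≤Y j i = Rat.tail-bound (λ i → expPoly (K ℕ.+ i) z) (Rat.halve (term K Y))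
    (Rat.halve-nonNeg (0≤term K 0≤Y)) (λ i → Rat.half+half (Rat.halve (term K Y) i)) step j i
    where
    step : ∀ i → Rat.dist (expPoly (K ℕ.+ i) z) (expPoly (K ℕ.+ suc i) z) ≤ Rat.halve (term K Y) (suc i)
    step i = subst (λ k → Rat.dist (expPoly (K ℕ.+ i) z) (expPoly k z) ≤ Rat.halve (term K Y) (suc i)) (sym
        (ℕ.+-suc K i))
      (begin
        Rat.dist (expPoly (K ℕ.+ i) z) (expPoly (suc (K ℕ.+ i)) z)   ≡⟨ Rat.dist-comm (expPoly (K ℕ.+ i) z) _ ⟩
        ∣ expPoly (K ℕ.+ i) z + term (suc (K ℕ.+ i)) z - expPoly (K ℕ.+ i) z ∣
          ≡⟨ cong ∣_∣ (solve 2 (λ p t → p :+ t :- p := t) refl (expPoly (K ℕ.+ i) z) (term (suc (K ℕ.+ i)) z)) ⟩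
        ∣ term (suc (K ℕ.+ i)) z ∣   ≡⟨ cong (λ k → ∣ term k z ∣) (sym (ℕ.+-suc K i)) ⟩
        ∣ term (K ℕ.+ suc i) z ∣     ≤⟨ term-halves K 0≤Y 2Y<K z≤Y (suc i) ⟩
        Rat.halve (term K Y) (suc i) ∎)

  module _ (K i₀ : ℕ) {X τ δ : ℚ} (0≤X : 0ℚ ≤ X) (2Y<K : (X + 1ℚ) + (X + 1ℚ) < ι K)
    (h≤τ : Rat.halve (term K (X + 1ℚ)) (suc i₀) ≤ τ) (0≤δ : 0ℚ ≤ δ) (δ≤1 : δ ≤ 1ℚ) where

    private
      Y = X + 1ℚ
      N = K ℕ.+ i₀
      M = suc N
      B = expPoly N Y
      C = taylor-bound N Y

      0≤Y : 0ℚ ≤ Y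
      0≤Y = 0≤+ 0≤X 0≤1

      0≤τ : 0ℚ ≤ τ
      0≤τ = ℚ.≤-trans (Rat.halve-nonNeg (0≤term K 0≤Y) (suc i₀)) h≤τ

      0≤C : 0ℚ ≤ C
      0≤C = 0≤taylor-bound N 0≤Y

      K+1+i₀≡M : K ℕ.+ suc i₀ ≡ M
      K+1+i₀≡M = ℕ.+-suc K i₀

      last≤ : ∀ {z} → ∣ z ∣ ≤ Y → ∣ term M z ∣ ≤ τ
      last≤ {z} z≤Y = subst (λ k → ∣ term k z ∣ ≤ τ) K+1+i₀≡M (ℚ.≤-trans (term-halves K 0≤Y 2Y<K z≤Y (suc i₀)) h≤τ)

      expPoly-cut : ∀ {i z} → M ℕ.≤ i → ∣ z ∣ ≤ Y → ∣ expPoly i z - expPoly M z ∣ ≤ τ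
      expPoly-cut {i} {z} M≤i z≤Y = ℚ.≤-trans (ℚ.≤-trans (ℚ.≤-reflexive (Rat.dist-comm (expPoly i z) (expPoly M z)))
        (subst₂ (λ a b → Rat.dist (expPoly a z) (expPoly b z) ≤ Rat.halve (term K Y) (suc i₀)) K+1+i₀≡M index
          (expPoly-tail K 0≤Y 2Y<K z≤Y (i ℕ.∸ M) (suc i₀)))) h≤τ
        where
        index : K ℕ.+ (i ℕ.∸ M ℕ.+ suc i₀) ≡ i
        index = trans (cong (K ℕ.+_) (ℕ.+-comm (i ℕ.∸ M) (suc i₀))) (trans (sym (ℕ.+-assoc K (suc i₀) (i ℕ.∸ M)))
          (trans (cong (ℕ._+ (i ℕ.∸ M)) K+1+i₀≡M) (ℕ.m+[n∸m]≡n M≤i)))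

    -- Three errors add up: τ for cutting the series at degree M, C δ + δ B for moving the argument
    -- from -x to -kq, and Y (C δ + τ) for passing to (1 - q)^k. Uniformity in i matters, since
    -- `exp` evaluates the i-th partial sum at the i-th approximant.
    exp-close : ∀ {i q k x} → M ℕ.≤ i → 0ℚ ≤ q → q ≤ δ → 0ℚ ≤ x → x ≤ X → ∣ x - ι k * q ∣ ≤ δ →
      ∣ expPoly i (- x) - pow (1ℚ - q) k ∣ ≤ τ + (C * δ + δ * B + Y * (C * δ + τ))
    exp-close {i} {q} {k} {x} M≤i 0≤q q≤δ 0≤x x≤X near = begin
      ∣ expPoly i (- x) - w ∣
        ≡⟨ cong ∣_∣ (solve 5 (λ a b c w d → a :- w := (a :- b) :+ ((:- (c :- b :- d)) :+ (:- d) :+ (c :- w)))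
             refl (expPoly i (- x)) (expPoly M (- x)) (expPoly M z) w (η * expPoly N (- x))) ⟩
      ∣ (expPoly i (- x) - expPoly M (- x)) +
        ((- (expPoly M z - expPoly M (- x) - η * expPoly N (- x))) + (- (η * expPoly N (- x))) + (expPoly M z - w)) ∣
        ≤⟨ abs-+ (expPoly-cut M≤i x≤Y) (abs-+ (abs-+
             (abs-neg {expPoly M z - expPoly M (- x) - η * expPoly N (- x)}
               (subst (λ y → ∣ expPoly M y - expPoly M (- x) - η * expPoly N (- x) ∣ ≤ C * (η * η)) (sym z≡)
                   (taylor N x≤Y y≤Y)))
             (abs-neg {η * expPoly N (- x)} (abs-* near (∣expPoly∣≤ N x≤Y))))
             (expPoly-pow N last≤ 0≤q (ℚ.≤-trans q≤δ δ≤1) k kq≤Y)) ⟩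
      τ + (C * (η * η) + δ * B + ι k * q * (C * q + τ))
        ≤⟨ ℚ.+-monoʳ-≤ τ (ℚ.+-mono-≤ (ℚ.+-monoˡ-≤ (δ * B) (ℚ.*-monoˡ-≤-nonNeg C {{nonNegative 0≤C}} η²≤δ))
             (Rat.*-mono-nonNeg (0≤* (0≤ι k) 0≤q) (0≤+ (0≤* 0≤C 0≤δ) 0≤τ) kq≤Y
               (ℚ.+-monoˡ-≤ τ (ℚ.*-monoˡ-≤-nonNeg C {{nonNegative 0≤C}} q≤δ)))) ⟩
      τ + (C * δ + δ * B + Y * (C * δ + τ)) ∎
      where
      w = pow (1ℚ - q) k
      z = - (ι k * q)
      η = x - ι k * q
      z≡ : z ≡ - x + η
      z≡ = solve 2 (λ x y → :- y := :- x :+ (x :- y)) refl x (ι k * q)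
      x≤Y : ∣ - x ∣ ≤ Y
      x≤Y = abs-neg {x} (abs-nonNeg 0≤x (≤-by ((X - x) + 1ℚ)
        (solve 2 (λ x X → x :+ ((X :- x) :+ con 1ℚ) := X :+ con 1ℚ) refl x X) (0≤+ (gap x≤X) 0≤1)))
      kq≤Y : ι k * q ≤ Y
      kq≤Y = ≤-by ((δ - - η) + (1ℚ - δ) + (X - x))
        (solve 4 (λ y δ x X → y :+ ((δ :- (:- (x :- y))) :+ (con 1ℚ :- δ) :+ (X :- x)) := X :+ con 1ℚ) refl
            (ι k * q) δ x X)
        (0≤+ (0≤+ (gap (ℚ.≤-trans (-p≤∣p∣ η) near)) (gap δ≤1)) (gap x≤X))
      y≤Y : ∣ - x + η ∣ ≤ Y
      y≤Y = subst (λ y → ∣ y ∣ ≤ Y) z≡ (abs-neg {ι k * q} (abs-nonNeg (0≤* (0≤ι k) 0≤q) kq≤Y))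
      η²≤δ : η * η ≤ δ
      η²≤δ = ℚ.≤-trans (Rat.p≤∣p∣ (η * η)) (ℚ.≤-trans (abs-* near (ℚ.≤-trans near δ≤1)) (ℚ.≤-reflexive
          (ℚ.*-identityʳ δ)))

  -- The total error is τ (1 + Y) + δ (B + C + Y C), and each summand receives half of ε. The 1
  -- added in the second factor keeps the divisor positive.
  exp-budget : ∀ {τ C δ B Y δ′ ε} → 0ℚ ≤ δ → δ ≤ δ′ → 0ℚ ≤ B → 0ℚ ≤ C → 0ℚ ≤ Y →
    τ * (1ℚ + Y) ≡ ½ * ε → δ′ * (1ℚ + (B + C + Y * C)) ≡ ½ * ε → τ + (C * δ + δ * B + Y * (C * δ + τ)) ≤ ε
  exp-budget {τ} {C} {δ} {B} {Y} {δ′} {ε} 0≤δ δ≤δ′ 0≤B 0≤C 0≤Y split scale = begin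
    τ + (C * δ + δ * B + Y * (C * δ + τ))
      ≤⟨ ≤-by (δ + (δ′ - δ) * (1ℚ + (B + C + Y * C)))
           (solve 6 (λ τ C δ B Y δ′ → τ :+ (C :* δ :+ δ :* B :+ Y :* (C :* δ :+ τ))
               :+ (δ :+ (δ′ :- δ) :* (con 1ℚ :+ (B :+ C :+ Y :* C)))
             := τ :* (con 1ℚ :+ Y) :+ δ′ :* (con 1ℚ :+ (B :+ C :+ Y :* C))) refl τ C δ B Y δ′)
           (0≤+ 0≤δ (0≤* (gap δ≤δ′) (0≤+ 0≤1 (0≤+ (0≤+ 0≤B 0≤C) (0≤* 0≤Y 0≤C))))) ⟩
    τ * (1ℚ + Y) + δ′ * (1ℚ + (B + C + Y * C))   ≡⟨ cong₂ _+_ split scale ⟩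
    ½ * ε + ½ * ε                      ≡⟨ Rat.half+half ε ⟩
    ε                                  ∎

  0<⊓ : ∀ {p q} → 0ℚ < p → 0ℚ < q → 0ℚ < p ⊓ q
  0<⊓ {p} {q} 0<p 0<q with ℚ.⊓-sel p q
  ... | inj₁ eq = subst (0ℚ <_) (sym eq) 0<p
  ... | inj₂ eq = subst (0ℚ <_) (sym eq) 0<q

  -- The order of choices is forced: τ from ε, the degree from τ, then B and C, which depend on the
  -- degree, and only then δ.
  exp-approx : ∀ {X ε} → 0ℚ ≤ X → 0ℚ < ε → ∃[ δ ] 0ℚ < δ × ∃[ I ] ∀ {i q k x} → I ℕ.≤ i →
    0ℚ ≤ q → q ≤ δ → 0ℚ ≤ x → x ≤ X → ∣ x - ι k * q ∣ ≤ δ → ∣ expPoly i (- x) - pow (1ℚ - q) k ∣ ≤ ε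
  exp-approx {X} {ε} 0≤X 0<ε = choose (Rat.below-ℕ ((X + 1ℚ) + (X + 1ℚ)))
    (divide {d = 1ℚ + (X + 1ℚ)} (Rat.half-pos 0<ε) (0<+ 0<1 0≤Y))
    where
    Y = X + 1ℚ
    0≤Y : 0ℚ ≤ Y
    0≤Y = 0≤+ 0≤X 0≤1
    Goal = ∃[ δ ] 0ℚ < δ × ∃[ I ] ∀ {i q k x} → I ℕ.≤ i →
      0ℚ ≤ q → q ≤ δ → 0ℚ ≤ x → x ≤ X → ∣ x - ι k * q ∣ ≤ δ → ∣ expPoly i (- x) - pow (1ℚ - q) k ∣ ≤ ε
    choose : ∃[ K ] Y + Y < ι K → ∃[ τ ] 0ℚ < τ × τ * (1ℚ + Y) ≡ ½ * ε → Goal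
    choose (K , 2Y<K) (τ , 0<τ , split) = choose′ (Rat.halve→0 (term K Y) 0<τ)
      where
      choose′ : ∃[ i ] Rat.halve (term K Y) i < τ → Goal
      choose′ (i₀ , h<τ) = choose″ (divide {d = 1ℚ + (B + C + Y * C)} (Rat.half-pos 0<ε)
          (0<+ 0<1 (0≤+ (0≤+ 0≤B 0≤C) (0≤* 0≤Y 0≤C))))
        where
        B = expPoly (K ℕ.+ i₀) Y
        C = taylor-bound (K ℕ.+ i₀) Y
        0≤B = 0≤expPoly (K ℕ.+ i₀) 0≤Y
        0≤C = 0≤taylor-bound (K ℕ.+ i₀) 0≤Y
        h≤τ : Rat.halve (term K Y) (suc i₀) ≤ τ
        h≤τ = ≤-by (½ * h + (τ - h)) (solve 2 (λ h τ → con ½ :* h :+ (con ½ :* h :+ (τ :- h)) := τ) refl h τ)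
          (0≤+ (0≤* (ℚ.nonNegative⁻¹ ½) (Rat.halve-nonNeg (0≤term K 0≤Y) i₀)) (gap (ℚ.<⇒≤ h<τ)))
          where h = Rat.halve (term K Y) i₀
        choose″ : ∃[ δ′ ] 0ℚ < δ′ × δ′ * (1ℚ + (B + C + Y * C)) ≡ ½ * ε → Goal
        choose″ (δ′ , 0<δ′ , scale) = 1ℚ ⊓ δ′ , 0<δ , suc (K ℕ.+ i₀) , λ {i} {q} {k} {x} I≤i 0≤q q≤δ 0≤x x≤X near →
          ℚ.≤-trans (exp-close K i₀ 0≤X 2Y<K h≤τ (ℚ.<⇒≤ 0<δ) (ℚ.p⊓q≤p 1ℚ δ′) {i} {q} {k} {x} I≤i 0≤q q≤δ 0≤x x≤X near)
            (exp-budget {τ} {C} {1ℚ ⊓ δ′} {B} {Y} {δ′} (ℚ.<⇒≤ 0<δ) (ℚ.p⊓q≤q 1ℚ δ′) 0≤B 0≤C 0≤Y split scale)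
          where
          0<δ : 0ℚ < 1ℚ ⊓ δ′
          0<δ = 0<⊓ 0<1 0<δ′

open RatExtra

-- Distance from the two limit shapes, over ℚ

module _ where
  open import Data.Rational.Base hiding (NonZero)
  open ℚ.+-*-Solver using (solve; _:=_; con; _:+_; _:*_; :-_; _:-_)
  open ℚ.≤-Reasoning

  2ℚ 3ℚ : ℚ
  2ℚ = 1ℚ + 1ℚ
  3ℚ = 1ℚ + 2ℚ

  0≤½ : 0ℚ ≤ ½
  0≤½ = ℚ.nonNegative⁻¹ ½

  *-cancelʳ-≤ : ∀ {p q l} → 0ℚ < l → p * l ≤ q * l → p ≤ q
  *-cancelʳ-≤ {l = l} 0<l = ℚ.*-cancelʳ-≤-pos l {{positive 0<l}}

  square-cancel-≤ : ∀ {p q} → 0ℚ ≤ q → p * p ≤ q * q → p ≤ q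
  square-cancel-≤ {p} {q} 0≤q p²≤q² = ℚ.≮⇒≥ λ q<p → ℚ.<-irrefl refl (begin-strict
    q * q  ≤⟨ ℚ.*-monoˡ-≤-nonNeg q {{nonNegative 0≤q}} (ℚ.<⇒≤ q<p) ⟩
    q * p  <⟨ ℚ.*-monoˡ-<-pos p {{positive (ℚ.≤-<-trans 0≤q q<p)}} q<p ⟩
    p * p  ≤⟨ p²≤q² ⟩
    q * q  ∎)

  pow-nonNeg : ∀ {p} → 0ℚ ≤ p → ∀ k → 0ℚ ≤ pow p k
  pow-nonNeg 0≤p zero    = 0≤1
  pow-nonNeg 0≤p (suc k) = 0≤* 0≤p (pow-nonNeg 0≤p k)

  pow≤1 : ∀ {p} → 0ℚ ≤ p → p ≤ 1ℚ → ∀ k → pow p k ≤ 1ℚ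
  pow≤1 0≤p p≤1 zero    = ℚ.≤-refl
  pow≤1 0≤p p≤1 (suc k) = Rat.*-mono-nonNeg 0≤p 0≤1 p≤1 (pow≤1 0≤p p≤1 k)

  module _ {n l λₖ k x u w v X : ℚ} (ul≡1 : u * l ≡ 1ℚ) (0≤u : 0ℚ ≤ u) (vl≡λ : v * l ≡ λₖ) (wl≡n : w * l ≡ n)
    (0≤x : 0ℚ ≤ x) (x≤X : x ≤ X) (k≤ : k ≤ x * w + 1ℚ) (≤k : x * w ≤ k + 2ℚ)
    (l²≤ : l * l ≤ ι 2 * n + ι 3 * l) (2n≤ : ι 2 * n ≤ l * l + ι 11 * l)
    (0≤λ : 0ℚ ≤ λₖ) (λ-lo : l ≤ λₖ + (k + 2ℚ)) (λ-hi : λₖ + k ≤ l + 2ℚ ⊎ λₖ ≡ 0ℚ) where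

    private
      -- The lower estimate loses (3 + 11x/2) u and the upper one (4 + 3x/2) u; both are at most 6
      -- (1 + X) u.
      C = ι 6 * (1ℚ + X)

      *u : ∀ {p q} → p ≤ q → p * u ≤ q * u
      *u = ℚ.*-monoʳ-≤-nonNeg u {{nonNegative 0≤u}}

      w≡nu : w ≡ n * u
      w≡nu = begin-equality
        w            ≡⟨ ℚ.*-identityʳ w ⟨
        w * 1ℚ       ≡⟨ cong (w *_) ul≡1 ⟨
        w * (u * l)  ≡⟨ solve 3 (λ w u l → w :* (u :* l) := (w :* l) :* u) refl w u l ⟩
        w * l * u    ≡⟨ cong (_* u) wl≡n ⟩
        n * u        ∎

      v≡λu : v ≡ λₖ * u
      v≡λu = begin-equality
        v            ≡⟨ ℚ.*-identityʳ v ⟨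
        v * 1ℚ       ≡⟨ cong (v *_) ul≡1 ⟨
        v * (u * l)  ≡⟨ solve 3 (λ w u l → w :* (u :* l) := (w :* l) :* u) refl v u l ⟩
        v * l * u    ≡⟨ cong (_* u) vl≡λ ⟩
        λₖ * u       ∎

      wu-lo : 1ℚ ≤ ι 2 * (w * u) + ι 3 * u
      wu-lo = begin
        1ℚ                              ≡⟨ cong₂ _*_ (sym ul≡1) (sym ul≡1) ⟩
        (u * l) * (u * l)               ≡⟨ solve 2 (λ u l → (u :* l) :* (u :* l) := l :* l :* u :* u) refl u l ⟩
        l * l * u * u                   ≤⟨ *u (*u l²≤) ⟩
        (ι 2 * n + ι 3 * l) * u * u     ≡⟨ solve 3 (λ n u l → (con (ι 2) :* n :+ con (ι 3) :* l) :* u :* u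
                                             := con (ι 2) :* ((n :* u) :* u) :+ con (ι 3) :* (u :* l) :* u) refl n u l ⟩
        ι 2 * ((n * u) * u) + ι 3 * (u * l) * u   ≡⟨ cong₂ (λ a b → ι 2 * (a * u) + ι 3 * b * u) (sym w≡nu) ul≡1 ⟩
        ι 2 * (w * u) + ι 3 * 1ℚ * u    ≡⟨⟩
        ι 2 * (w * u) + ι 3 * u         ∎

      wu-hi : ι 2 * (w * u) ≤ 1ℚ + ι 11 * u
      wu-hi = begin
        ι 2 * (w * u)                   ≡⟨ cong (λ a → ι 2 * (a * u)) w≡nu ⟩
        ι 2 * ((n * u) * u)             ≡⟨ solve 2 (λ n u → con (ι 2) :* ((n :* u) :* u) := con
            (ι 2) :* n :* u :* u) refl n u ⟩
        ι 2 * n * u * u                 ≤⟨ *u (*u 2n≤) ⟩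
        (l * l + ι 11 * l) * u * u      ≡⟨ solve 2 (λ u l → (l :* l :+ con (ι 11) :* l) :* u :* u
                                             := (u :* l) :* (u :* l) :+ con (ι 11) :* (u :* l) :* u) refl u l ⟩
        (u * l) * (u * l) + ι 11 * (u * l) * u   ≡⟨ cong (λ b → b * b + ι 11 * b * u) ul≡1 ⟩
        1ℚ + ι 11 * u                   ∎

      T = 1ℚ + - (x * ½)

      0≤C*u : 0ℚ ≤ C * u
      0≤C*u = 0≤* (0≤* (0≤ι 6) (0≤+ 0≤1 (ℚ.≤-trans 0≤x x≤X))) 0≤u

      0≤v : 0ℚ ≤ v
      0≤v = subst (0ℚ ≤_) (sym v≡λu) (0≤* 0≤λ 0≤u)

      1≤ : 1ℚ ≤ v + (k + 2ℚ) * u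
      1≤ = begin
        1ℚ                      ≡⟨ ul≡1 ⟨
        u * l                   ≡⟨ ℚ.*-comm u l ⟩
        l * u                   ≤⟨ *u λ-lo ⟩
        (λₖ + (k + 2ℚ)) * u     ≡⟨ ℚ.*-distribʳ-+ u λₖ (k + 2ℚ) ⟩
        λₖ * u + (k + 2ℚ) * u   ≡⟨ cong (_+ (k + 2ℚ) * u) v≡λu ⟨
        v + (k + 2ℚ) * u        ∎

      T≤ : T ≤ v + C * u
      T≤ = ≤-by (g₁ + g₂ + g₃ + g₄)
        (solve 6 (λ x v k u w X →
            (con 1ℚ :+ :- (x :* con ½))
              :+ (((v :+ (k :+ con 2ℚ) :* u) :- con 1ℚ)
              :+ ((x :* w :+ con 1ℚ) :* u :- k :* u)
              :+ x :* con ½ :* ((con 1ℚ :+ con (ι 11) :* u) :- con (ι 2) :* (w :* u))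
              :+ ((X :- x) :* con (ι 6) :* u :+ con ½ :* x :* u :+ con (ι 3) :* u))
            := v :+ con (ι 6) :* (con 1ℚ :+ X) :* u) refl x v k u w X)
        (0≤+ (0≤+ (0≤+ (gap 1≤) (gap (*u k≤))) (0≤* (0≤* 0≤x 0≤½) (gap wu-hi)))
          (0≤+ (0≤+ (0≤* (0≤* (gap x≤X) (0≤ι 6)) 0≤u) (0≤* (0≤* 0≤½ 0≤x) 0≤u)) (0≤* (0≤ι 3) 0≤u)))
        where
        g₁ = (v + (k + 2ℚ) * u) - 1ℚ
        g₂ = (x * w + 1ℚ) * u - k * u
        g₃ = x * ½ * ((1ℚ + ι 11 * u) - ι 2 * (w * u))
        g₄ = (X - x) * ι 6 * u + ½ * x * u + ι 3 * u

      v≤T : λₖ + k ≤ l + 2ℚ → v ≤ T + C * u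
      v≤T λ≤ = ≤-by (g₁ + g₂ + g₃ + g₄)
        (solve 6 (λ x v k u w X →
            v :+ (((con 1ℚ :+ con 2ℚ :* u) :- (v :+ k :* u))
              :+ ((k :+ con 2ℚ) :* u :- x :* w :* u)
              :+ x :* con ½ :* ((con (ι 2) :* (w :* u) :+ con (ι 3) :* u) :- con 1ℚ)
              :+ ((X :- x) :* con (ι 6) :* u :+ con (ι 4 + ½) :* x :* u :+ con 2ℚ :* u))
            := (con 1ℚ :+ :- (x :* con ½)) :+ con (ι 6) :* (con 1ℚ :+ X) :* u) refl x v k u w X)
        (0≤+ (0≤+ (0≤+ (gap 1≥) (gap (*u ≤k))) (0≤* (0≤* 0≤x 0≤½) (gap wu-lo)))
          (0≤+ (0≤+ (0≤* (0≤* (gap x≤X) (0≤ι 6)) 0≤u) (0≤* (0≤* (ℚ.nonNegative⁻¹ (ι 4 + ½)) 0≤x) 0≤u)) (0≤*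
              (0≤+ 0≤1 0≤1) 0≤u)))
        where
        1≥ : v + k * u ≤ 1ℚ + 2ℚ * u
        1≥ = begin
          v + k * u        ≡⟨ cong (_+ k * u) v≡λu ⟩
          λₖ * u + k * u   ≡⟨ ℚ.*-distribʳ-+ u λₖ k ⟨
          (λₖ + k) * u     ≤⟨ *u λ≤ ⟩
          (l + 2ℚ) * u     ≡⟨ solve 2 (λ l u → (l :+ con 2ℚ) :* u := u :* l :+ con 2ℚ :* u) refl l u ⟩
          u * l + 2ℚ * u   ≡⟨ cong (_+ 2ℚ * u) ul≡1 ⟩
          1ℚ + 2ℚ * u      ∎
        g₁ = (1ℚ + 2ℚ * u) - (v + k * u)
        g₂ = (k + 2ℚ) * u - x * w * u
        g₃ = x * ½ * ((ι 2 * (w * u) + ι 3 * u) - 1ℚ)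
        g₄ = (X - x) * ι 6 * u + (ι 4 + ½) * x * u + 2ℚ * u

      v≤ : λₖ + k ≤ l + 2ℚ ⊎ λₖ ≡ 0ℚ → v ≤ (T ⊔ 0ℚ) + C * u
      v≤ (inj₁ λ≤)  = ℚ.≤-trans (v≤T λ≤) (ℚ.+-monoˡ-≤ (C * u) (ℚ.p≤p⊔q T 0ℚ))
      v≤ (inj₂ λ≡0) = ℚ.≤-trans (ℚ.≤-reflexive (trans v≡λu (trans (cong (_* u) λ≡0) (ℚ.*-zeroˡ u))))
        (0≤+ (ℚ.p≤q⊔p T 0ℚ) 0≤C*u)

    triangular-estimate : ∣ v - ((1ℚ + - (x * ½)) ⊔ 0ℚ) ∣ ≤ ι 6 * (1ℚ + X) * u
    triangular-estimate = abs≤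
      (≤-by _ (solve 3 (λ v t c → (v :- t) :+ ((t :+ c) :- v) := c) refl v (T ⊔ 0ℚ) (C * u)) (gap (v≤ λ-hi)))
      (≤-by _ (solve 3 (λ v t c → (:- (v :- t)) :+ ((v :+ c) :- t) := c) refl v (T ⊔ 0ℚ) (C * u))
        (gap (ℚ.⊔-lub T≤ (0≤+ 0≤v 0≤C*u))))

  -- Meant for `lo` = ⌈rn⌉ and `H` = ⌊√n⌋, when all new piles lie between `lo` and `lo` + 2`H`. The
  -- field `part-lo` is multiplied by r to avoid a division: the parts fall short of (1 - r)^i `lo`
  -- by at most 1/r.
  record ExponentialBounds (r : ℚ) (n : ℕ) (part : ℕ → ℕ) : Set where
    field
      lo H    : ℕ
      rn≤lo   : r * ι n ≤ ι lo
      lo≤rn+1 : ι lo ≤ r * ι n + 1ℚ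
      H²≤n    : H ℕ.* H ℕ.≤ n
      1≤H     : 1 ℕ.≤ H
      lo≤     : lo ℕ.≤ part 0
      ≤hi     : part 0 ℕ.≤ lo ℕ.+ (H ℕ.+ H)
      part-hi : ∀ i → ι (part i) ≤ pow (1ℚ - r) i * ι (lo ℕ.+ (H ℕ.+ H))
      part-lo : ∀ i → r * pow (1ℚ - r) i * ι lo ≤ r * ι (part i) + 1ℚ

  -- P stands for (1 - r)^k and η for the relative error allowed. The last two hypotheses say 1/r ≤
  -- η rn and 3√n ≤ η rn: the rounding loss and the spread of the new piles are small against λ₁ ≥
  -- rn.
  module _ {r n l lo H λₖ x v w X η δ P : ℚ} {k : ℚ}
    (0<r : 0ℚ < r) (0<l : 0ℚ < l) (0<n : 0ℚ < n) (0≤η : 0ℚ < η) (vl≡λ : v * l ≡ λₖ) (wl≡n : w * l ≡ n)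
    (0≤x : 0ℚ ≤ x) (x≤X : x ≤ X) (k≤ : k ≤ x * w + 1ℚ) (≤k : x * w ≤ k + 2ℚ)
    (rn≤lo : r * n ≤ lo) (lo≤rn+1 : lo ≤ r * n + 1ℚ) (H²≤n : H * H ≤ n) (1≤H : 1ℚ ≤ H) (lo≤l : lo ≤ l)
        (l≤hi : l ≤ lo + (H + H))
    (0≤P : 0ℚ ≤ P) (P≤1 : P ≤ 1ℚ) (λ-hi : λₖ ≤ P * (lo + (H + H))) (λ-lo : r * P * lo ≤ r * λₖ + 1ℚ)
    (1≤ηr²n : 1ℚ ≤ η * (r * r * n)) (9≤η²r²n : 3ℚ * 3ℚ ≤ η * η * (r * r * n)) where

    private
      0≤r = ℚ.<⇒≤ 0<r
      0≤n = ℚ.<⇒≤ 0<n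
      0≤l = ℚ.<⇒≤ 0<l
      0≤H = ℚ.≤-trans 0≤1 1≤H
      η≥0 = ℚ.<⇒≤ 0≤η
      rn≤l = ℚ.≤-trans rn≤lo lo≤l

      -- Compared through squares, (3H)² ≤ 9n ≤ (η rn)². The factor 3 covers the spread 2H and one
      -- more H ≥ 1 for the rounding of rn.
      3H≤ηl : 3ℚ * H ≤ η * l
      3H≤ηl = square-cancel-≤ (0≤* η≥0 0≤l) (begin
        3ℚ * H * (3ℚ * H)            ≡⟨ solve 2 (λ t H → t :* H :* (t :* H) := t :* t :* (H :* H)) refl 3ℚ H ⟩
        3ℚ * 3ℚ * (H * H)            ≤⟨ Rat.*-mono-nonNeg (ℚ.nonNegative⁻¹ (3ℚ * 3ℚ)) 0≤n 9≤η²r²n H²≤n ⟩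
        η * η * (r * r * n) * n      ≡⟨ solve 3 (λ η r n → η :* η :* (r :* r :* n) :* n := η :* (r :* n) :* (η :*
            (r :* n))) refl η r n ⟩
        η * (r * n) * (η * (r * n))  ≤⟨ Rat.*-mono-nonNeg (0≤* η≥0 (0≤* 0≤r 0≤n)) (0≤* η≥0 0≤l) ηrn≤ηl ηrn≤ηl ⟩
        η * l * (η * l)              ∎)
        where
        ηrn≤ηl : η * (r * n) ≤ η * l
        ηrn≤ηl = ℚ.*-monoˡ-≤-nonNeg η {{nonNegative η≥0}} rn≤l

      1≤ηrl : 1ℚ ≤ η * r * l
      1≤ηrl = begin
        1ℚ                   ≤⟨ 1≤ηr²n ⟩
        η * (r * r * n)      ≡⟨ solve 3 (λ η r n → η :* (r :* r :* n) := η :* r :* (r :* n)) refl η r n ⟩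
        η * r * (r * n)      ≤⟨ ℚ.*-monoˡ-≤-nonNeg (η * r) {{nonNegative (0≤* η≥0 0≤r)}} rn≤l ⟩
        η * r * l            ∎

      v≤ : v ≤ P + η
      v≤ = *-cancelʳ-≤ 0<l (begin
        v * l                ≡⟨ vl≡λ ⟩
        λₖ                   ≤⟨ λ-hi ⟩
        P * (lo + (H + H))   ≤⟨ ≤-by (P * (l - lo) + (H + (1ℚ - P) * (H + H)) + (η * l - 3ℚ * H))
                                  (solve 5 (λ P lo H l η → P :* (lo :+ (H :+ H)) :+ (P :* (l :- lo) :+ (H :+
                                      (con 1ℚ :- P) :* (H :+ H)) :+ (η :* l :- con 3ℚ :* H))
                                     := (P :+ η) :* l) refl P lo H l η)
                                  (0≤+ (0≤+ (0≤* 0≤P (gap lo≤l)) (0≤+ 0≤H (0≤* (gap P≤1) (0≤+ 0≤H 0≤H)))) (gap 3H≤ηl)) ⟩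
        (P + η) * l          ∎)

      P≤ : P ≤ v + (η + η)
      P≤ = *-cancelʳ-≤ (0<* 0<r 0<l) (begin
        P * (r * l)   ≤⟨ ≤-by (r * P * (lo + (H + H) - l) + r * (1ℚ - P) * (H + H) + r * H + r * (η * l - 3ℚ * H) +
            (r * λₖ + 1ℚ - r * P * lo) + (η * r * l - 1ℚ))
                           (solve 7 (λ P r lo H l η λₖ → P :* (r :* l) :+ (r :* P :* (lo :+ (H :+ H) :- l) :+ r :*
                               (con 1ℚ :- P) :* (H :+ H) :+ r :* H :+ r :* (η :* l :- con 3ℚ :* H)
                               :+ (r :* λₖ :+ con 1ℚ :- r :* P :* lo) :+ (η :* r :* l :- con 1ℚ))
                              := r :* λₖ :+ (η :+ η) :* (r :* l)) refl P r lo H l η λₖ)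
                           (0≤+ (0≤+ (0≤+ (0≤+ (0≤+ (0≤* (0≤* 0≤r 0≤P) (gap l≤hi)) (0≤* (0≤* 0≤r (gap P≤1))
                               (0≤+ 0≤H 0≤H)))
                             (0≤* 0≤r 0≤H)) (0≤* 0≤r (gap 3H≤ηl))) (gap λ-lo)) (gap 1≤ηrl)) ⟩
        r * λₖ + (η + η) * (r * l)        ≡⟨ cong (λ t → r * t + (η + η) * (r * l)) vl≡λ ⟨
        r * (v * l) + (η + η) * (r * l)   ≡⟨ solve 4 (λ r v l η →
            r :* (v :* l) :+ (η :+ η) :* (r :* l) := (v :+ (η :+ η)) :* (r :* l)) refl r v l η ⟩
        (v + (η + η)) * (r * l)           ∎)

      rw≤ : r * w ≤ 1ℚ + η
      rw≤ = *-cancelʳ-≤ 0<l (begin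
        r * w * l        ≡⟨ trans (ℚ.*-assoc r w l) (cong (r *_) wl≡n) ⟩
        r * n            ≤⟨ rn≤l ⟩
        l                ≤⟨ ≤-by (η * l) (solve 2 (λ l η → l :+ η :* l := (con 1ℚ :+ η) :* l) refl l η) (0≤* η≥0 0≤l) ⟩
        (1ℚ + η) * l     ∎)

      ≤rw : 1ℚ ≤ r * w + η
      ≤rw = *-cancelʳ-≤ 0<l (begin
        1ℚ * l           ≡⟨ ℚ.*-identityˡ l ⟩
        l                ≤⟨ ≤-by ((lo + (H + H) - l) + (r * n + 1ℚ - lo) + (H - 1ℚ) + (η * l - 3ℚ * H))
                              (solve 5 (λ l lo H rn ηl → l :+ ((lo :+ (H :+ H) :- l) :+ (rn :+ con 1ℚ :- lo) :+
                                  (H :- con 1ℚ) :+ (ηl :- con 3ℚ :* H))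
                                 := rn :+ ηl) refl l lo H (r * n) (η * l))
                              (0≤+ (0≤+ (0≤+ (gap l≤hi) (gap lo≤rn+1)) (gap 1≤H)) (gap 3H≤ηl)) ⟩
        r * n + η * l         ≡⟨ cong (λ t → r * t + η * l) wl≡n ⟨
        r * (w * l) + η * l   ≡⟨ solve 4 (λ r w l η → r :* (w :* l) :+ η :* l := (r :* w :+ η) :* l) refl r w l η ⟩
        (r * w + η) * l       ∎)

    shape-estimate : ∣ v - P ∣ ≤ η + η
    shape-estimate = abs≤
      (≤-by ((P + η - v) + η) (solve 3 (λ v P η → (v :- P) :+ ((P :+ η :- v) :+ η) := η :+ η) refl v P η) (0≤+
          (gap v≤) η≥0))
      (≤-by (v + (η + η) - P) (solve 3 (λ v P η → (:- (v :- P)) :+ (v :+ (η :+ η) :- P) := η :+ η) refl v P η) (gap P≤))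

    -- The index k is within 2 of x w, and r w = rn/l is within η of 1.
    time-estimate : X * η + 2ℚ * r ≤ δ → ∣ x - k * r ∣ ≤ δ
    time-estimate Xη+2r≤δ = abs≤
      (≤-by (r * (k + 2ℚ - x * w) + x * (r * w + η - 1ℚ) + (X - x) * η + (δ - (X * η + 2ℚ * r)))
        (solve 7 (λ x k r w X η δ → (x :- k :* r) :+ (r :* (k :+ con 2ℚ :- x :* w) :+ x :* (r :* w :+ η :- con 1ℚ) :+
            (X :- x) :* η :+ (δ :- (X :* η :+ con 2ℚ :* r)))
            := δ) refl x k r w X η δ)
        (0≤+ (0≤+ (0≤+ (0≤* 0≤r (gap ≤k)) (0≤* 0≤x (gap ≤rw))) (0≤* (gap x≤X) η≥0)) (gap Xη+2r≤δ)))
      (≤-by (r * (x * w + 1ℚ - k) + x * (1ℚ + η - r * w) + (X - x) * η + r + (δ - (X * η + 2ℚ * r)))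
        (solve 7 (λ x k r w X η δ → (:- (x :- k :* r)) :+ (r :* (x :* w :+ con 1ℚ :- k) :+ x :*
            (con 1ℚ :+ η :- r :* w) :+ (X :- x) :* η :+ r :+ (δ :- (X :* η :+ con 2ℚ :* r)))
            := δ) refl x k r w X η δ)
        (0≤+ (0≤+ (0≤+ (0≤+ (0≤* 0≤r (gap k≤)) (0≤* 0≤x (gap rw≤))) (0≤* (gap x≤X) η≥0)) 0≤r) (gap Xη+2r≤δ)))

-- From reals to rationals: approximants and slopes

module RealExtra where
  open import Data.Rational.Base hiding (NonZero; _/_)
  open ℚ.+-*-Solver using (solve; _:=_; con; _:+_; _:*_; :-_; _:-_)
  open ℚ.≤-Reasoning
  open D using (ℝ; seq; cauchy; fromℚ; fromℕ; 0ℝ; 1ℝ; ⌈_⌉≡_; ⌊_⌋≡_)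
    renaming (_<_ to _<ℝ_; _≤_ to _≤ℝ_; _*_ to _*ℝ_; _+_ to _+ℝ_)

  ⅛ : ℚ → ℚ
  ⅛ p = ½ * (½ * (½ * p))

  0<⅛ : ∀ {p} → 0ℚ < p → 0ℚ < ⅛ p
  0<⅛ 0<p = Rat.half-pos (Rat.half-pos (Rat.half-pos 0<p))

  dist-gap : ∀ p q {c} → Rat.dist p q < c → 0ℚ ≤ q + c - p
  dist-gap p q {c} d<c = gap (ℚ.<⇒≤ (Rat.dist⇒< {p} {q} {c} d<c))

  -- `x ≤ y` is a negation and gives no index by itself. The rational order at one late index
  -- decides: a failure by more than η/2 there would persist and prove y < x.
  ≤-eventually : ∀ x y {η} → x ≤ℝ y → 0ℚ < η → ∃[ I ] ∀ {i} → I ℕ.≤ i → seq x i ≤ seq y i + η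
  ≤-eventually x y {η} x≤y 0<η = go (cauchy x (0<⅛ 0<η)) (cauchy y (0<⅛ 0<η))
    where
    c = ⅛ η
    Near : ℝ → ℕ → Set
    Near x N = ∀ {m n} → N ℕ.≤ m → N ℕ.≤ n → Rat.dist (seq x m) (seq x n) < c
    go : ∃[ N ] Near x N → ∃[ N ] Near y N → ∃[ I ] ∀ {i} → I ℕ.≤ i → seq x i ≤ seq y i + η
    go (N₁ , cx) (N₂ , cy) with seq x (N₁ ℕ.⊔ N₂) ℚ.≤? seq y (N₁ ℕ.⊔ N₂) + ½ * η
    ... | yes le = N₁ ℕ.⊔ N₂ , λ {i} I≤i → ≤-by
      ((seq x I + c - seq x i) + (seq y I + ½ * η - seq x I) + (seq y i + c - seq y I) + ½ * (½ * η))
      (solve 5 (λ xi yi xI yI η → xi :+ ((xI :+ con ½ :* (con ½ :* (con ½ :* η)) :- xi) :+ (yI :+ con ½ :* η :- xI)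
          :+ (yi :+ con ½ :* (con ½ :* (con ½ :* η)) :- yI) :+ con ½ :* (con ½ :* η)) := yi :+ η)
        refl (seq x i) (seq y i) (seq x I) (seq y I) η)
      (0≤+ (0≤+ (0≤+ (dist-gap (seq x i) (seq x I) (cx (ℕ.m⊔n≤o⇒m≤o N₁ N₂ I≤i) (ℕ.m≤m⊔n N₁ N₂)))
        (gap le)) (dist-gap (seq y I) (seq y i) (cy (ℕ.m≤n⊔m N₁ N₂) (ℕ.m⊔n≤o⇒n≤o N₁ N₂ I≤i))))
        (ℚ.<⇒≤ (Rat.half-pos (Rat.half-pos 0<η))))
      where I = N₁ ℕ.⊔ N₂
    ... | no ≰ = contradiction (c , 0<⅛ 0<η , I , λ {i} I≤i → ≤-by
      ((seq x i + c - seq x I) + (seq x I - (seq y I + ½ * η)) + (seq y I + c - seq y i) + c)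
      (solve 5 (λ xi yi xI yI η → let c = con ½ :* (con ½ :* (con ½ :* η)) in
          yi :+ c :+ ((xi :+ c :- xI) :+ (xI :- (yI :+ con ½ :* η)) :+ (yI :+ c :- yi) :+ c) := xi)
        refl (seq x i) (seq y i) (seq x I) (seq y I) η)
      (0≤+ (0≤+ (0≤+ (dist-gap (seq x I) (seq x i) (cx (ℕ.m≤m⊔n N₁ N₂) (ℕ.m⊔n≤o⇒m≤o N₁ N₂ I≤i)))
        (gap (ℚ.<⇒≤ (ℚ.≰⇒> ≰)))) (dist-gap (seq y i) (seq y I) (cy (ℕ.m⊔n≤o⇒n≤o N₁ N₂ I≤i) (ℕ.m≤n⊔m N₁ N₂))))
        (ℚ.<⇒≤ (0<⅛ 0<η)))) x≤y
      where I = N₁ ℕ.⊔ N₂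

  <-eventually : ∀ x y → x <ℝ y → ∃[ I ] ∀ {i} → I ℕ.≤ i → seq x i ≤ seq y i
  <-eventually x y (δ , 0<δ , N , x+δ≤y) = N , λ {i} N≤i → ℚ.≤-trans
    (≤-by δ refl (ℚ.<⇒≤ 0<δ)) (x+δ≤y N≤i)

  below : ∀ {q} → 0ℝ <ℝ q → ∃[ r ] 0ℚ < r × fromℚ r <ℝ q × q <ℝ fromℚ (r + r)
  below {q} (δ , 0<δ , N , δ≤q) = go (cauchy q (0<⅛ 0<δ))
    where
    c = ⅛ δ
    0<c = 0<⅛ 0<δ
    go : ∃[ M ] (∀ {m n} → M ℕ.≤ m → M ℕ.≤ n → Rat.dist (seq q m) (seq q n) < c) →
         ∃[ r ] 0ℚ < r × fromℚ r <ℝ q × q <ℝ fromℚ (r + r)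
    go (M , cq) = r , 0<r , (c , 0<c , M , r+c≤q) , (c , 0<c , M , q+c≤2r)
      where
      i = N ℕ.⊔ M
      p = seq q i
      -- With p ≥ δ = 8c and q within c of p, this r stays below q by c, while 2r = 2p - 4c ≥ p + 4c
      -- exceeds q.
      r = p - (c + c)
      δ≤p : 0ℚ + δ ≤ p
      δ≤p = δ≤q (ℕ.m≤m⊔n N M)
      0<r : 0ℚ < r
      0<r = ℚ.<-≤-trans 0<c (≤-by ((p - (0ℚ + δ)) + ⅛ (δ + δ + δ + δ + δ))
        (solve 2 (λ p δ → let c = con ½ :* (con ½ :* (con ½ :* δ)) in
            c :+ ((p :- (con 0ℚ :+ δ)) :+ con ½ :* (con ½ :* (con ½ :* (δ :+ δ :+ δ :+ δ :+ δ)))) := p :-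
                (c :+ c)) refl p δ)
        (0≤+ (gap δ≤p) (ℚ.<⇒≤ (0<⅛ (0<+ (0<+ (0<+ (0<+ 0<δ 0≤δ) 0≤δ) 0≤δ) 0≤δ)))))
        where 0≤δ = ℚ.<⇒≤ 0<δ
      r+c≤q : ∀ {j} → M ℕ.≤ j → r + c ≤ seq q j
      r+c≤q {j} M≤j = ≤-by (seq q j + c - p) (solve 3 (λ q c p →
          p :- (c :+ c) :+ c :+ (q :+ c :- p) := q) refl (seq q j) c p)
        (dist-gap p (seq q j) (cq (ℕ.m≤n⊔m N M) M≤j))
      q+c≤2r : ∀ {j} → M ℕ.≤ j → seq q j + c ≤ r + r
      q+c≤2r {j} M≤j = ≤-by ((p + c - seq q j) + (p - (0ℚ + δ)) + (c + c))
        (solve 3 (λ q p δ → let c = con ½ :* (con ½ :* (con ½ :* δ)) in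
            q :+ c :+ ((p :+ c :- q) :+ (p :- (con 0ℚ :+ δ)) :+ (c :+ c)) := (p :- (c :+ c)) :+ (p :- (c :+ c))) refl
                (seq q j) p δ)
        (0≤+ (0≤+ (dist-gap (seq q j) p (cq M≤j (ℕ.m≤n⊔m N M))) (gap δ≤p)) (ℚ.<⇒≤ (0<+ 0<c (ℚ.<⇒≤ 0<c))))

  -- The half of the ceiling condition that lowering the slope could destroy. The other half, r h ≤
  -- k, passes from q to every smaller r.
  Fits : ℚ → ℕ → ℕ → Set
  Fits r h k = ι k < r * ι h + 1ℚ

  Fits-mono : ∀ {r r′ h k} → r ≤ r′ → Fits r h k → Fits r′ h k
  Fits-mono {h = h} r≤r′ fits = ℚ.<-≤-trans fits
    (ℚ.+-monoˡ-≤ 1ℚ (ℚ.*-monoʳ-≤-nonNeg (ι h) {{nonNegative (0≤ι h)}} r≤r′))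

  -- A strict inequality of reals carries a gap δ. Lowering the slope by e = δ/(1 + h) spends only e
  -- h of it and leaves e.
  tighten : ∀ {q h k} → fromℕ k <ℝ q *ℝ fromℕ h +ℝ 1ℝ → ∃[ r ] fromℚ r <ℝ q × Fits r h k
  tighten {q} {h} {k} (δ , 0<δ , N , k+δ≤) = go (divide {d = 1ℚ + ι h} 0<δ (0<+ 0<1 (0≤ι h)))
    where
    go : ∃[ e ] 0ℚ < e × e * (1ℚ + ι h) ≡ δ → ∃[ r ] fromℚ r <ℝ q × Fits r h k
    go (e , 0<e , e≡) = withApprox (cauchy q (Rat.half-pos 0<e))
      where
      withApprox : ∃[ M ] (∀ {m n} → M ℕ.≤ m → M ℕ.≤ n → Rat.dist (seq q m) (seq q n) < ½ * e) →
          ∃[ r ] fromℚ r <ℝ q × Fits r h k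
      withApprox (M , cq) = r , (½ * e , Rat.half-pos 0<e , M , r+e/2≤q) , fits
        where
        i = N ℕ.⊔ M
        p = seq q i
        r = p - e
        r+e/2≤q : ∀ {j} → M ℕ.≤ j → r + ½ * e ≤ seq q j
        r+e/2≤q {j} M≤j = ≤-by (seq q j + ½ * e - p)
          (solve 3 (λ q e p → p :- e :+ con ½ :* e :+ (q :+ con ½ :* e :- p) := q) refl (seq q j) e p)
          (dist-gap p (seq q j) (cq (ℕ.m≤n⊔m N M) M≤j))
        fits : Fits r h k
        fits = begin-strict
          ι k                   ≡⟨ ℚ.+-identityʳ (ι k) ⟨
          ι k + 0ℚ              <⟨ ℚ.+-monoʳ-< (ι k) 0<e ⟩
          ι k + e               ≡⟨ solve 3 (λ k e h → k :+ e := k :+ e :* (con 1ℚ :+ h) :- e :* h) refl (ι k) e (ι h) ⟩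
          ι k + e * (1ℚ + ι h) - e * ι h   ≡⟨ cong (λ d → ι k + d - e * ι h) e≡ ⟩
          ι k + δ - e * ι h     ≤⟨ ℚ.+-monoˡ-≤ (- (e * ι h)) (k+δ≤ (ℕ.m≤m⊔n N M)) ⟩
          p * ι h + 1ℚ - e * ι h  ≡⟨ solve 3 (λ p h e → p :* h :+ con 1ℚ :- e :* h := (p :- e) :* h :+ con 1ℚ) refl p
              (ι h) e ⟩
          r * ι h + 1ℚ          ∎

  ⊔-<ℝ : ∀ {q} p r → fromℚ p <ℝ q → fromℚ r <ℝ q → fromℚ (p ⊔ r) <ℝ q
  ⊔-<ℝ {q} p r p<q r<q with ℚ.⊔-sel p r
  ... | inj₁ eq = subst (λ s → fromℚ s <ℝ q) (sym eq) p<q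
  ... | inj₂ eq = subst (λ s → fromℚ s <ℝ q) (sym eq) r<q

  FitAll : ℚ → List ℕ → List ℕ → Set
  FitAll r = Pointwise (Fits r)

  FitAll-mono : ∀ r r′ → r ≤ r′ → ∀ {hs ks} → FitAll r hs ks → FitAll r′ hs ks
  FitAll-mono r r′ r≤r′ []                    = []
  FitAll-mono r r′ r≤r′ (_∷_ {h} {k} fits fs) = Fits-mono {r} {r′} {h} {k} r≤r′ fits ∷ FitAll-mono r r′ r≤r′ fs

  Picks : ℝ → List ℕ → List ℕ → Set
  Picks q = Pointwise (λ h k → ⌈ q *ℝ fromℕ h ⌉≡ k)

  -- `Fits` survives an increase of the slope, so the maximum of finitely many admissible slopes
  -- below q serves all piles at once.
  tightenList : ∀ q r {hs ks} → fromℚ r <ℝ q → Picks q hs ks → ∃[ r′ ] r ≤ r′ × fromℚ r′ <ℝ q × FitAll r′ hs ks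
  tightenList q r r<q []                 = r , ℚ.≤-refl , r<q , []
  tightenList q r r<q (_∷_ {h} {k} c cs) = join (tighten {q} {h} {k} (proj₂ c)) (tightenList q r r<q cs)
    where
    join : ∀ {hs ks} → ∃[ r₁ ] fromℚ r₁ <ℝ q × Fits r₁ h k → ∃[ r₂ ] r ≤ r₂ × fromℚ r₂ <ℝ q × FitAll r₂ hs ks →
      ∃[ r′ ] r ≤ r′ × fromℚ r′ <ℝ q × FitAll r′ (h ∷ hs) (k ∷ ks)
    join (r₁ , r₁<q , fits) (r₂ , r≤r₂ , r₂<q , fs) = r₁ ⊔ r₂ , ℚ.≤-trans r≤r₂ (ℚ.p≤q⊔p r₁ r₂) , ⊔-<ℝ
        {q} r₁ r₂ r₁<q r₂<q ,
      Fits-mono {r₁} {r₁ ⊔ r₂} {h} {k} (ℚ.p≤p⊔q r₁ r₂) fits ∷ FitAll-mono r₂ (r₁ ⊔ r₂) (ℚ.p≤q⊔p r₁ r₂) fs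

  tightenLists : ∀ q r (hs ks : ℕ → List ℕ) → fromℚ r <ℝ q → (∀ t → Picks q (hs t) (ks t)) → ∀ K →
    ∃[ r′ ] r ≤ r′ × fromℚ r′ <ℝ q × (∀ {t} → t ℕ.< K → FitAll r′ (hs t) (ks t))
  tightenLists q r hs ks r<q c zero    = r , ℚ.≤-refl , r<q , λ ()
  tightenLists q r hs ks r<q c (suc K) = extend (tightenLists q r hs ks r<q c K)
    where
    Result : ℕ → Set
    Result K = ∃[ r′ ] r ≤ r′ × fromℚ r′ <ℝ q × (∀ {t} → t ℕ.< K → FitAll r′ (hs t) (ks t))
    extend : Result K → Result (suc K)
    extend (r₁ , r≤r₁ , r₁<q , fits) = join (tightenList q r₁ r₁<q (c K))
      where
      join : ∃[ r₂ ] r₁ ≤ r₂ × fromℚ r₂ <ℝ q × FitAll r₂ (hs K) (ks K) → Result (suc K)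
      join (r₂ , r₁≤r₂ , r₂<q , fitsK) = r₂ , ℚ.≤-trans r≤r₁ r₁≤r₂ , r₂<q , λ {t} t<1+K →
          split t (ℕ.m≤n⇒m<n∨m≡n (ℕ.s≤s⁻¹ t<1+K))
        where
        split : ∀ t → t ℕ.< K ⊎ t ≡ K → FitAll r₂ (hs t) (ks t)
        split t (inj₁ t<K)  = FitAll-mono r₁ r₂ r₁≤r₂ (fits t<K)
        split t (inj₂ refl) = fitsK

  pick-≥ : ∀ {q r h k} → fromℚ r <ℝ q → q *ℝ fromℕ h ≤ℝ fromℕ k → r * ι h ≤ ι k
  pick-≥ {q} {r} {h} {k} r<q qh≤k = ℚ.≮⇒≥ λ k<rh → qh≤k (r * ι h - ι k , 0<gap k<rh , proj₁ ev , λ {i} I≤i → begin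
    ι k + (r * ι h - ι k)  ≡⟨ solve 2 (λ k s → k :+ (s :- k) := s) refl (ι k) (r * ι h) ⟩
    r * ι h                ≤⟨ ℚ.*-monoʳ-≤-nonNeg (ι h) {{nonNegative (0≤ι h)}} (proj₂ ev I≤i) ⟩
    seq q i * ι h          ∎)
    where
    ev = <-eventually (fromℚ r) q r<q
    0<gap : ι k < r * ι h → 0ℚ < r * ι h - ι k
    0<gap lt = subst (_< r * ι h - ι k) (ℚ.+-inverseʳ (ι k)) (ℚ.+-monoˡ-< (- ι k) lt)

  fromℚ-≤ : ∀ {q r p} → fromℚ r <ℝ q → q ≤ℝ fromℚ p → r ≤ p
  fromℚ-≤ {q} {r} {p} r<q q≤p = ℚ.≮⇒≥ λ p<r → q≤p (r - p , subst (_< r - p) (ℚ.+-inverseʳ p) (ℚ.+-monoˡ-< (- p) p<r) ,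
    proj₁ ev , λ {i} I≤i → ℚ.≤-trans (ℚ.≤-reflexive (solve 2 (λ p r → p :+ (r :- p) := r) refl p r)) (proj₂ ev I≤i))
    where ev = <-eventually (fromℚ r) q r<q

-- Integer ceilings and square roots

module _ where
  open ℕ.≤-Reasoning

  ∃-ceiling : ∀ a b → ∃[ σ ] (∀ h → a ℕ.* h ℕ.≤ suc b ℕ.* σ h) × (∀ h → suc b ℕ.* σ h ℕ.< a ℕ.* h ℕ.+ suc b)
  ∃-ceiling a b = (λ h → (a ℕ.* h ℕ.+ b) ℕ./ suc b) ,
    (λ h → ℕ.+-cancelʳ-≤ b _ _ (begin
      a ℕ.* h ℕ.+ b                                                ≡⟨ ℕ.m≡m%n+[m/n]*n (a ℕ.* h ℕ.+ b) (suc b) ⟩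
      (a ℕ.* h ℕ.+ b) ℕ.% suc b ℕ.+ (a ℕ.* h ℕ.+ b) ℕ./ suc b ℕ.* suc b  ≤⟨ ℕ.+-monoˡ-≤ _ (ℕ.s≤s⁻¹ (ℕ.m%n<n
          (a ℕ.* h ℕ.+ b) (suc b))) ⟩
      b ℕ.+ (a ℕ.* h ℕ.+ b) ℕ./ suc b ℕ.* suc b                      ≡⟨ ℕ.+-comm b _ ⟩
      (a ℕ.* h ℕ.+ b) ℕ./ suc b ℕ.* suc b ℕ.+ b                      ≡⟨ cong (ℕ._+ b) (ℕ.*-comm
          ((a ℕ.* h ℕ.+ b) ℕ./ suc b) (suc b)) ⟩
      suc b ℕ.* ((a ℕ.* h ℕ.+ b) ℕ./ suc b) ℕ.+ b                    ∎)) ,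
    (λ h → begin-strict
      suc b ℕ.* ((a ℕ.* h ℕ.+ b) ℕ./ suc b)   ≡⟨ ℕ.*-comm (suc b) _ ⟩
      (a ℕ.* h ℕ.+ b) ℕ./ suc b ℕ.* suc b     ≤⟨ ℕ.m/n*n≤m (a ℕ.* h ℕ.+ b) (suc b) ⟩
      a ℕ.* h ℕ.+ b                         <⟨ ℕ.+-monoʳ-< (a ℕ.* h) (ℕ.n<1+n b) ⟩
      a ℕ.* h ℕ.+ suc b                     ∎)

  √-floor : ∀ n → ∃[ H ] H ℕ.* H ℕ.≤ n × n ℕ.< suc H ℕ.* suc H
  √-floor zero    = 0 , ℕ.z≤n , ℕ.s≤s ℕ.z≤n
  √-floor (suc n) with √-floor n
  ... | H , H²≤n , n<H⁺² with suc H ℕ.* suc H ℕ.≤? suc n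
  ... | no  ≰ = H , ℕ.m≤n⇒m≤1+n H²≤n , ℕ.≰⇒> ≰
  ... | yes ≤ = suc H , ≤ , ℕ.≤-<-trans n<H⁺² (ℕ.*-mono-< (ℕ.n<1+n (suc H)) (ℕ.n<1+n (suc H)))

fraction : ∀ {r} → 0ℚ ℚ.< r → ∃[ a ] ∃[ b ] r ℚ.* ι (suc b) ≡ ι a
fraction {r@(mkℚ (+ a) b _)} 0<r = a , b , trans (cong (ℚ._* ι (suc b)) (sym (ℚ.↥p/↧p≡p r))) (/≡ι* a (suc b))
fraction {mkℚ -[1+ a ] b _} (ℚ.*<* ())

-- All bounds for an orbit with rational slope

module _ where
  open import Data.Rational.Base hiding (NonZero; _/_)
  open ℚ.+-*-Solver using (solve; _:=_; con; _:+_; _:*_; :-_; _:-_)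

  upperNew : ∀ {r n part} → ExponentialBounds r n part → ℕ
  upperNew E = ExponentialBounds.lo E ℕ.+ (ExponentialBounds.H E ℕ.+ ExponentialBounds.H E)

  -- Serves both regimes. The premise of the staircase bounds says that r h ≤ 1 for the largest
  -- possible new pile h, so that each nonempty pile gives a single card.
  Bounds : ℚ → ℕ → (ℕ → ℕ) → Set
  Bounds r n part = Σ (ExponentialBounds r n part) λ E → r * ι (upperNew E) ≤ 1ℚ → TriangularBounds n part

  module Fraction (r : ℚ) (a b : ℕ) (rb≡a : r * ι (suc b) ≡ ι a) (σ : ℕ → ℕ)
    (lower : ∀ h → a ℕ.* h ℕ.≤ suc b ℕ.* σ h) (upper : ∀ h → suc b ℕ.* σ h ℕ.< a ℕ.* h ℕ.+ suc b)
    (0<r : 0ℚ < r) (r≤1 : r ≤ 1ℚ) where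
    open ℚ.≤-Reasoning

    0<b : 0ℚ < ι (suc b)
    0<b = ι-mono-< {0} {suc b} (ℕ.s≤s ℕ.z≤n)

    ιah≡ : ∀ h → ι (a ℕ.* h) ≡ r * ι h * ι (suc b)
    ιah≡ h = trans (ι-* a h) (trans (cong (_* ι h) (sym rb≡a))
      (solve 3 (λ r b h → r :* b :* h := r :* h :* b) refl r (ι (suc b)) (ι h)))

    ιbk≡ : ∀ k → ι (suc b ℕ.* k) ≡ ι k * ι (suc b)
    ιbk≡ k = trans (ι-* (suc b) k) (ℚ.*-comm (ι (suc b)) (ι k))

    ιah+b≡ : ∀ h → ι (a ℕ.* h ℕ.+ suc b) ≡ (r * ι h + 1ℚ) * ι (suc b)
    ιah+b≡ h = trans (ι-+ (a ℕ.* h) (suc b)) (trans (cong (_+ ι (suc b)) (ιah≡ h))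
      (solve 2 (λ s b → s :* b :+ b := (s :+ con 1ℚ) :* b) refl (r * ι h) (ι (suc b))))

    lowerᵣ : ∀ h → r * ι h ≤ ι (σ h)
    lowerᵣ h = *-cancelʳ-≤ {r * ι h} {ι (σ h)} 0<b (subst₂ _≤_ (ιah≡ h) (ιbk≡ (σ h)) (ι-mono-≤ (lower h)))

    upperᵣ : ∀ h → ι (σ h) ≤ r * ι h + 1ℚ
    upperᵣ h = *-cancelʳ-≤ {ι (σ h)} {r * ι h + 1ℚ} 0<b
      (subst₂ _≤_ (ιbk≡ (σ h)) (ιah+b≡ h) (ι-mono-≤ (ℕ.<⇒≤ (upper h))))

    a*≤b : ∀ {h} → r * ι h ≤ 1ℚ → a ℕ.* h ℕ.≤ suc b
    a*≤b {h} rh≤1 = ι-cancel-≤ (subst₂ _≤_ (sym (ιah≡ h)) (ℚ.*-identityˡ (ι (suc b)))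
      (ℚ.*-monoʳ-≤-nonNeg (ι (suc b)) {{nonNegative (ℚ.<⇒≤ 0<b)}} rh≤1))

    0<a : 0 ℕ.< a
    0<a = ι-cancel-< {0} {a} (subst (0ℚ <_) rb≡a (0<* 0<r 0<b))

    a≤b : a ℕ.≤ suc b
    a≤b = subst (ℕ._≤ suc b) (ℕ.*-identityʳ a) (a*≤b (subst (_≤ 1ℚ) (sym (ℚ.*-identityʳ r)) r≤1))

    open Solitaire a (suc b) σ lower upper 0<a a≤b public

    pick-unique : ∀ {h k} → r * ι h ≤ ι k → RealExtra.Fits r h k → k ≡ σ h
    pick-unique {h} {k} rh≤k fits = ℕ.≤-antisym
      (b*-cancel (ℕ.<-≤-trans (ι-cancel-< (subst₂ _<_ (sym (ιbk≡ k)) (sym (ιah+b≡ h))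
        (ℚ.*-monoˡ-<-pos (ι (suc b)) {{positive 0<b}} fits))) (ℕ.+-monoˡ-≤ (suc b) (lower h))))
      (b*-cancel (ℕ.<-≤-trans (upper h) (ℕ.+-monoˡ-≤ (suc b) (ι-cancel-≤ (subst₂ _≤_ (sym (ιah≡ h)) (sym (ιbk≡ k))
        (ℚ.*-monoʳ-≤-nonNeg (ι (suc b)) {{nonNegative (ℚ.<⇒≤ 0<b)}} rh≤k))))))

    ι-rest : ∀ h → ι (rest h) + ι (σ h) ≡ ι h
    ι-rest h = trans (sym (ι-+ (rest h) (σ h))) (cong ι (ℕ.m∸n+n≡m (σ≤ h)))

    0≤1-r : 0ℚ ≤ 1ℚ - r
    0≤1-r = gap r≤1

    restⁱ-hi : ∀ i h → ι (restⁱ i h) ≤ pow (1ℚ - r) i * ι h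
    restⁱ-hi zero    h = ℚ.≤-reflexive (sym (ℚ.*-identityˡ (ι h)))
    restⁱ-hi (suc i) h = begin
      ι (rest m)                          ≤⟨ ≤-by (ι (σ m) - r * ι m) (trans (sym (ℚ.+-assoc (ι (rest m)) (ι (σ m)) (-
          (r * ι m))))
                                               (trans (cong (_- r * ι m) (ι-rest m))
                                                 (solve 2 (λ m r → m :- r :* m := (con 1ℚ :- r) :* m) refl (ι m) r)))
                                               (gap (lowerᵣ m)) ⟩
      (1ℚ - r) * ι m                      ≤⟨ ℚ.*-monoˡ-≤-nonNeg (1ℚ - r) {{nonNegative 0≤1-r}} (restⁱ-hi i h) ⟩
      (1ℚ - r) * (pow (1ℚ - r) i * ι h)   ≡⟨ ℚ.*-assoc (1ℚ - r) (pow (1ℚ - r) i) (ι h) ⟨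
      (1ℚ - r) * pow (1ℚ - r) i * ι h     ∎
      where m = restⁱ i h

    -- The rounding errors add up to at most Σⱼ (1−r)ʲ ≤ 1/r.
    restⁱ-lo : ∀ i h → r * pow (1ℚ - r) i * ι h + pow (1ℚ - r) i ≤ r * ι (restⁱ i h) + 1ℚ
    restⁱ-lo zero    h = ℚ.≤-reflexive (cong (λ s → s * ι h + 1ℚ) (ℚ.*-identityʳ r))
    restⁱ-lo (suc i) h = begin
      r * ((1ℚ - r) * p) * ι h + (1ℚ - r) * p   ≡⟨ solve 3 (λ r p h →
          r :* ((con 1ℚ :- r) :* p) :* h :+ (con 1ℚ :- r) :* p
                                                     := (con 1ℚ :- r) :* (r :* p :* h :+ p)) refl r p (ι h) ⟩
      (1ℚ - r) * (r * p * ι h + p)              ≤⟨ ℚ.*-monoˡ-≤-nonNeg (1ℚ - r) {{nonNegative 0≤1-r}} (restⁱ-lo i h) ⟩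
      (1ℚ - r) * (r * ι m + 1ℚ)                 ≤⟨ ≤-by (r * (r * ι m + 1ℚ - ι (σ m)))
                                                     (trans (solve 3 (λ r m s →
                                                         (con 1ℚ :- r) :* (r :* m :+ con 1ℚ) :+ r :*
                                                         (r :* m :+ con 1ℚ :- s)
                                                        := r :* (m :- s) :+ con 1ℚ) refl r (ι m) (ι (σ m)))
                                                      (cong (λ t → r * t + 1ℚ) (trans (cong (_- ι (σ m)) (sym
                                                          (ι-rest m)))
                                                        (solve 2 (λ a s → a :+ s :- s := a) refl (ι (rest m)) (ι
                                                            (σ m))))))
                                                     (0≤* (ℚ.<⇒≤ 0<r) (gap (upperᵣ m))) ⟩
      r * ι (rest m) + 1ℚ                       ∎
      where
      p = pow (1ℚ - r) i
      m = restⁱ i h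

    module OrbitBounds (n k : ℕ) (xs : ℕ → List ℕ)
      (total : ∀ t → sum (xs t) ≡ n)
      (sorted : ∀ t → Linked ℕ._≥_ (xs t))
      (period : ∀ t → xs (suc k ℕ.+ t) ≡ xs t)
      (step : ∀ t → xs (suc t) ↭
        filter ℕ.nonZero? (sum (map σ (xs t)) ∷ zipWith ℕ._∸_ (xs t) (map σ (xs t))))
      (1≤n : 1 ℕ.≤ n) (1≤l : 1 ℕ.≤ nth₀ (xs 0) 0) where
      open Orbit n k xs total sorted period step

      part : ℕ → ℕ
      part = nth₀ (xs 0)

      H : ℕ
      H = proj₁ (√-floor n)
      n<H⁺² : n ℕ.< suc H ℕ.* suc H
      n<H⁺² = proj₂ (proj₂ (√-floor n))

      1≤H : 1 ℕ.≤ H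
      1≤H = ℕ.n≢0⇒n>0 λ H≡0 → ℕ.<⇒≱ n<H⁺² (subst (λ H → suc H ℕ.* suc H ℕ.≤ n) (sym H≡0) 1≤n)

      exponentialBounds : ExponentialBounds r n part
      exponentialBounds = record
        { lo = σ n ; H = H
        ; rn≤lo = lowerᵣ n ; lo≤rn+1 = upperᵣ n
        ; H²≤n = proj₁ (proj₂ (√-floor n)) ; 1≤H = 1≤H
        ; lo≤ = ≤part σn≤new 0 0
        ; ≤hi = part≤ (new≤ H n<H⁺²) 0 0
        ; part-hi = λ i → ℚ.≤-trans (ι-mono-≤ (part≤ (new≤ H n<H⁺²) 0 i)) (restⁱ-hi i (σ n ℕ.+ (H ℕ.+ H)))
        ; part-lo = λ i → begin
            r * pow (1ℚ - r) i * ι (σ n)                      ≤⟨ ≤-by (pow (1ℚ - r) i) refl (pow-nonNeg 0≤1-r i) ⟩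
            r * pow (1ℚ - r) i * ι (σ n) + pow (1ℚ - r) i     ≤⟨ restⁱ-lo i (σ n) ⟩
            r * ι (restⁱ i (σ n)) + 1ℚ                        ≤⟨ ℚ.+-monoˡ-≤ 1ℚ (ℚ.*-monoˡ-≤-nonNeg r {{nonNegative
                (ℚ.<⇒≤ 0<r)}}
                                                                   (ι-mono-≤ (≤part σn≤new 0 i))) ⟩
            r * ι (part i) + 1ℚ                               ∎
        }

      bounds : Bounds r n part
      bounds = exponentialBounds , λ small →
        Bulgarian.triangularBounds (σ n ℕ.+ (H ℕ.+ H)) (new≤ H n<H⁺²) (a*≤b small) 0 1≤l

-- Recurrent configurations of the real game

module _ where
  open import Data.Rational.Base hiding (NonZero; _/_)
  open D using (ℝ; seq; fromℚ; fromℕ; 0ℝ; 1ℝ; Partition; parts; part; IsMoveMap; Recurrent; largest-nonZero)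
    renaming (_<_ to _<ℝ_; _≤_ to _≤ℝ_; _*_ to _*ℝ_; _+_ to _+ℝ_)
  open RealExtra

  partition-sorted : ∀ {n} (μ : Partition n) → Linked ℕ._≥_ (parts μ)
  partition-sorted (D.mkPartition hs s _ _) = recompute (linked? ℕ._≥?_ hs) s

  partition-total : ∀ {n} (μ : Partition n) → sum (parts μ) ≡ n
  partition-total {n} (D.mkPartition hs _ _ t) = recompute (sum hs ℕ.≟ n) t

  fold-period : ∀ {A : Set} (f : A → A) x k → fold x f k ≡ x → ∀ t → fold x f (k ℕ.+ t) ≡ fold x f t
  fold-period f x k eq zero    = trans (cong (fold x f) (ℕ.+-identityʳ k)) eq
  fold-period f x k eq (suc t) = trans (cong (fold x f) (ℕ.+-suc k t)) (cong f (fold-period f x k eq t))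

  -- Only the piles met during one period matter, so q can be replaced by a slightly smaller rational.
  rational-slope : ∀ {n} .{{_ : NonZero n}} (q : ℝ) (f : Partition n → Partition n) → 0ℝ <ℝ q → q ≤ℝ 1ℝ →
      IsMoveMap q f →
    ∀ μ → Recurrent f μ → ∃[ r ] 0ℚ < r × fromℚ r <ℝ q × q <ℝ fromℚ (r + r) × Bounds r n (part μ)
  rational-slope {n} q f 0<q q≤1 move μ (suc k , _ , returns) = go (below {q} 0<q)
    where
    orbit : ℕ → Partition n
    orbit = fold μ f
    xs ks : ℕ → List ℕ
    xs t = parts (orbit t)
    ks t = proj₁ (move (orbit t))
    Goal : Set
    Goal = ∃[ r ] 0ℚ < r × fromℚ r <ℝ q × q <ℝ fromℚ (r + r) × Bounds r n (part μ)
    period : ∀ t → orbit (suc k ℕ.+ t) ≡ orbit t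
    period = fold-period f μ (suc k) returns
    -- The slope r is adapted to the piles of one period; any other time is referred back to it.
    representative : ∀ t → ∃[ s ] s ℕ.< suc k × orbit t ≡ orbit s
    representative zero    = 0 , ℕ.s≤s ℕ.z≤n , refl
    representative (suc t) with representative t
    ... | s , s<K , eq with ℕ.m≤n⇒m<n∨m≡n s<K
    ... | inj₁ 1+s<K = suc s , 1+s<K , cong f eq
    ... | inj₂ 1+s≡K = 0 , ℕ.s≤s ℕ.z≤n , trans (cong f eq) (trans (cong orbit 1+s≡K) returns)
    go : ∃[ r ] 0ℚ < r × fromℚ r <ℝ q × q <ℝ fromℚ (r + r) → Goal
    go (r₀ , 0<r₀ , r₀<q , (δ , 0<δ , N , q+δ≤2r₀)) =
      withApprox (tightenLists q r₀ xs ks r₀<q (λ t → proj₁ (proj₂ (move (orbit t)))) (suc k))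
      where
      withApprox : ∃[ r ] r₀ ≤ r × fromℚ r <ℝ q × (∀ {t} → t ℕ.< suc k → FitAll r (xs t) (ks t)) → Goal
      withApprox (r , r₀≤r , r<q , fits) = withFraction (fraction 0<r)
        where
        0<r : 0ℚ < r
        0<r = ℚ.<-≤-trans 0<r₀ r₀≤r
        q<2r : q <ℝ fromℚ (r + r)
        q<2r = δ , 0<δ , N , λ {i} N≤i → ℚ.≤-trans (q+δ≤2r₀ {i} N≤i) (ℚ.+-mono-≤ r₀≤r r₀≤r)
        withFraction : ∃[ a ] ∃[ b ] r * ι (suc b) ≡ ι a → Goal
        withFraction (a , b , rb≡a) = withCeiling (∃-ceiling a b)
          where
          withCeiling : ∃[ σ ] (∀ h → a ℕ.* h ℕ.≤ suc b ℕ.* σ h) × (∀ h → suc b ℕ.* σ h ℕ.< a ℕ.* h ℕ.+ suc b) → Goal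
          withCeiling (σ , lower , upper) = r , 0<r , r<q , q<2r , OB.bounds
            where
            module F = Fraction r a b rb≡a σ lower upper 0<r (fromℚ-≤ {q} {r} {1ℚ} r<q q≤1)
            picks≡ : ∀ {hs ks} → Picks q hs ks → FitAll r hs ks → ks ≡ map σ hs
            picks≡ []                 []       = refl
            picks≡ (_∷_ {h} {k} c cs) (f ∷ fs) = cong₂ _∷_ (F.pick-unique (pick-≥ {q} {r} {h} {k} r<q (proj₁ c)) f)
                (picks≡ cs fs)
            Step : Partition n → Set
            Step ν = parts (f ν) ↭ filter ℕ.nonZero? (sum (map σ (parts ν)) ∷ zipWith ℕ._∸_ (parts ν) (map σ (parts ν)))
            step : ∀ t → Step (orbit t)
            step t with representative t
            ... | s , s<K , eq = subst Step (sym eq)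
                (subst (λ ps → xs (suc s) ↭ filter ℕ.nonZero? (sum ps ∷ zipWith ℕ._∸_ (xs s) ps))
                  (picks≡ (proj₁ (proj₂ (move (orbit s)))) (fits s<K)) (proj₂ (proj₂ (move (orbit s)))))
            instance _ = largest-nonZero μ
            module OB = F.OrbitBounds n k xs (λ t → partition-total (orbit t)) (λ t → partition-sorted (orbit t))
              (λ t → cong parts (period t)) step (ℕ.>-nonZero⁻¹ n) (ℕ.>-nonZero⁻¹ (part μ 0))

-- From estimates to limit shapes

module Limits where
  open import Data.Rational.Base hiding (NonZero)
  open ℚ.+-*-Solver using (solve; _:=_; con; _:+_; _:*_; :-_; _:-_)
  open ℚ.≤-Reasoning
  open D using (ℝ; seq; fromℚ; fromℕ; 0ℝ; 1ℝ; _⟶_; _⟶∞; Partition; part; largest-nonZero; ∂[_]_≡_;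
      Recurrent; IsMoveMap; IsLimitShape; triangular; exponential; bounded; expSum)
    renaming (_<_ to _<ℝ_; _≤_ to _≤ℝ_; _*_ to _*ℝ_; -_ to -ℝ_)
  open RealExtra using (≤-eventually; <-eventually)

  -- The order on reals demands a uniform gap. With δ the gap in 0 < ε, closeness to δ/2 leaves the
  -- other half as the gap required.
  ⟶-intro : ∀ (y : ℕ → ℝ) L → (∀ {ε} → 0ℚ < ε → ∃[ N ] ∀ n → N ℕ.≤ n → ∃[ I ] ∀ {i} → I ℕ.≤ i →
      ∣ seq (y n) i - seq L i ∣ ≤ ε) →
    y ⟶ L
  ⟶-intro y L close ε (δ , 0<δ , M , δ≤ε) = go (close (Rat.half-pos 0<δ))
    where
    go : ∃[ N ] (∀ n → N ℕ.≤ n → ∃[ I ] ∀ {i} → I ℕ.≤ i → ∣ seq (y n) i - seq L i ∣ ≤ ½ * δ) → ∃[ N ] ∀ n → N ℕ.≤ n →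
        D.∣ y n D.- L ∣ <ℝ ε
    go (N , f) = N , λ n N≤n → ½ * δ , Rat.half-pos 0<δ , proj₁ (f n N≤n) ℕ.⊔ M , λ {i} I≤i →
      let d  = seq (y n) i - seq L i
          le = proj₂ (f n N≤n) (ℕ.m⊔n≤o⇒m≤o (proj₁ (f n N≤n)) M I≤i)
      in begin
        (d ⊔ - d) + ½ * δ   ≤⟨ ℚ.+-monoˡ-≤ (½ * δ) (ℚ.⊔-lub (ℚ.≤-trans (Rat.p≤∣p∣ d) le) (ℚ.≤-trans (-p≤∣p∣ d) le)) ⟩
        ½ * δ + ½ * δ       ≡⟨ Rat.half+half δ ⟩
        δ                   ≡⟨ ℚ.+-identityˡ δ ⟨
        0ℚ + δ              ≤⟨ δ≤ε (ℕ.m⊔n≤o⇒n≤o (proj₁ (f n N≤n)) M I≤i) ⟩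
        seq ε i             ∎

  ⟶0-elim : ∀ (u : ℕ → ℝ) → u ⟶ 0ℝ → ∀ {ε} → 0ℚ < ε → ∃[ N ] ∀ n → N ℕ.≤ n → ∃[ I ] ∀ {i} → I ℕ.≤ i → seq (u n) i ≤ ε
  ⟶0-elim u u→0 {ε} 0<ε = go (u→0 (fromℚ ε) (ε , 0<ε , 0 , λ _ → ℚ.≤-reflexive (ℚ.+-identityˡ ε)))
    where
    go : ∃[ N ] (∀ n → N ℕ.≤ n → D.∣ u n D.- 0ℝ ∣ <ℝ fromℚ ε) → ∃[ N ] ∀ n → N ℕ.≤ n → ∃[ I ] ∀ {i} → I ℕ.≤ i →
        seq (u n) i ≤ ε
    go (N , f) = N , λ n N≤n → let I , le = <-eventually D.∣ u n D.- 0ℝ ∣ (fromℚ ε) (f n N≤n) in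
      I , λ {i} I≤i → ℚ.≤-trans (ℚ.≤-reflexive (solve 1 (λ a → a := a :- con 0ℚ) refl (seq (u n) i)))
        (ℚ.≤-trans (ℚ.p≤p⊔q (seq (u n) i - 0ℚ) (- (seq (u n) i - 0ℚ))) (le {i} I≤i))

  slope-≤ : ∀ {q r ε} → fromℚ r <ℝ q → ∃[ I ] (∀ {i} → I ℕ.≤ i → seq q i ≤ ε) → r ≤ ε
  slope-≤ {q} {r} r<q (I , q≤ε) = let J , r≤q = <-eventually (fromℚ r) q r<q in
    ℚ.≤-trans (r≤q (ℕ.m≤n⊔m I J)) (q≤ε (ℕ.m≤m⊔n I J))

  slope²-≤ : ∀ {q r ε} n → 0ℚ < r → fromℚ r <ℝ q → ∃[ I ] (∀ {i} → I ℕ.≤ i → seq (q *ℝ q *ℝ fromℕ n) i ≤ ε) →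
      r * r * ι n ≤ ε
  slope²-≤ {q} {r} n 0<r r<q (I , q²n≤ε) = let J , r≤q = <-eventually (fromℚ r) q r<q
                                               r≤ = r≤q (ℕ.m≤n⊔m I J) in
    ℚ.≤-trans (ℚ.*-monoʳ-≤-nonNeg (ι n) {{nonNegative (0≤ι n)}}
      (Rat.*-mono-nonNeg (ℚ.<⇒≤ 0<r) (ℚ.≤-trans (ℚ.<⇒≤ 0<r) r≤) r≤ r≤)) (q²n≤ε (ℕ.m≤m⊔n I J))

  -- From q < 2r follows q²n ≤ 4r²n; hence the factor 4 in the premise.
  ≤-slope² : ∀ {q r C} n → 0ℚ < r → fromℚ r <ℝ q → q <ℝ fromℚ (r + r) → fromℚ (ι 4 * C) <ℝ q *ℝ q *ℝ fromℕ n →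
      C ≤ r * r * ι n
  ≤-slope² {q} {r} {C} n 0<r r<q q<2r 4C<q²n =
    let I , r≤q   = <-eventually (fromℚ r) q r<q
        J , q≤2r  = <-eventually q (fromℚ (r + r)) q<2r
        K , 4C≤   = <-eventually (fromℚ (ι 4 * C)) (q *ℝ q *ℝ fromℕ n) 4C<q²n
        i         = I ℕ.⊔ (J ℕ.⊔ K)
        J⊔K≤i     = ℕ.m≤n⊔m I (J ℕ.⊔ K)
        0≤q       = ℚ.≤-trans (ℚ.<⇒≤ 0<r) (r≤q (ℕ.m≤m⊔n I (J ℕ.⊔ K)))
        q≤        = q≤2r (ℕ.m⊔n≤o⇒m≤o J K J⊔K≤i)
        0≤2r      = 0≤+ (ℚ.<⇒≤ 0<r) (ℚ.<⇒≤ 0<r)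
    in ℚ.*-cancelˡ-≤-pos (ι 4) (begin
      ι 4 * C                        ≤⟨ 4C≤ (ℕ.m⊔n≤o⇒n≤o J K J⊔K≤i) ⟩
      seq q i * seq q i * ι n        ≤⟨ ℚ.*-monoʳ-≤-nonNeg (ι n) {{nonNegative (0≤ι n)}}
          (Rat.*-mono-nonNeg 0≤q 0≤2r q≤ q≤) ⟩
      (r + r) * (r + r) * ι n        ≡⟨ solve 2 (λ r n → (r :+ r) :* (r :+ r) :* n := con (ι 4) :*
          (r :* r :* n)) refl r (ι n) ⟩
      ι 4 * (r * r * ι n)            ∎)

  1≤2 : 1ℚ ≤ 2ℚ
  1≤2 = ≤-by 1ℚ refl 0≤1

  -- An approximant of x w may leave the interval from k to k + 1, so one unit is granted on each
  -- side. These units become negligible when divided by λ₁ or multiplied by r.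
  floor-eventually : ∀ x w k → D.⌊ x *ℝ fromℚ w ⌋≡ k →
    ∃[ I ] ∀ {i} → I ℕ.≤ i → ι k ≤ seq x i * w + 1ℚ × seq x i * w ≤ ι k + 2ℚ
  floor-eventually x w k (k≤ , <k) = join (≤-eventually (fromℕ k) (x *ℝ fromℚ w) k≤ 0<1) (<-eventually (x *ℝ fromℚ w)
      (fromℕ k D.+ 1ℝ) <k)
    where
    join : ∃[ I ] (∀ {i} → I ℕ.≤ i → ι k ≤ seq x i * w + 1ℚ) → ∃[ I ] (∀ {i} → I ℕ.≤ i → seq x i * w ≤ ι k + 1ℚ) →
      ∃[ I ] ∀ {i} → I ℕ.≤ i → ι k ≤ seq x i * w + 1ℚ × seq x i * w ≤ ι k + 2ℚ
    join (I , f) (J , g) = I ℕ.⊔ J , λ {i} I≤i → f (ℕ.m⊔n≤o⇒m≤o I J I≤i) ,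
      ℚ.≤-trans (g (ℕ.m⊔n≤o⇒n≤o I J I≤i)) (ℚ.+-monoʳ-≤ (ι k) 1≤2)

  ≃-eventually : ∀ y v → y D.≃ fromℚ v → ∀ {η} → 0ℚ < η → ∃[ I ] ∀ {i} → I ℕ.≤ i → ∣ seq y i - v ∣ ≤ η
  ≃-eventually y v (y≤v , v≤y) {η} 0<η = join (≤-eventually y (fromℚ v) y≤v 0<η) (≤-eventually (fromℚ v) y v≤y 0<η)
    where
    join : ∃[ I ] (∀ {i} → I ℕ.≤ i → seq y i ≤ v + η) → ∃[ I ] (∀ {i} → I ℕ.≤ i → v ≤ seq y i + η) →
      ∃[ I ] ∀ {i} → I ℕ.≤ i → ∣ seq y i - v ∣ ≤ η
    join (I , f) (J , g) = I ℕ.⊔ J , λ {i} I≤i → abs≤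
      (≤-by (v + η - seq y i) (solve 3 (λ y v η → y :- v :+ (v :+ η :- y) := η) refl (seq y i) v η)
        (gap (f (ℕ.m⊔n≤o⇒m≤o I J I≤i))))
      (≤-by (seq y i + η - v) (solve 3 (λ y v η → :- (y :- v) :+ (y :+ η :- v) := η) refl (seq y i) v η)
        (gap (g (ℕ.m⊔n≤o⇒n≤o I J I≤i))))

  graph-eventually : ∀ x y w v k → D.⌊ x *ℝ fromℚ w ⌋≡ k → y D.≃ fromℚ v → ∀ {η} → 0ℚ < η →
    ∃[ I ] ∀ {i} → I ℕ.≤ i → ι k ≤ seq x i * w + 1ℚ × seq x i * w ≤ ι k + 2ℚ × ∣ seq y i - v ∣ ≤ η
  graph-eventually x y w v k floor y≃v {η} 0<η = join (floor-eventually x w k floor) (≃-eventually y v y≃v 0<η)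
    where
    join : ∃[ I ] (∀ {i} → I ℕ.≤ i → ι k ≤ seq x i * w + 1ℚ × seq x i * w ≤ ι k + 2ℚ) → ∃[ I ] (∀ {i} → I ℕ.≤ i →
        ∣ seq y i - v ∣ ≤ η) →
      ∃[ I ] ∀ {i} → I ℕ.≤ i → ι k ≤ seq x i * w + 1ℚ × seq x i * w ≤ ι k + 2ℚ × ∣ seq y i - v ∣ ≤ η
    join (I , f) (J , g) = I ℕ.⊔ J , λ {i} I≤i → proj₁ (f (ℕ.m⊔n≤o⇒m≤o I J I≤i)) , proj₂ (f (ℕ.m⊔n≤o⇒m≤o I J I≤i)) ,
      g (ℕ.m⊔n≤o⇒n≤o I J I≤i)

  range : ∀ x → 0ℝ <ℝ x → ∃[ X ] 0ℚ ≤ X × ∃[ I ] ∀ {i} → I ℕ.≤ i → 0ℚ ≤ seq x i × seq x i ≤ X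
  range x 0<x =
    let X , 0<X , I , ≤X = bounded x
        J , 0≤x = <-eventually 0ℝ x 0<x
    in X , ℚ.<⇒≤ 0<X , I ℕ.⊔ J , λ {i} I≤i → 0≤x (ℕ.m⊔n≤o⇒n≤o I J I≤i) ,
       ℚ.≤-trans (Rat.p≤∣p∣ (seq x i)) (≤X (ℕ.m⊔n≤o⇒m≤o I J I≤i))

  ¼ ⅛₁ : ℚ
  ¼ = ½ * ½
  ⅛₁ = ½ * ¼

  -- From r²n ≤ 1/64 follows r H ≤ 1/8, so r (rn + 1 + 2H) is at most 1/64 + 1/4 + 1/4.
  slow⇒classical : ∀ {r n part} (E : ExponentialBounds r n part) → 0ℚ < r → r ≤ ¼ → r * r * ι n ≤ ⅛₁ * ⅛₁ →
      r * ι (upperNew E) ≤ 1ℚ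
  slow⇒classical {r} {n} E 0<r r≤¼ r²n≤ = begin
    r * ι (lo ℕ.+ (H ℕ.+ H))         ≡⟨ cong (r *_) (trans (ι-+ lo (H ℕ.+ H)) (cong (λ t → ι lo + t) (ι-+ H H))) ⟩
    r * (ι lo + (ι H + ι H))         ≤⟨ ≤-by (r * (r * ι n + 1ℚ - ι lo) + (⅛₁ * ⅛₁ - r * r * ι n) + (¼ - r) +
        ((⅛₁ - r * ι H) + (⅛₁ - r * ι H)) + (½ - ⅛₁ * ⅛₁))
                                          (solve 4 (λ r n lo H →
                                              r :* (lo :+ (H :+ H)) :+ (r :* (r :* n :+ con 1ℚ :- lo) :+ (con
                                              (⅛₁ * ⅛₁) :- r :* r :* n) :+ (con ¼ :- r)
                                              :+ ((con ⅛₁ :- r :* H) :+ (con ⅛₁ :- r :* H)) :+ con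
                                                  (½ - ⅛₁ * ⅛₁)) := con 1ℚ) refl r (ι n) (ι lo) (ι H))
                                          (0≤+ (0≤+ (0≤+ (0≤+ (0≤* 0≤r (gap lo≤rn+1)) (gap r²n≤)) (gap r≤¼)) (0≤+
                                              (gap rH≤⅛) (gap rH≤⅛))) (ℚ.nonNegative⁻¹ (½ - ⅛₁ * ⅛₁))) ⟩
    1ℚ                               ∎
    where
    open ExponentialBounds E
    0≤r = ℚ.<⇒≤ 0<r
    rH≤⅛ : r * ι H ≤ ⅛₁
    rH≤⅛ = square-cancel-≤ (ℚ.nonNegative⁻¹ ⅛₁) (begin
      r * ι H * (r * ι H)      ≡⟨ solve 2 (λ r H → r :* H :* (r :* H) := r :* r :* (H :* H)) refl r (ι H) ⟩
      r * r * (ι H * ι H)      ≡⟨ cong (r * r *_) (ι-* H H) ⟨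
      r * r * ι (H ℕ.* H)      ≤⟨ ℚ.*-monoˡ-≤-nonNeg (r * r) {{nonNegative (0≤* 0≤r 0≤r)}} (ι-mono-≤ H²≤n) ⟩
      r * r * ι n              ≤⟨ r²n≤ ⟩
      ⅛₁ * ⅛₁                  ∎)

  triangular-at : ∀ {n x w X k} (part : ℕ → ℕ) .{{_ : NonZero (part 0)}} → TriangularBounds n part → w ≡ + n / part 0 →
    0ℚ ≤ x → x ≤ X → ι k ≤ x * w + 1ℚ → x * w ≤ ι k + 2ℚ →
    ∣ (+ part k / part 0) - ((1ℚ + - (x * ½)) ⊔ 0ℚ) ∣ ≤ ι 6 * (1ℚ + X) * (+ 1 / part 0)
  triangular-at {n} {x} {w} {X} {k} part T w≡ 0≤x x≤X k≤ ≤k =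
    triangular-estimate {ι n} {ι l} {ι (part k)} {ι k} {x} {u} {w} {+ part k / l} {X}
      (/≡ι* 1 l) (ℚ.nonNegative⁻¹ u {{ℚ.normalize-nonNeg 1 l}}) (/≡ι* (part k) l) (trans (cong (_* ι l) w≡) (/≡ι* n l))
      0≤x x≤X k≤ ≤k
      (subst₂ _≤_ (ι-* l l) (trans (ι-+ (2 ℕ.* n) (3 ℕ.* l)) (cong₂ _+_ (ι-* 2 n) (ι-* 3 l))) (ι-mono-≤ l²≤))
      (subst₂ _≤_ (ι-* 2 n) (trans (ι-+ (l ℕ.* l) (11 ℕ.* l)) (cong₂ _+_ (ι-* l l) (ι-* 11 l))) (ι-mono-≤ 2n≤))
      (0≤ι (part k))
      (subst (ι l ≤_) (trans (ι-+ (part k) (k ℕ.+ 2)) (cong (λ t → ι (part k) + t) (ι-+ k 2))) (ι-mono-≤ (part-lo k)))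
      (hi (part-hi k))
    where
    open TriangularBounds T
    u = + 1 / l
    hi : part k ℕ.+ k ℕ.≤ l ℕ.+ 2 ⊎ part k ≡ 0 → ι (part k) + ι k ≤ ι l + 2ℚ ⊎ ι (part k) ≡ 0ℚ
    hi (inj₁ le) = inj₁ (subst₂ _≤_ (ι-+ (part k) k) (ι-+ l 2) (ι-mono-≤ le))
    hi (inj₂ eq) = inj₂ (cong ι eq)

  recip-small : ∀ {e K l} .{{_ : NonZero l}} → 1ℚ ≤ ι K * e → 0ℚ ≤ e → K ℕ.≤ l → (+ 1 / l) ≤ e
  recip-small {e} {K} {l} 1≤Ke 0≤e K≤l = begin
    u              ≡⟨ ℚ.*-identityʳ u ⟨
    u * 1ℚ         ≤⟨ ℚ.*-monoˡ-≤-nonNeg u {{ℚ.normalize-nonNeg 1 l}} (ℚ.≤-trans 1≤Ke (ℚ.*-monoʳ-≤-nonNeg e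
        {{nonNegative 0≤e}} (ι-mono-≤ K≤l))) ⟩
    u * (ι l * e)  ≡⟨ ℚ.*-assoc u (ι l) e ⟨
    u * ι l * e    ≡⟨ cong (_* e) (/≡ι* 1 l) ⟩
    1ℚ * e         ≡⟨ ℚ.*-identityˡ e ⟩
    e              ∎
    where u = + 1 / l

  exceed : ∀ {e} → 0ℚ < e → ∃[ K ] 1ℚ ≤ ι K * e
  exceed {e} 0<e = let g , _ , ge≡1 = divide 0<1 0<e
                       K , g<K = Rat.below-ℕ g
                   in K , subst (_≤ ι K * e) ge≡1 (ℚ.*-monoʳ-≤-nonNeg e {{nonNegative (ℚ.<⇒≤ 0<e)}} (ℚ.<⇒≤ g<K))

  -- The index k is tied to x only through rational inequalities on approximants, so the bound does
  -- not mention the floor of a real.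
  ShapeBound : (n : ℕ) (part : ℕ → ℕ) .{{_ : NonZero (part 0)}} → ℝ → ℝ → ℚ → Set
  ShapeBound n part x y ε = ∃[ I ] ∀ {i} → I ℕ.≤ i → ∀ k →
    ι k ≤ seq x i * (+ n / part 0) + 1ℚ → seq x i * (+ n / part 0) ≤ ι k + 2ℚ → ∣ (+ part k / part 0) - seq y i ∣ ≤ ε

  dist-halves : ∀ a v t {ε} → ∣ a - v ∣ ≤ ½ * ε → ∣ v - t ∣ ≤ ½ * ε → ∣ a - t ∣ ≤ ε
  dist-halves a v t {ε} av vt = ℚ.≤-trans (Rat.dist-triangle a v t) (ℚ.≤-trans (ℚ.+-mono-≤ av vt) (ℚ.≤-reflexive
      (Rat.half+half ε)))

  triangular-bound : ∀ {ε X e K n} (part : ℕ → ℕ) .{{_ : NonZero (part 0)}} x → 0ℚ ≤ X → 0ℚ < e →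
      e * (ι 6 * (1ℚ + X)) ≡ ε → 1ℚ ≤ ι K * e →
    ∃[ I ] (∀ {i} → I ℕ.≤ i → 0ℚ ≤ seq x i × seq x i ≤ X) → K ℕ.* K ℕ.+ 11 ℕ.* K ℕ.< n → TriangularBounds n part →
    ShapeBound n part x (triangular x) ε
  triangular-bound {ε} {X} {e} {K} {n} part x 0≤X 0<e eC≡ε 1≤Ke (I , x∈) K<n T = I , λ {i} I≤i k k≤ ≤k →
    ℚ.≤-trans (triangular-at {n} {seq x i} {+ n / part 0} {X} {k} part T refl (proj₁ (x∈ I≤i)) (proj₂
        (x∈ I≤i)) k≤ ≤k) small
    where
    -- A large n forces a large l, because 2n ≤ l² + 11l.
    K≤l : K ℕ.≤ part 0
    K≤l = ℕ.≮⇒≥ λ l<K → ℕ.<⇒≱ K<n (ℕ.≤-trans (ℕ.m≤m+n n (n ℕ.+ 0)) (ℕ.≤-trans (TriangularBounds.2n≤ T)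
      (ℕ.+-mono-≤ (ℕ.*-mono-≤ (ℕ.<⇒≤ l<K) (ℕ.<⇒≤ l<K)) (ℕ.*-monoʳ-≤ 11 (ℕ.<⇒≤ l<K)))))
    small : ι 6 * (1ℚ + X) * (+ 1 / part 0) ≤ ε
    small = begin
      ι 6 * (1ℚ + X) * (+ 1 / part 0)  ≤⟨ ℚ.*-monoˡ-≤-nonNeg (ι 6 * (1ℚ + X)) {{nonNegative (0≤* (0≤ι 6)
          (0≤+ 0≤1 0≤X))}}
                                            (recip-small {e} {K} 1≤Ke (ℚ.<⇒≤ 0<e) K≤l) ⟩
      ι 6 * (1ℚ + X) * e               ≡⟨ ℚ.*-comm (ι 6 * (1ℚ + X)) e ⟩
      e * (ι 6 * (1ℚ + X))             ≡⟨ eC≡ε ⟩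
      ε                                ∎

  expTerm-seq : ∀ y j i → seq (D.expTerm y j) i ≡ term j (seq y i)
  expTerm-seq y zero    i = refl
  expTerm-seq y (suc j) i = cong (_* (seq y i * recip j)) (expTerm-seq y j i)

  expSum-seq : ∀ y j i → seq (expSum y j) i ≡ expPoly j (seq y i)
  expSum-seq y zero    i = refl
  expSum-seq y (suc j) i = cong₂ _+_ (expSum-seq y j i) (expTerm-seq y (suc j) i)

  0<ι : ∀ m .{{_ : NonZero m}} → 0ℚ < ι m
  0<ι m = ι-mono-< {0} {m} (ℕ.>-nonZero⁻¹ m)

  module _ {r η δ X : ℚ} {n k : ℕ} {x : ℚ} (part : ℕ → ℕ) .{{_ : NonZero (part 0)}} .{{_ : NonZero n}} (E : ExponentialBounds r n part)
    (0<r : 0ℚ < r) (r≤1 : r ≤ 1ℚ) (0<η : 0ℚ < η) (0≤x : 0ℚ ≤ x) (x≤X : x ≤ X)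
    (k≤ : ι k ≤ x * (+ n / part 0) + 1ℚ) (≤k : x * (+ n / part 0) ≤ ι k + 2ℚ)
    (1≤ηr²n : 1ℚ ≤ η * (r * r * ι n)) (9≤η²r²n : 3ℚ * 3ℚ ≤ η * η * (r * r * ι n)) where
    open ExponentialBounds E

    private
      l = part 0
      P = pow (1ℚ - r) k

      hi≡ : ι (lo ℕ.+ (H ℕ.+ H)) ≡ ι lo + (ι H + ι H)
      hi≡ = trans (ι-+ lo (H ℕ.+ H)) (cong (λ t → ι lo + t) (ι-+ H H))

      1-r≤1 : 1ℚ - r ≤ 1ℚ
      1-r≤1 = ≤-by r (solve 1 (λ r → (con 1ℚ :- r) :+ r := con 1ℚ) refl r) (ℚ.<⇒≤ 0<r)

      l≤hi : ι l ≤ ι lo + (ι H + ι H)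
      l≤hi = subst (ι l ≤_) hi≡ (ι-mono-≤ ≤hi)

      H² : ι H * ι H ≤ ι n
      H² = subst (_≤ ι n) (ι-* H H) (ι-mono-≤ H²≤n)

      λ-hi : ι (part k) ≤ P * (ι lo + (ι H + ι H))
      λ-hi = subst (λ h → ι (part k) ≤ P * h) hi≡ (part-hi k)

    shape-at : ∣ (+ part k / l) - P ∣ ≤ η + η
    shape-at = shape-estimate {r} {ι n} {ι l} {ι lo} {ι H} {ι (part k)} {x} {+ part k / l} {+ n / l} {X} {η} {δ} {P}
        {ι k}
      0<r (0<ι l) (0<ι n) 0<η (/≡ι* (part k) l) (/≡ι* n l) 0≤x x≤X k≤ ≤k rn≤lo lo≤rn+1
      H² (ι-mono-≤ 1≤H) (ι-mono-≤ lo≤) l≤hi (pow-nonNeg (gap r≤1) k) (pow≤1 (gap r≤1) 1-r≤1 k) λ-hi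
          (part-lo k) 1≤ηr²n 9≤η²r²n

    time-at : X * η + 2ℚ * r ≤ δ → ∣ x - ι k * r ∣ ≤ δ
    time-at = time-estimate {r} {ι n} {ι l} {ι lo} {ι H} {ι (part k)} {x} {+ part k / l} {+ n / l} {X} {η} {δ} {P} {ι k}
      0<r (0<ι l) (0<ι n) 0<η (/≡ι* (part k) l) (/≡ι* n l) 0≤x x≤X k≤ ≤k rn≤lo lo≤rn+1
      H² (ι-mono-≤ 1≤H) (ι-mono-≤ lo≤) l≤hi (pow-nonNeg (gap r≤1) k) (pow≤1 (gap r≤1) 1-r≤1 k) λ-hi
          (part-lo k) 1≤ηr²n 9≤η²r²n

  ExpApprox : ℚ → ℚ → ℚ → ℕ → Set
  ExpApprox X ε δ I = ∀ {i q k x} → I ℕ.≤ i → 0ℚ ≤ q → q ≤ δ → 0ℚ ≤ x → x ≤ X → ∣ x - ι k * q ∣ ≤ δ →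
    ∣ expPoly i (- x) - pow (1ℚ - q) k ∣ ≤ ε

  -- The power (1 - r)^k mediates: `shape-at` puts the rescaled part within ε/2 of it, and since k r
  -- is close to x by `time-at`, so does `approx` for the exponential.
  exponential-bound : ∀ {ε X δ η r n} (part : ℕ → ℕ) .{{_ : NonZero (part 0)}} .{{_ : NonZero n}} x I₀ →
    ExpApprox X (½ * ε) δ I₀ → ∃[ I ] (∀ {i} → I ℕ.≤ i → 0ℚ ≤ seq x i × seq x i ≤ X) →
    ExponentialBounds r n part → 0ℚ < r → r ≤ 1ℚ → r ≤ δ → 0ℚ < η → η + η ≤ ½ * ε → X * η + 2ℚ * r ≤ δ →
    1ℚ ≤ η * (r * r * ι n) → 3ℚ * 3ℚ ≤ η * η * (r * r * ι n) → ShapeBound n part x (exponential x) ε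
  exponential-bound {ε} {X} {δ} {η} {r} {n} part x I₀ approx
      (I₁ , x∈) E 0<r r≤1 r≤δ 0<η 2η≤ Xη+2r≤δ c₁ c₂ = I₀ ℕ.⊔ I₁ , bound
    where
    bound : ∀ {i} → I₀ ℕ.⊔ I₁ ℕ.≤ i → ∀ k → ι k ≤ seq x i * (+ n / part 0) + 1ℚ → seq x i * (+ n / part 0) ≤ ι k + 2ℚ →
      ∣ (+ part k / part 0) - seq (exponential x) i ∣ ≤ ε
    bound {i} I≤i k k≤ ≤k = dist-halves (+ part k / part 0) P (seq (exponential x) i)
      (ℚ.≤-trans (shape-at {r} {η} {δ} {X} {n} {k} {seq x i} part E 0<r r≤1 0<η 0≤x x≤X k≤ ≤k c₁ c₂) 2η≤)
      (subst (λ p → ∣ P - p ∣ ≤ ½ * ε) (sym (expSum-seq (-ℝ x) i i))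
        (ℚ.≤-trans (ℚ.≤-reflexive (Rat.dist-comm P (expPoly i (- seq x i))))
          (approx {i} {r} {k} {seq x i} (ℕ.m⊔n≤o⇒m≤o I₀ I₁ I≤i) (ℚ.<⇒≤ 0<r) r≤δ 0≤x x≤X
            (time-at {r} {η} {δ} {X} {n} {k} {seq x i} part E 0<r r≤1 0<η 0≤x x≤X k≤ ≤k c₁ c₂ Xη+2r≤δ))))
      where
      P = pow (1ℚ - r) k
      0≤x = proj₁ (x∈ (ℕ.m⊔n≤o⇒n≤o I₀ I₁ I≤i))
      x≤X = proj₂ (x∈ (ℕ.m⊔n≤o⇒n≤o I₀ I₁ I≤i))

  -- η ≤ ε/4 serves the shape error 2η, and η ≤ δ/(2(1 + X)) keeps X η below half of δ; the other
  -- half pays for 2r when r ≤ δ/4.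
  tune : ∀ {ε X δ} → 0ℚ < ε → 0ℚ ≤ X → 0ℚ < δ → ∃[ η ] ∃[ C ] 0ℚ < η × η + η ≤ ½ * ε ×
    (∀ {r} → r ≤ ¼ * δ → r ≤ δ × X * η + 2ℚ * r ≤ δ) × (∀ {s} → C ≤ s → 1ℚ ≤ η * s × 3ℚ * 3ℚ ≤ η * η * s)
  tune {ε} {X} {δ} 0<ε 0≤X 0<δ = choose (divide {d = 1ℚ + X} (Rat.half-pos 0<δ) (0<+ 0<1 0≤X))
    where
    Goal : Set
    Goal = ∃[ η ] ∃[ C ] 0ℚ < η × η + η ≤ ½ * ε ×
      (∀ {r} → r ≤ ¼ * δ → r ≤ δ × X * η + 2ℚ * r ≤ δ) × (∀ {s} → C ≤ s → 1ℚ ≤ η * s × 3ℚ * 3ℚ ≤ η * η * s)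
    choose : ∃[ e ] 0ℚ < e × e * (1ℚ + X) ≡ ½ * δ → Goal
    choose (e , 0<e , e≡) = invert η 0<η (ℚ.p⊓q≤p (¼ * ε) e) (ℚ.p⊓q≤q (¼ * ε) e) (divide 0<1 0<η)
      where
      η = ¼ * ε ⊓ e
      0<η : 0ℚ < η
      0<η = 0<⊓ (0<* (ℚ.positive⁻¹ ¼) 0<ε) 0<e
      invert : ∀ η → 0ℚ < η → η ≤ ¼ * ε → η ≤ e → ∃[ g ] 0ℚ < g × g * η ≡ 1ℚ → Goal
      -- With g = 1/η, the threshold C = g + 9g² gives both η C ≥ 1 and η² C ≥ 9.
      invert η 0<η η≤ε/4 η≤e (g , 0<g , gη≡1) = η , g + ι 9 * g * g , 0<η ,
        ≤-by ((¼ * ε - η) + (¼ * ε - η)) (solve 2 (λ η ε → η :+ η :+ ((con ¼ :* ε :- η) :+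
            (con ¼ :* ε :- η)) := con ½ :* ε) refl η ε)
          (0≤+ (gap η≤ε/4) (gap η≤ε/4)) ,
        (λ {r} r≤ → ≤-by ((¼ * δ - r) + (½ + ¼) * δ) (solve 2 (λ r δ →
            r :+ ((con ¼ :* δ :- r) :+ con (½ + ¼) :* δ) := δ) refl r δ)
            (0≤+ (gap r≤) (0≤* (ℚ.nonNegative⁻¹ (½ + ¼)) (ℚ.<⇒≤ 0<δ))) ,
          (begin
            X * η + 2ℚ * r              ≤⟨ ≤-by (X * (e - η) + e + 2ℚ * (¼ * δ - r))
                                             (solve 5 (λ X η e r δ →
                                                 X :* η :+ con 2ℚ :* r :+ (X :* (e :- η) :+ e :+ con 2ℚ :*
                                                 (con ¼ :* δ :- r))
                                               := e :* (con 1ℚ :+ X) :+ con ½ :* δ) refl X η e r δ)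
                                             (0≤+ (0≤+ (0≤* 0≤X (gap η≤e)) (ℚ.<⇒≤ 0<e)) (0≤* (0≤+ 0≤1 0≤1) (gap r≤))) ⟩
            e * (1ℚ + X) + ½ * δ        ≡⟨ cong (_+ ½ * δ) e≡ ⟩
            ½ * δ + ½ * δ               ≡⟨ Rat.half+half δ ⟩
            δ                           ∎)) ,
        (λ {s} C≤s → (begin
            1ℚ                          ≤⟨ ≤-by (ι 9 * g) refl (0≤* (0≤ι 9) (ℚ.<⇒≤ 0<g)) ⟩
            1ℚ + ι 9 * g                ≡⟨ solve 1 (λ g → con 1ℚ :+ con (ι 9) :* g := con 1ℚ :+ con
                (ι 9) :* g :* con 1ℚ) refl g ⟩
            1ℚ + ι 9 * g * 1ℚ           ≡⟨ cong (λ t → t + ι 9 * g * t) gη≡1 ⟨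
            g * η + ι 9 * g * (g * η)   ≡⟨ solve 2 (λ g η → g :* η :+ con (ι 9) :* g :* (g :* η) := η :* (g :+ con
                (ι 9) :* g :* g)) refl g η ⟩
            η * (g + ι 9 * g * g)       ≤⟨ ℚ.*-monoˡ-≤-nonNeg η {{nonNegative (ℚ.<⇒≤ 0<η)}} C≤s ⟩
            η * s                       ∎) ,
          (begin
            3ℚ * 3ℚ                     ≤⟨ ≤-by η (solve 1 (λ η →
                con (3ℚ * 3ℚ) :+ η := con 1ℚ :* η :+ con (ι 9) :* con 1ℚ :* con 1ℚ) refl η) (ℚ.<⇒≤ 0<η) ⟩
            1ℚ * η + ι 9 * 1ℚ * 1ℚ      ≡⟨ cong (λ t → t * η + ι 9 * t * t) gη≡1 ⟨
            g * η * η + ι 9 * (g * η) * (g * η)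
              ≡⟨ solve 2 (λ g η → g :* η :* η :+ con (ι 9) :* (g :* η) :* (g :* η) := η :* η :* (g :+ con
                  (ι 9) :* g :* g)) refl g η ⟩
            η * η * (g + ι 9 * g * g)   ≤⟨ ℚ.*-monoˡ-≤-nonNeg (η * η) {{nonNegative (0≤* (ℚ.<⇒≤ 0<η)
                (ℚ.<⇒≤ 0<η))}} C≤s ⟩
            η * η * s                   ∎))

  module _ (q : ℕ → ℝ) (0<q≤1 : ∀ n → .{{_ : NonZero n}} → 0ℝ <ℝ q n × q n ≤ℝ 1ℝ) (q→0 : q ⟶ 0ℝ)
    (f : ∀ n → Partition n → Partition n) (move : ∀ n → .{{_ : NonZero n}} → IsMoveMap (q n) (f n)) where

    Slope : ℕ → ℚ → Set
    Slope n r = 0ℚ < r × r ≤ 1ℚ × fromℚ r <ℝ q n × q n <ℝ fromℚ (r + r)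

    -- The threshold N precedes the parts and the slope r: r depends on the orbit, and the limit
    -- must hold for every choice of recurrent configurations.
    EventuallyBound : ℝ → ℝ → Set
    EventuallyBound x y = ∀ {ε} → 0ℚ < ε → ∃[ N ] ∀ n .{{_ : NonZero n}} → N ℕ.≤ n →
      ∀ part .{{_ : NonZero (part 0)}} r → Slope n r → Bounds r n part → ShapeBound n part x y ε

    limit-shape : ∀ φ → (∀ x → 0ℝ <ℝ x → EventuallyBound x (φ x)) → IsLimitShape f φ
    limit-shape φ bound μ rec x 0<x y graph = ⟶-intro y (φ x) λ {ε} 0<ε → close ε 0<ε (bound x 0<x (Rat.half-pos 0<ε))
      where
      close : ∀ ε → 0ℚ < ε → ∃[ N ] (∀ n .{{_ : NonZero n}} → N ℕ.≤ n →
          ∀ part .{{_ : NonZero (part 0)}} r → Slope n r → Bounds r n part → ShapeBound n part x (φ x) (½ * ε)) →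
        ∃[ N ] ∀ n → N ℕ.≤ n → ∃[ I ] ∀ {i} → I ℕ.≤ i → ∣ seq (y n) i - seq (φ x) i ∣ ≤ ε
      -- The successor excludes n = 0, where `y` is unconstrained.
      close ε 0<ε (N , b) = suc N , λ { (suc n) N<n → at n (ℕ.<⇒≤ N<n) }
        where
        at : ∀ n-1 → let n = suc n-1 in N ℕ.≤ n → ∃[ I ] ∀ {i} → I ℕ.≤ i → ∣ seq (y n) i - seq (φ x) i ∣ ≤ ε
        at n-1 N≤n = go (rational-slope (q n) (f n) (proj₁ (0<q≤1 n)) (proj₂ (0<q≤1 n)) (move n) (μ n) (rec n))
            (graph n)
          where
          n = suc n-1
          instance _ = largest-nonZero (μ n)
          go : ∃[ r ] 0ℚ < r × fromℚ r <ℝ q n × q n <ℝ fromℚ (r + r) × Bounds r n (part (μ n)) → ∂[ μ n ] x ≡ y n →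
            ∃[ I ] ∀ {i} → I ℕ.≤ i → ∣ seq (y n) i - seq (φ x) i ∣ ≤ ε
          go (r , 0<r , r<q , q<2r , B) (k , floor , y≃v) =
            join (b n N≤n (part (μ n)) r (0<r , RealExtra.fromℚ-≤ {q n} {r} {1ℚ} r<q (proj₂ (0<q≤1 n)) , r<q , q<2r) B)
              (graph-eventually x (y n) (+ n / part (μ n) 0) (+ part (μ n) k / part (μ n) 0) k floor y≃v
                  (Rat.half-pos 0<ε))
            where
            join : ShapeBound n (part (μ n)) x (φ x) (½ * ε) →
              ∃[ I ] (∀ {i} → I ℕ.≤ i → ι k ≤ seq x i * (+ n / part (μ n) 0) + 1ℚ ×
                  seq x i * (+ n / part (μ n) 0) ≤ ι k + 2ℚ ×
                ∣ seq (y n) i - (+ part (μ n) k / part (μ n) 0) ∣ ≤ ½ * ε) →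
              ∃[ I ] ∀ {i} → I ℕ.≤ i → ∣ seq (y n) i - seq (φ x) i ∣ ≤ ε
            join (I , shape) (J , near) = I ℕ.⊔ J , λ {i} I≤i →
              let k≤ , ≤k , y≈v = near (ℕ.m⊔n≤o⇒n≤o I J I≤i) in
              dist-halves (seq (y n) i) (+ part (μ n) k / part (μ n) 0) (seq (φ x) i) y≈v
                (shape (ℕ.m⊔n≤o⇒m≤o I J I≤i) k k≤ ≤k)

    triangular-limit : (λ n → q n *ℝ q n *ℝ fromℕ n) ⟶ 0ℝ → IsLimitShape f triangular
    triangular-limit q²n→0 = limit-shape triangular λ x 0<x {ε} 0<ε → go x 0<ε (range x 0<x)
      where
      go : ∀ x {ε} → 0ℚ < ε → ∃[ X ] 0ℚ ≤ X × ∃[ I ] (∀ {i} → I ℕ.≤ i → 0ℚ ≤ seq x i × seq x i ≤ X) →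
        ∃[ N ] ∀ n .{{_ : NonZero n}} → N ℕ.≤ n →
          ∀ part .{{_ : NonZero (part 0)}} r → Slope n r → Bounds r n part → ShapeBound n part x (triangular x) ε
      go x {ε} 0<ε (X , 0≤X , x∈) =
        let e , 0<e , eC≡ε = divide {d = ι 6 * (1ℚ + X)} 0<ε (0<* (ℚ.positive⁻¹ (ι 6)) (0<+ 0<1 0≤X))
            K , 1≤Ke = exceed 0<e
            N₁ , q-small = ⟶0-elim q q→0 {¼} (ℚ.positive⁻¹ ¼)
            N₂ , q²n-small = ⟶0-elim (λ n → q n *ℝ q n *ℝ fromℕ n) q²n→0 {⅛₁ * ⅛₁} (ℚ.positive⁻¹ (⅛₁ * ⅛₁))
            N₃ = suc (K ℕ.* K ℕ.+ 11 ℕ.* K)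
        in (N₁ ℕ.⊔ N₂) ℕ.⊔ N₃ , λ n N≤n part r (0<r , _ , r<q , _) (E , classical) →
          let N₁₂≤n = ℕ.m⊔n≤o⇒m≤o (N₁ ℕ.⊔ N₂) N₃ N≤n in
          triangular-bound {ε} {X} {e} {K} {n} part x 0≤X 0<e eC≡ε 1≤Ke x∈ (ℕ.m⊔n≤o⇒n≤o (N₁ ℕ.⊔ N₂) N₃ N≤n)
            (classical (slow⇒classical E 0<r (slope-≤ {q n} {r} {¼} r<q (q-small n (ℕ.m⊔n≤o⇒m≤o N₁ N₂ N₁₂≤n)))
              (slope²-≤ {q n} {r} {⅛₁ * ⅛₁} n 0<r r<q (q²n-small n (ℕ.m⊔n≤o⇒n≤o N₁ N₂ N₁₂≤n)))))

    exponential-limit : (λ n → q n *ℝ q n *ℝ fromℕ n) ⟶∞ → IsLimitShape f exponential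
    exponential-limit q²n→∞ = limit-shape exponential λ x 0<x {ε} 0<ε → go x 0<ε (range x 0<x)
      where
      Result : ℝ → ℚ → Set
      Result x ε = ∃[ N ] ∀ n .{{_ : NonZero n}} → N ℕ.≤ n →
          ∀ part .{{_ : NonZero (part 0)}} r → Slope n r → Bounds r n part → ShapeBound n part x (exponential x) ε
      go : ∀ x {ε} → 0ℚ < ε → ∃[ X ] 0ℚ ≤ X × ∃[ I ] (∀ {i} → I ℕ.≤ i → 0ℚ ≤ seq x i × seq x i ≤ X) → Result x ε
      go x {ε} 0<ε (X , 0≤X , x∈) = withApprox (exp-approx 0≤X (Rat.half-pos 0<ε))
        where
        withApprox : ∃[ δ ] 0ℚ < δ × ∃[ I ] ExpApprox X (½ * ε) δ I → Result x ε
        withApprox (δ , 0<δ , I₀ , approx) =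
          let η , C , 0<η , 2η≤ , r-small , s-large = tune 0<ε 0≤X 0<δ
              N₁ , q-small = ⟶0-elim q q→0 {¼ * δ} (0<* (ℚ.positive⁻¹ ¼) 0<δ)
              N₂ , q²n-large = q²n→∞ (fromℚ (ι 4 * C))
          in N₁ ℕ.⊔ N₂ , λ n N≤n part r (0<r , r≤1 , r<q , q<2r) (E , _) →
            let r≤δ , Xη+2r≤δ = r-small (slope-≤ {q n} {r} {¼ * δ} r<q (q-small n (ℕ.m⊔n≤o⇒m≤o N₁ N₂ N≤n)))
                c₁ , c₂ = s-large (≤-slope² {q n} {r} {C} n 0<r r<q q<2r (q²n-large n (ℕ.m⊔n≤o⇒n≤o N₁ N₂ N≤n)))
            in exponential-bound {ε} {X} {δ} {η} {r} {n} part x I₀ (λ {i} {q} {k} {x} → approx {i} {q} {k} {x}) x∈ E 0<r r≤1 r≤δ 0<η 2η≤ Xη+2r≤δ c₁ c₂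

open import Defs

mainTheorem7 : (q : ℕ → ℝ) →
    (∀ n → .{{_ : NonZero n}} → 0ℝ < q n × q n ≤ 1ℝ) →
    q ⟶ 0ℝ →
    (f : ∀ n → Partition n → Partition n) →
    (∀ n → .{{_ : NonZero n}} → IsMoveMap (q n) (f n)) →
    ((λ n → q n * q n * fromℕ n) ⟶ 0ℝ → IsLimitShape f triangular) ×
    ((λ n → q n * q n * fromℕ n) ⟶∞ → IsLimitShape f exponential)
mainTheorem7 q 0<q≤1 q→0 f move =
  Limits.triangular-limit q 0<q≤1 q→0 f move , Limits.exponential-limit q 0<q≤1 q→0 f move
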